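{- For every natural number $n \geq 1$, setting $m = 10^{5n}$, we have $\mathbb{E}^n \not\longrightarrow (\ell_2, \ell_m)$; that is, there exists a red/blue-coloring of $\mathbb{E}^n$ which contains no two red points at distance exactly one and no blue isometric copy of $\ell_m$.
   Context: $\mathbb{E}^n$ denotes $\mathbb{R}^n$ with the Euclidean distance. A red/blue-coloring of $\mathbb{E}^n$ is an arbitrary assignment of one of the two colors to each point. $\ell_m$ denotes a sequence of $m$ points on a line with consecutive points at distance one (i.e. an isometric copy of $\{0,1,\dots,m-1\} \subset \mathbb{R}$), so $\ell_2$ is a pair of points at distance one. A copy of a set means an isometric copy; it is red (blue) if all its points are red (blue). $\mathbb{E}^n \not\longrightarrow (\ell_2,K)$ means that some red/blue-coloring of $\mathbb{E}^n$ contains neither a red copy of $\ell_2$ nor a blue copy of $K$. -}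

module Defs where

open import Level using (0ℓ)
open import Data.Nat.Base as ℕ using (ℕ)
import Data.Nat.Properties as ℕ
open import Data.Integer.Base using (+_)
open import Data.Rational.Base as ℚ using (ℚ; 0ℚ; 1ℚ; ½; ∣_∣)
import Data.Rational.Properties as ℚ
open import Data.Rational.Solver using (module +-*-Solver)
open import Data.Fin.Base using (Fin; toℕ)
open import Data.Vec.Functional using (Vector; foldr)
import Data.Vec.Functional.Relation.Binary.Equality.Setoid as VecEq
open import Data.Product.Base using (Σ; ∃; _×_; _,_; proj₁; proj₂)
open import Function.Bundles using (_⟶ₛ_; _⟨$⟩_; _⇔_)
open import Relation.Nullary.Negation.Core using (¬_)
open import Relation.Binary.Bundles using (Setoid)
open import Relation.Binary.PropositionalEquality
  using (_≡_; refl; sym; cong; cong₂; subst; module ≡-Reasoning)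
  renaming (setoid to ≡-setoid)

IsNull : (ℕ → ℚ) → Set
IsNull u = ∀ ε → 0ℚ ℚ.< ε → ∃ λ N → ∀ k → N ℕ.≤ k → ∣ u k ∣ ℚ.< ε

IsCauchy : (ℕ → ℚ) → Set
IsCauchy u = ∀ ε → 0ℚ ℚ.< ε →
  ∃ λ N → ∀ i j → N ℕ.≤ i → N ℕ.≤ j → ∣ u i ℚ.- u j ∣ ℚ.< ε

half-pos : ∀ {ε} → 0ℚ ℚ.< ε → 0ℚ ℚ.< ½ ℚ.* ε
half-pos {ε} 0<ε = subst (ℚ._< ½ ℚ.* ε) (ℚ.*-zeroʳ ½) (ℚ.*-monoʳ-<-pos ½ 0<ε)

halves : ∀ ε → ½ ℚ.* ε ℚ.+ ½ ℚ.* ε ≡ ε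
halves ε = begin
  ½ ℚ.* ε ℚ.+ ½ ℚ.* ε  ≡⟨ ℚ.*-distribʳ-+ ε ½ ½ ⟨
  1ℚ ℚ.* ε             ≡⟨ ℚ.*-identityˡ ε ⟩
  ε                    ∎
  where
  open ≡-Reasoning

abs-self-diff : ∀ p → ∣ p ℚ.- p ∣ ≡ 0ℚ
abs-self-diff p = cong ∣_∣ (ℚ.+-inverseʳ p)

abs-diff-sym : ∀ p q → ∣ p ℚ.- q ∣ ≡ ∣ q ℚ.- p ∣
abs-diff-sym p q = begin
  ∣ p ℚ.- q ∣        ≡⟨ cong ∣_∣ (solve 2 (λ p q → p :- q := :- (q :- p)) refl p q) ⟩
  ∣ ℚ.- (q ℚ.- p) ∣  ≡⟨ ℚ.∣-p∣≡∣p∣ (q ℚ.- p) ⟩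
  ∣ q ℚ.- p ∣        ∎
  where
  open ≡-Reasoning
  open +-*-Solver

abs-diff-trans : ∀ p q r → ∣ p ℚ.- r ∣ ℚ.≤ ∣ p ℚ.- q ∣ ℚ.+ ∣ q ℚ.- r ∣
abs-diff-trans p q r = begin
  ∣ p ℚ.- r ∣
    ≡⟨ cong ∣_∣ (solve 3 (λ p q r → p :- r := (p :- q) :+ (q :- r)) refl p q r) ⟩
  ∣ (p ℚ.- q) ℚ.+ (q ℚ.- r) ∣
    ≤⟨ ℚ.∣p+q∣≤∣p∣+∣q∣ (p ℚ.- q) (q ℚ.- r) ⟩
  ∣ p ℚ.- q ∣ ℚ.+ ∣ q ℚ.- r ∣
    ∎
  where
  open ℚ.≤-Reasoning
  open +-*-Solver

const-cauchy : ∀ q → IsCauchy (λ _ → q)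
const-cauchy q ε 0<ε =
  0 , λ _ _ _ _ → subst (ℚ._< ε) (sym (abs-self-diff q)) 0<ε

neg-cauchy : ∀ u → IsCauchy u → IsCauchy (λ k → ℚ.- u k)
neg-cauchy u cu ε 0<ε with cu ε 0<ε
... | N , p = N , λ i j N≤i N≤j → subst (ℚ._< ε) (eq (u i) (u j)) (p i j N≤i N≤j)
  where
  open +-*-Solver
  eq : ∀ a b → ∣ a ℚ.- b ∣ ≡ ∣ ℚ.- a ℚ.- (ℚ.- b) ∣
  eq a b = begin
    ∣ a ℚ.- b ∣              ≡⟨ abs-diff-sym a b ⟩
    ∣ b ℚ.- a ∣              ≡⟨ cong ∣_∣ (solve 2 (λ a b → b :- a := :- a :- (:- b)) refl a b) ⟩
    ∣ ℚ.- a ℚ.- (ℚ.- b) ∣    ∎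
    where
    open ≡-Reasoning

+-cauchy : ∀ u v → IsCauchy u → IsCauchy v → IsCauchy (λ k → u k ℚ.+ v k)
+-cauchy u v cu cv ε 0<ε with cu _ (half-pos 0<ε) | cv _ (half-pos 0<ε)
... | M , p | N , q = M ℕ.⊔ N , λ i j le le′ → begin-strict
  ∣ (u i ℚ.+ v i) ℚ.- (u j ℚ.+ v j) ∣
    ≡⟨ cong ∣_∣ (solve 4 (λ a b c d → (a :+ b) :- (c :+ d) := (a :- c) :+ (b :- d))
                       refl (u i) (v i) (u j) (v j)) ⟩
  ∣ (u i ℚ.- u j) ℚ.+ (v i ℚ.- v j) ∣
    ≤⟨ ℚ.∣p+q∣≤∣p∣+∣q∣ (u i ℚ.- u j) (v i ℚ.- v j) ⟩
  ∣ u i ℚ.- u j ∣ ℚ.+ ∣ v i ℚ.- v j ∣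
    <⟨ ℚ.+-mono-< (p i j (ℕ.m⊔n≤o⇒m≤o M N le) (ℕ.m⊔n≤o⇒m≤o M N le′))
                  (q i j (ℕ.m⊔n≤o⇒n≤o M N le) (ℕ.m⊔n≤o⇒n≤o M N le′)) ⟩
  ½ ℚ.* ε ℚ.+ ½ ℚ.* ε
    ≡⟨ halves ε ⟩
  ε ∎
  where
  open ℚ.≤-Reasoning
  open +-*-Solver

0<1 : 0ℚ ℚ.< 1ℚ
0<1 = ℚ.positive⁻¹ 1ℚ

eventually-bounded : ∀ u → IsCauchy u →
  ∃ λ B → 0ℚ ℚ.< B × ∃ λ N → ∀ k → N ℕ.≤ k → ∣ u k ∣ ℚ.≤ B
eventually-bounded u cu with cu 1ℚ 0<1
... | N , p = 1ℚ ℚ.+ ∣ u N ∣ , 0<B , N , bound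
  where
  open ℚ.≤-Reasoning
  open +-*-Solver
  0<B : 0ℚ ℚ.< 1ℚ ℚ.+ ∣ u N ∣
  0<B = ℚ.+-mono-<-≤ 0<1 (ℚ.0≤∣p∣ (u N))
  bound : ∀ k → N ℕ.≤ k → ∣ u k ∣ ℚ.≤ 1ℚ ℚ.+ ∣ u N ∣
  bound k N≤k = begin
    ∣ u k ∣
      ≡⟨ cong ∣_∣ (solve 2 (λ a b → a := (a :- b) :+ b) refl (u k) (u N)) ⟩
    ∣ (u k ℚ.- u N) ℚ.+ u N ∣
      ≤⟨ ℚ.∣p+q∣≤∣p∣+∣q∣ (u k ℚ.- u N) (u N) ⟩
    ∣ u k ℚ.- u N ∣ ℚ.+ ∣ u N ∣
      ≤⟨ ℚ.+-monoˡ-≤ ∣ u N ∣ (ℚ.<⇒≤ (p k N N≤k ℕ.≤-refl)) ⟩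
    1ℚ ℚ.+ ∣ u N ∣
      ∎

scaled : ∀ C ε → 0ℚ ℚ.< C → 0ℚ ℚ.< ε → ∃ λ δ → 0ℚ ℚ.< δ × C ℚ.* δ ≡ ε
scaled C ε 0<C 0<ε = r ℚ.* ε , 0<rε , eq
  where
  open ≡-Reasoning
  instance
    C-pos : ℚ.Positive C
    C-pos = ℚ.positive 0<C
    C-nonZero : ℚ.NonZero C
    C-nonZero = ℚ.pos⇒nonZero C
  r : ℚ
  r = ℚ.1/ C
  0<rε : 0ℚ ℚ.< r ℚ.* ε
  0<rε = subst (ℚ._< r ℚ.* ε) (ℚ.*-zeroʳ r)
               (ℚ.*-monoʳ-<-pos r {{ℚ.1/pos⇒pos C}} 0<ε)
  eq : C ℚ.* (r ℚ.* ε) ≡ ε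
  eq = begin
    C ℚ.* (r ℚ.* ε)  ≡⟨ ℚ.*-assoc C r ε ⟨
    (C ℚ.* r) ℚ.* ε  ≡⟨ cong (ℚ._* ε) (ℚ.*-inverseʳ C) ⟩
    1ℚ ℚ.* ε         ≡⟨ ℚ.*-identityˡ ε ⟩
    ε                ∎

*-bound : ∀ {C δ} a b → 0ℚ ℚ.< C → ∣ a ∣ ℚ.≤ C → ∣ b ∣ ℚ.< δ →
          ∣ a ℚ.* b ∣ ℚ.< C ℚ.* δ
*-bound {C} {δ} a b 0<C ∣a∣≤C ∣b∣<δ = begin-strict
  ∣ a ℚ.* b ∣      ≡⟨ ℚ.∣p*q∣≡∣p∣*∣q∣ a b ⟩
  ∣ a ∣ ℚ.* ∣ b ∣  ≤⟨ ℚ.*-monoʳ-≤-nonNeg ∣ b ∣ {{ℚ.nonNegative (ℚ.0≤∣p∣ b)}} ∣a∣≤C ⟩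
  C ℚ.* ∣ b ∣      <⟨ ℚ.*-monoʳ-<-pos C {{ℚ.positive 0<C}} ∣b∣<δ ⟩
  C ℚ.* δ          ∎
  where
  open ℚ.≤-Reasoning

abs-*-diff : ∀ a b c d →
  ∣ a ℚ.* b ℚ.- c ℚ.* d ∣ ℚ.≤ ∣ a ℚ.* (b ℚ.- d) ∣ ℚ.+ ∣ d ℚ.* (a ℚ.- c) ∣
abs-*-diff a b c d = begin
  ∣ a ℚ.* b ℚ.- c ℚ.* d ∣
    ≡⟨ cong ∣_∣ (solve 4 (λ a b c d → a :* b :- c :* d := a :* (b :- d) :+ d :* (a :- c))
                       refl a b c d) ⟩
  ∣ a ℚ.* (b ℚ.- d) ℚ.+ d ℚ.* (a ℚ.- c) ∣
    ≤⟨ ℚ.∣p+q∣≤∣p∣+∣q∣ (a ℚ.* (b ℚ.- d)) (d ℚ.* (a ℚ.- c)) ⟩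
  ∣ a ℚ.* (b ℚ.- d) ∣ ℚ.+ ∣ d ℚ.* (a ℚ.- c) ∣
    ∎
  where
  open ℚ.≤-Reasoning
  open +-*-Solver

*-diff-bound : ∀ {A B α β ε} a b c d → 0ℚ ℚ.< A → 0ℚ ℚ.< B →
  A ℚ.* α ≡ ½ ℚ.* ε → B ℚ.* β ≡ ½ ℚ.* ε →
  ∣ a ∣ ℚ.≤ A → ∣ d ∣ ℚ.≤ B → ∣ b ℚ.- d ∣ ℚ.< α → ∣ a ℚ.- c ∣ ℚ.< β →
  ∣ a ℚ.* b ℚ.- c ℚ.* d ∣ ℚ.< ε
*-diff-bound {A} {B} {α} {β} {ε} a b c d 0<A 0<B Aα≡ε/2 Bβ≡ε/2 ∣a∣≤A ∣d∣≤B b-d<α a-c<β =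
  begin-strict
    ∣ a ℚ.* b ℚ.- c ℚ.* d ∣
      ≤⟨ abs-*-diff a b c d ⟩
    ∣ a ℚ.* (b ℚ.- d) ∣ ℚ.+ ∣ d ℚ.* (a ℚ.- c) ∣
      <⟨ ℚ.+-mono-< (*-bound a (b ℚ.- d) 0<A ∣a∣≤A b-d<α)
                    (*-bound d (a ℚ.- c) 0<B ∣d∣≤B a-c<β) ⟩
    A ℚ.* α ℚ.+ B ℚ.* β
      ≡⟨ cong₂ ℚ._+_ Aα≡ε/2 Bβ≡ε/2 ⟩
    ½ ℚ.* ε ℚ.+ ½ ℚ.* ε
      ≡⟨ halves ε ⟩
    ε ∎
  where
  open ℚ.≤-Reasoning

*-bound-at : ∀ {ε} {u v : ℕ → ℚ} A B α β M N P Q → 0ℚ ℚ.< A → 0ℚ ℚ.< B →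
  A ℚ.* α ≡ ½ ℚ.* ε → B ℚ.* β ≡ ½ ℚ.* ε →
  (∀ k → M ℕ.≤ k → ∣ u k ∣ ℚ.≤ A) →
  (∀ k → N ℕ.≤ k → ∣ v k ∣ ℚ.≤ B) →
  (∀ i j → P ℕ.≤ i → P ℕ.≤ j → ∣ v i ℚ.- v j ∣ ℚ.< α) →
  (∀ i j → Q ℕ.≤ i → Q ℕ.≤ j → ∣ u i ℚ.- u j ∣ ℚ.< β) →
  ∃ λ K → ∀ i j → K ℕ.≤ i → K ℕ.≤ j → ∣ u i ℚ.* v i ℚ.- u j ℚ.* v j ∣ ℚ.< ε
*-bound-at {ε} {u} {v} A B α β M N P Q 0<A 0<B Aα≡ε/2 Bβ≡ε/2 ∣u∣≤A ∣v∣≤B p q =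
  (M ℕ.⊔ N) ℕ.⊔ (P ℕ.⊔ Q) , λ i j le le′ →
    *-diff-bound (u i) (v i) (u j) (v j) 0<A 0<B Aα≡ε/2 Bβ≡ε/2
      (∣u∣≤A i (M≤ i le)) (∣v∣≤B j (N≤ j le′))
      (p i j (P≤ i le) (P≤ j le′)) (q i j (Q≤ i le) (Q≤ j le′))
  where
  module _ k (le : (M ℕ.⊔ N) ℕ.⊔ (P ℕ.⊔ Q) ℕ.≤ k) where
    M≤ : M ℕ.≤ k
    M≤ = ℕ.m⊔n≤o⇒m≤o M N (ℕ.m⊔n≤o⇒m≤o (M ℕ.⊔ N) (P ℕ.⊔ Q) le)
    N≤ : N ℕ.≤ k
    N≤ = ℕ.m⊔n≤o⇒n≤o M N (ℕ.m⊔n≤o⇒m≤o (M ℕ.⊔ N) (P ℕ.⊔ Q) le)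
    P≤ : P ℕ.≤ k
    P≤ = ℕ.m⊔n≤o⇒m≤o P Q (ℕ.m⊔n≤o⇒n≤o (M ℕ.⊔ N) (P ℕ.⊔ Q) le)
    Q≤ : Q ℕ.≤ k
    Q≤ = ℕ.m⊔n≤o⇒n≤o P Q (ℕ.m⊔n≤o⇒n≤o (M ℕ.⊔ N) (P ℕ.⊔ Q) le)

*-cauchy : ∀ u v → IsCauchy u → IsCauchy v → IsCauchy (λ k → u k ℚ.* v k)
*-cauchy u v cu cv ε 0<ε =
  let (A , 0<A , M , ∣u∣≤A) = eventually-bounded u cu
      (B , 0<B , N , ∣v∣≤B) = eventually-bounded v cv
      (α , 0<α , Aα≡ε/2)    = scaled A (½ ℚ.* ε) 0<A (half-pos 0<ε)
      (β , 0<β , Bβ≡ε/2)    = scaled B (½ ℚ.* ε) 0<B (half-pos 0<ε)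
      (P , p)               = cv α 0<α
      (Q , q)               = cu β 0<β
  in *-bound-at {ε} {u} {v} A B α β M N P Q 0<A 0<B Aα≡ε/2 Bβ≡ε/2 ∣u∣≤A ∣v∣≤B p q

-- A real number is represented by a Cauchy sequence of rationals; two of
-- them represent the same number when their difference tends to zero.

record ℝ : Set where
  constructor mkℝ
  field
    seq    : ℕ → ℚ
    cauchy : IsCauchy seq

open ℝ public

infix  4 _≈_ _≤_
infixl 6 _+_ _-_
infixl 7 _*_
infix  8 -_

_≈_ : ℝ → ℝ → Set
x ≈ y = IsNull (λ k → seq x k ℚ.- seq y k)

_≤_ : ℝ → ℝ → Set
x ≤ y = ∀ ε → 0ℚ ℚ.< ε → ∃ λ N → ∀ k → N ℕ.≤ k → seq x k ℚ.≤ seq y k ℚ.+ ε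

fromℚ : ℚ → ℝ
fromℚ q = mkℝ (λ _ → q) (const-cauchy q)

fromℕ : ℕ → ℝ
fromℕ n = fromℚ (+ n ℚ./ 1)

0ℝ 1ℝ : ℝ
0ℝ = fromℕ 0
1ℝ = fromℕ 1

_+_ : ℝ → ℝ → ℝ
x + y = mkℝ (λ k → seq x k ℚ.+ seq y k) (+-cauchy (seq x) (seq y) (cauchy x) (cauchy y))

-_ : ℝ → ℝ
- x = mkℝ (λ k → ℚ.- seq x k) (neg-cauchy (seq x) (cauchy x))

_-_ : ℝ → ℝ → ℝ
x - y = x + (- y)

_*_ : ℝ → ℝ → ℝ
x * y = mkℝ (λ k → seq x k ℚ.* seq y k) (*-cauchy (seq x) (seq y) (cauchy x) (cauchy y))

≈-refl : ∀ {x} → x ≈ x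
≈-refl {x} ε 0<ε =
  0 , λ k _ → subst (ℚ._< ε) (sym (abs-self-diff (seq x k))) 0<ε

≈-sym : ∀ {x y} → x ≈ y → y ≈ x
≈-sym {x} {y} x≈y ε 0<ε with x≈y ε 0<ε
... | N , p = N , λ k N≤k →
  subst (ℚ._< ε) (abs-diff-sym (seq x k) (seq y k)) (p k N≤k)

≈-trans : ∀ {x y z} → x ≈ y → y ≈ z → x ≈ z
≈-trans {x} {y} {z} x≈y y≈z ε 0<ε with x≈y _ (half-pos 0<ε) | y≈z _ (half-pos 0<ε)
... | M , p | N , q = M ℕ.⊔ N , λ k le → begin-strict
  ∣ seq x k ℚ.- seq z k ∣
    ≤⟨ abs-diff-trans (seq x k) (seq y k) (seq z k) ⟩
  ∣ seq x k ℚ.- seq y k ∣ ℚ.+ ∣ seq y k ℚ.- seq z k ∣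
    <⟨ ℚ.+-mono-< (p k (ℕ.m⊔n≤o⇒m≤o M N le)) (q k (ℕ.m⊔n≤o⇒n≤o M N le)) ⟩
  ½ ℚ.* ε ℚ.+ ½ ℚ.* ε
    ≡⟨ halves ε ⟩
  ε ∎
  where
  open ℚ.≤-Reasoning

ℝ-setoid : Setoid 0ℓ 0ℓ
ℝ-setoid = record
  { Carrier       = ℝ
  ; _≈_           = _≈_
  ; isEquivalence = record
    { refl  = λ {x} → ≈-refl {x}
    ; sym   = λ {x} {y} → ≈-sym {x} {y}
    ; trans = λ {x} {y} {z} → ≈-trans {x} {y} {z}
    }
  }

𝔼 : ℕ → Setoid 0ℓ 0ℓ
𝔼 = VecEq.≋-setoid ℝ-setoid

Point : ℕ → Set
Point n = Setoid.Carrier (𝔼 n)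

∑ : ∀ {n} → Vector ℝ n → ℝ
∑ = foldr _+_ 0ℝ

-- The Euclidean distance as a relation: d is the nonnegative square root
-- of the sum of the squared coordinate differences.

Dist : ∀ {n} → Point n → Point n → ℝ → Set
Dist x y d = 0ℝ ≤ d × d * d ≈ ∑ (λ i → (x i - y i) * (x i - y i))

data Color : Set where
  red blue : Color

-- A function on 𝔼ⁿ as a setoid: representatives of the same point get the
-- same color.  Constructively every such function that can be defined is
-- essentially constant, so results about colorings of 𝔼ⁿ take
-- ExcludedMiddle 0ℓ as a hypothesis.

Coloring : ℕ → Set
Coloring n = 𝔼 n ⟶ₛ ≡-setoid Color

Configuration : ℕ → ℕ → Set
Configuration d m = Fin m → Point d

-- The distance between points i and j is the same in both configurations.

IsCopy : ∀ {d n m} → Configuration d m → Configuration n m → Set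
IsCopy K f = ∀ i j r → Dist (K i) (K j) r ⇔ Dist (f i) (f j) r

HasCopy : ∀ {d n m} → Coloring n → Color → Configuration d m → Set
HasCopy {n = n} {m} χ c K =
  Σ (Configuration n m) λ f → IsCopy K f × (∀ i → χ ⟨$⟩ f i ≡ c)

-- Some coloring of 𝔼ⁿ has neither a red copy of K nor a blue copy of L.

infix 4 _↛⟨_,_⟩

_↛⟨_,_⟩ : ∀ {d e k m} → ℕ → Configuration d k → Configuration e m → Set
n ↛⟨ K , L ⟩ = Σ (Coloring n) λ χ → ¬ HasCopy χ red K × ¬ HasCopy χ blue L

ℓ : (m : ℕ) → Configuration 1 m
ℓ m i _ = fromℕ (toℕ i)

{-# OPTIONS --safe #-}

-- Cover the scaled space (coordinates k x with 361 n ≤ k² ≤ 400 n) by the slightly overlapping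
-- cubes 16 c + [0, 17]ⁿ, c ∈ ℤⁿ. Such a cube has diameter less than one in the original scale,
-- and two cubes that contain points at distance one differ by one of at most 34ⁿ short vectors.
-- Mark the cells modulo T = 4 n m independently with probability 1 / (2 · 34ⁿ), and color red the
-- cubes of the marked cells that have no marked neighbour; then no two red points are at distance one.
-- Every 8th point of a copy of ℓ_m gives a test that succeeds with probability at least 1 / (4 · 34ⁿ),
-- and these tests are independent, because the torus is wide enough for the cells involved to
-- be distinct. The overlap of the cubes makes the sequence of cells depend only on the start and the step of
-- the progression rounded at scale 1 / (2 m), hence on boundedly many codes, and a union bound
-- over the codes shows that some marking meets every copy of ℓ_m.

module Submission where

open import Defs
  using (_↛⟨_,_⟩; ℓ; IsCauchy; half-pos; abs-self-diff; 0<1; scaled; ℝ; seq; cauchy; _≈_; fromℚ; fromℕ;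
         ≈-sym; Point; ∑; Dist; Color; red; blue; Coloring; Configuration; IsCopy; HasCopy)
  renaming (_*_ to _*ℝ_; _-_ to _-ℝ_)
open import Level using (0ℓ)
open import Data.Nat.Base using (ℕ; zero; suc; _+_; _∸_; _<_; z≤n; s≤s; _≤_; _*_; _^_)
open import Axiom.ExcludedMiddle using (ExcludedMiddle)
import Data.Bool.Properties as Bool
open import Data.Bool.Base using (Bool; true; false; if_then_else_)
open import Data.Empty using (⊥; ⊥-elim)
open import Data.Fin.Base using (Fin; zero; suc; toℕ; fromℕ<)
open import Data.Fin.Properties using (toℕ-fromℕ<; toℕ<n)
open import Data.Integer.Base as ℤ using (ℤ; +_; -[1+_])
import Data.Integer.DivMod as ℤ
import Data.Integer.Properties as ℤ
import Data.Integer.Tactic.RingSolver as ℤ-Solver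
open import Data.List.Base
  using (List; []; _∷_; length; map; concatMap; _++_; filter; applyUpTo; upTo; cartesianProduct; cartesianProductWith)
import Data.List.Membership.DecPropositional as DecMembership
open import Data.List.Membership.Propositional using (_∈_; _∉_; lose)
open import Data.List.Membership.Propositional.Properties
  using (∈-map⁺; ∈-map⁻; ∈-++⁺ˡ; ∈-++⁺ʳ; ∈-++⁻; ∈-concatMap⁺; ∈-filter⁺; ∈-filter⁻;
         ∈-cartesianProduct⁺; ∈-cartesianProductWith⁺; ∈-upTo⁺)
open import Data.List.Properties using (length-++; length-map; length-filter; length-applyUpTo; length-upTo; map-cong)
open import Data.List.Relation.Unary.All as All using (All; []; _∷_)
import Data.List.Relation.Unary.All.Properties as All
open import Data.List.Relation.Unary.AllPairs using (AllPairs; []; _∷_)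
import Data.List.Relation.Unary.AllPairs.Properties as AllPairs
open import Data.List.Relation.Unary.Any as Any using (Any; here; there)
import Data.List.Relation.Unary.Any.Properties as Any
import Data.Nat.Base as ℕ
import Data.Nat.Coprimality as Coprime
import Data.Nat.DivMod as ℕ
import Data.Nat.Properties as ℕ
import Data.Nat.Tactic.RingSolver as ℕ-Solver
open import Data.Product.Base using (∃; _×_; _,_; proj₁; proj₂)
open import Data.Rational.Base as ℚ using (ℚ; 0ℚ; 1ℚ; ½; _/_; ∣_∣)
import Data.Rational.Properties as ℚ
import Data.Rational.Unnormalised.Base as ℚᵘ
import Data.Rational.Unnormalised.Properties as ℚᵘ
open import Data.Sum.Base using (inj₁; inj₂)
open import Data.Vec.Base using (Vec; []; _∷_; lookup; tabulate; replicate)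
open import Data.Vec.Functional using (Vector; foldr)
open import Data.Vec.Properties using (≡-dec; tabulate-cong; lookup∘tabulate; lookup-replicate)
open import Function.Bundles using (Equivalence)
open import Relation.Binary.Definitions using (DecidableEquality)
open import Relation.Binary.PropositionalEquality
open import Relation.Nullary using (¬_; Dec; yes; no; does; ¬?; _×-dec_)
open import Relation.Nullary.Decidable using (dec⇒maybe)
open import Tactic.RingSolver using (solve-∀)
open import Tactic.RingSolver.Core.AlmostCommutativeRing using (AlmostCommutativeRing; fromCommutativeRing)

-- Rational inequalities

-- The obstacle is that copies of ℓ_m form a continuum, while a union bound needs finitely many
-- events. A code takes O(n) bits per coordinate, so there are 2^O(n²) codes, and each copy offers m
-- / 8 tests. With D = 34ⁿ and p = 1 / (2 D), a test fails with probability at most 1 - p / 2, so 4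
-- D independent tests at least halve the probability that all fail. Hence it suffices that m
-- exceeds 34ⁿ times a polynomial in n, and 10^(5n) leaves ample room. The number 34 is 8 · 17/4:
-- the short vectors have Σ (|z_j| - 1)² at most 3 n (terms with z_j = 0 count as zero), and 17/4 is
-- the sum of 2^(- `cost` |z|) over all integers z. The integer k stands in for an irrational
-- multiple of √n, so that all geometry takes place among rational terms of Cauchy sequences. No
-- probability space is built. A failed test has a defect of at least one, products of defects bound
-- the event that all tests of a code fail, and an average below one is attained or undercut by some
-- marking.

ℚ-ring : AlmostCommutativeRing _ _
ℚ-ring = fromCommutativeRing ℚ.+-*-commutativeRing (λ x → dec⇒maybe (0ℚ ℚ.≟ x))

-- Built with the constructor rather than `_/_`, whose gcd normalisation does not reduce on a
-- variable; here numerator and denominator are visible by computation.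
ι : ℤ → ℚ
ι z = ℚ.mkℚ z 0 (Coprime.sym (Coprime.1-coprimeTo ℤ.∣ z ∣))

/1≡ι : ∀ z → z / 1 ≡ ι z
/1≡ι z = ℚ.toℚᵘ-injective (ℚ.toℚᵘ-fromℚᵘ (ℚᵘ.mkℚᵘ z 0))

ι-≃ : ∀ z → ℚ.toℚᵘ (ι z) ℚᵘ.≃ ℚᵘ.mkℚᵘ z 0
ι-≃ z = ℚᵘ.≃-refl

ι-+ : ∀ a b → ι (a ℤ.+ b) ≡ ι a ℚ.+ ι b
ι-+ a b = ℚ.toℚᵘ-injective (begin
  ℚ.toℚᵘ (ι (a ℤ.+ b))                   ≈⟨ ι-≃ (a ℤ.+ b) ⟩
  ℚᵘ.mkℚᵘ (a ℤ.+ b) 0                    ≈⟨ ℚᵘ.*≡* (cong (ℤ._* + 1) (sym (cong₂ ℤ._+_ (ℤ.*-identityʳ a) (ℤ.*-identityʳ b)))) ⟩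
  ℚᵘ.mkℚᵘ a 0 ℚᵘ.+ ℚᵘ.mkℚᵘ b 0           ≈⟨ ℚᵘ.+-cong (ι-≃ a) (ι-≃ b) ⟨
  ℚ.toℚᵘ (ι a) ℚᵘ.+ ℚ.toℚᵘ (ι b)         ≈⟨ ℚ.toℚᵘ-homo-+ (ι a) (ι b) ⟨
  ℚ.toℚᵘ (ι a ℚ.+ ι b)                   ∎)
  where open ℚᵘ.≃-Reasoning

ι-* : ∀ a b → ι (a ℤ.* b) ≡ ι a ℚ.* ι b
ι-* a b = ℚ.toℚᵘ-injective (begin
  ℚ.toℚᵘ (ι (a ℤ.* b))                   ≈⟨ ι-≃ (a ℤ.* b) ⟩
  ℚᵘ.mkℚᵘ (a ℤ.* b) 0                    ≡⟨⟩
  ℚᵘ.mkℚᵘ a 0 ℚᵘ.* ℚᵘ.mkℚᵘ b 0           ≈⟨ ℚᵘ.*-cong (ι-≃ a) (ι-≃ b) ⟨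
  ℚ.toℚᵘ (ι a) ℚᵘ.* ℚ.toℚᵘ (ι b)         ≈⟨ ℚ.toℚᵘ-homo-* (ι a) (ι b) ⟨
  ℚ.toℚᵘ (ι a ℚ.* ι b)                   ∎)
  where open ℚᵘ.≃-Reasoning

ι-neg : ∀ a → ι (ℤ.- a) ≡ ℚ.- ι a
ι-neg a = ℚ.toℚᵘ-injective (begin
  ℚ.toℚᵘ (ι (ℤ.- a))    ≈⟨ ι-≃ (ℤ.- a) ⟩
  ℚᵘ.- ℚᵘ.mkℚᵘ a 0      ≈⟨ ℚᵘ.-‿cong (ι-≃ a) ⟨
  ℚᵘ.- ℚ.toℚᵘ (ι a)     ≈⟨ ℚ.toℚᵘ-homo‿- (ι a) ⟨
  ℚ.toℚᵘ (ℚ.- ι a)      ∎)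
  where open ℚᵘ.≃-Reasoning

ι-mono-≤ : ∀ {a b} → a ℤ.≤ b → ι a ℚ.≤ ι b
ι-mono-≤ {a} {b} a≤b = ℚ.toℚᵘ-cancel-≤ (begin
  ℚ.toℚᵘ (ι a)   ≃⟨ ι-≃ a ⟩
  ℚᵘ.mkℚᵘ a 0    ≤⟨ ℚᵘ.*≤* (ℤ.*-monoʳ-≤-nonNeg (+ 1) a≤b) ⟩
  ℚᵘ.mkℚᵘ b 0    ≃⟨ ι-≃ b ⟨
  ℚ.toℚᵘ (ι b)   ∎)
  where open ℚᵘ.≤-Reasoning

ι-mono-< : ∀ {a b} → a ℤ.< b → ι a ℚ.< ι b
ι-mono-< {a} {b} a<b = ℚ.toℚᵘ-cancel-< (begin-strict
  ℚ.toℚᵘ (ι a)   ≃⟨ ι-≃ a ⟩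
  ℚᵘ.mkℚᵘ a 0    <⟨ ℚᵘ.*<* (ℤ.*-monoʳ-<-pos (+ 1) a<b) ⟩
  ℚᵘ.mkℚᵘ b 0    ≃⟨ ι-≃ b ⟨
  ℚ.toℚᵘ (ι b)   ∎)
  where open ℚᵘ.≤-Reasoning

ι-cancel-≤ : ∀ {a b} → ι a ℚ.≤ ι b → a ℤ.≤ b
ι-cancel-≤ {a} {b} ιa≤ιb = ℤ.≮⇒≥ λ b<a → ℚ.<-irrefl refl (ℚ.<-≤-trans (ι-mono-< b<a) ιa≤ιb)

-- The format of most inequalities below: the ring solver verifies that the difference equals a
-- certificate `e`, and `e` is a combination of hypotheses whose nonnegativity is read off its
-- shape.
≤-cert : ∀ {p q} e → q ℚ.- p ≡ e → 0ℚ ℚ.≤ e → p ℚ.≤ q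
≤-cert {p} {q} e eq 0≤e = begin
  p                 ≡⟨ ℚ.+-identityʳ p ⟨
  p ℚ.+ 0ℚ          ≤⟨ ℚ.+-monoʳ-≤ p 0≤e ⟩
  p ℚ.+ e           ≡⟨ cong (p ℚ.+_) eq ⟨
  p ℚ.+ (q ℚ.- p)   ≡⟨ add-difference p q ⟩
  q                 ∎
  where
  open ℚ.≤-Reasoning
  add-difference : ∀ p q → p ℚ.+ (q ℚ.- p) ≡ q
  add-difference = solve-∀ ℚ-ring

0≤-diff : ∀ {p q} → p ℚ.≤ q → 0ℚ ℚ.≤ q ℚ.- p
0≤-diff {p} {q} p≤q = subst (ℚ._≤ q ℚ.- p) (ℚ.+-inverseʳ p) (ℚ.+-monoˡ-≤ (ℚ.- p) p≤q)

0≤-+ : ∀ {p q} → 0ℚ ℚ.≤ p → 0ℚ ℚ.≤ q → 0ℚ ℚ.≤ p ℚ.+ q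
0≤-+ = ℚ.+-mono-≤

0≤-* : ∀ {p q} → 0ℚ ℚ.≤ p → 0ℚ ℚ.≤ q → 0ℚ ℚ.≤ p ℚ.* q
0≤-* {p} {q} 0≤p 0≤q =
  subst (ℚ._≤ p ℚ.* q) (ℚ.*-zeroʳ p) (ℚ.*-monoˡ-≤-nonNeg p {{ℚ.nonNegative 0≤p}} 0≤q)

0≤-² : ∀ p → 0ℚ ℚ.≤ p ℚ.* p
0≤-² p with ℚ.≤-total 0ℚ p
... | inj₁ 0≤p = 0≤-* 0≤p 0≤p
... | inj₂ p≤0 = subst (0ℚ ℚ.≤_) (neg² p) (0≤-* 0≤-p 0≤-p)
  where
  neg² : ∀ p → (ℚ.- p) ℚ.* (ℚ.- p) ≡ p ℚ.* p
  neg² = solve-∀ ℚ-ring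
  0≤-p : 0ℚ ℚ.≤ ℚ.- p
  0≤-p = ℚ.neg-antimono-≤ p≤0

-- Independent random marks

infixr 8 _^ℚ_
_^ℚ_ : ℚ → ℕ → ℚ
q ^ℚ zero  = 1ℚ
q ^ℚ suc n = q ℚ.* q ^ℚ n

0≤1 : 0ℚ ℚ.≤ 1ℚ
0≤1 = ℚ.nonNegative⁻¹ 1ℚ

0≤^ : ∀ {q} n → 0ℚ ℚ.≤ q → 0ℚ ℚ.≤ q ^ℚ n
0≤^ zero    0≤q = 0≤1
0≤^ (suc n) 0≤q = 0≤-* 0≤q (0≤^ n 0≤q)

*-mono-≤′ : ∀ {a b c d} → 0ℚ ℚ.≤ a → 0ℚ ℚ.≤ d → a ℚ.≤ b → c ℚ.≤ d → a ℚ.* c ℚ.≤ b ℚ.* d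
*-mono-≤′ {a} {b} {c} {d} 0≤a 0≤d a≤b c≤d = ℚ.≤-trans
  (ℚ.*-monoˡ-≤-nonNeg a {{ℚ.nonNegative 0≤a}} c≤d)
  (ℚ.*-monoʳ-≤-nonNeg d {{ℚ.nonNegative 0≤d}} a≤b)

module Marking {A : Set} (_≟_ : DecidableEquality A) (p : ℚ) (0≤p : 0ℚ ℚ.≤ p) (p≤1 : p ℚ.≤ 1ℚ) where

  open DecMembership _≟_ using (_∈?_)

  Marks : Set
  Marks = A → Bool

  upd : A → Bool → Marks → Marks
  upd x b μ y = if does (y ≟ x) then b else μ y

  upd-≡ : ∀ x b μ → upd x b μ x ≡ b
  upd-≡ x b μ with x ≟ x
  ... | yes _  = refl
  ... | no x≢x = ⊥-elim (x≢x refl)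

  upd-≢ : ∀ {x y} b μ → y ≢ x → upd x b μ y ≡ μ y
  upd-≢ {x} {y} b μ y≢x with y ≟ x
  ... | yes y≡x = ⊥-elim (y≢x y≡x)
  ... | no _    = refl

  -- The expectation over independent marks of probability p; keys outside the list are unmarked,
  -- and a repeated key takes its outermost mark.
  expect : List A → (Marks → ℚ) → ℚ
  expect []       f = f (λ _ → false)
  expect (x ∷ xs) f =
    p ℚ.* expect xs (λ μ → f (upd x true μ)) ℚ.+ (1ℚ ℚ.- p) ℚ.* expect xs (λ μ → f (upd x false μ))

  0≤1-p : 0ℚ ℚ.≤ 1ℚ ℚ.- p
  0≤1-p = 0≤-diff p≤1

  expect-mono : ∀ xs {f g} → (∀ μ → f μ ℚ.≤ g μ) → expect xs f ℚ.≤ expect xs g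
  expect-mono []       f≤g = f≤g _
  expect-mono (x ∷ xs) f≤g = ℚ.+-mono-≤
    (ℚ.*-monoˡ-≤-nonNeg p {{ℚ.nonNegative 0≤p}} (expect-mono xs λ μ → f≤g _))
    (ℚ.*-monoˡ-≤-nonNeg (1ℚ ℚ.- p) {{ℚ.nonNegative 0≤1-p}} (expect-mono xs λ μ → f≤g _))

  expect-cong : ∀ xs {f g} → (∀ μ → f μ ≡ g μ) → expect xs f ≡ expect xs g
  expect-cong []       f≡g = f≡g _
  expect-cong (x ∷ xs) f≡g = cong₂ ℚ._+_
    (cong (p ℚ.*_) (expect-cong xs λ μ → f≡g _))
    (cong ((1ℚ ℚ.- p) ℚ.*_) (expect-cong xs λ μ → f≡g _))

  average-const : ∀ p c → p ℚ.* c ℚ.+ (1ℚ ℚ.- p) ℚ.* c ≡ c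
  average-const = solve-∀ ℚ-ring

  expect-const : ∀ xs c → expect xs (λ _ → c) ≡ c
  expect-const []       c = refl
  expect-const (x ∷ xs) c = trans
    (cong₂ (λ a b → p ℚ.* a ℚ.+ (1ℚ ℚ.- p) ℚ.* b) (expect-const xs c) (expect-const xs c))
    (average-const p c)

  average-+ : ∀ p a b c d →
    p ℚ.* (a ℚ.+ b) ℚ.+ (1ℚ ℚ.- p) ℚ.* (c ℚ.+ d) ≡
    (p ℚ.* a ℚ.+ (1ℚ ℚ.- p) ℚ.* c) ℚ.+ (p ℚ.* b ℚ.+ (1ℚ ℚ.- p) ℚ.* d)
  average-+ = solve-∀ ℚ-ring

  expect-+ : ∀ xs f g → expect xs (λ μ → f μ ℚ.+ g μ) ≡ expect xs f ℚ.+ expect xs g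
  expect-+ []       f g = refl
  expect-+ (x ∷ xs) f g = trans
    (cong₂ (λ a b → p ℚ.* a ℚ.+ (1ℚ ℚ.- p) ℚ.* b) (expect-+ xs _ _) (expect-+ xs _ _))
    (average-+ p _ _ _ _)

  DependsOn : List A → (Marks → ℚ) → Set
  DependsOn S f = ∀ μ ν → (∀ {a} → a ∈ S → μ a ≡ ν a) → f μ ≡ f ν

  Disjoint : List A → List A → Set
  Disjoint S S′ = ∀ {a} → a ∈ S → a ∉ S′

  upd-agree : ∀ {S : List A} x b {μ ν : Marks} → (∀ {a} → a ∈ S → μ a ≡ ν a) → ∀ {a} → a ∈ S → upd x b μ a ≡ upd x b ν a
  upd-agree x b eq {a} a∈S with a ≟ x
  ... | yes _ = refl
  ... | no _  = eq a∈S

  upd-depends : ∀ {S f} x b → DependsOn S f → DependsOn S (λ μ → f (upd x b μ))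
  upd-depends x b dep μ ν eq = dep _ _ (upd-agree x b eq)

  upd-irrelevant : ∀ {S f} x b → DependsOn S f → x ∉ S → ∀ μ → f (upd x b μ) ≡ f μ
  upd-irrelevant x b dep x∉S μ = dep _ _ λ a∈S → upd-≢ b μ λ where refl → x∉S a∈S

  expect-irrelevant : ∀ xs {S f} x → DependsOn S f → x ∉ S → expect (x ∷ xs) f ≡ expect xs f
  expect-irrelevant xs x dep x∉S = trans
    (cong₂ (λ a b → p ℚ.* a ℚ.+ (1ℚ ℚ.- p) ℚ.* b)
      (expect-cong xs (upd-irrelevant x true dep x∉S)) (expect-cong xs (upd-irrelevant x false dep x∉S)))
    (average-const p _)

  average-*ˡ : ∀ p a b c → p ℚ.* (a ℚ.* b) ℚ.+ (1ℚ ℚ.- p) ℚ.* (a ℚ.* c) ≡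
    a ℚ.* (p ℚ.* b ℚ.+ (1ℚ ℚ.- p) ℚ.* c)
  average-*ˡ = solve-∀ ℚ-ring

  expect-* : ∀ xs {S S′ f g} → DependsOn S f → DependsOn S′ g → Disjoint S S′ →
    expect xs (λ μ → f μ ℚ.* g μ) ≡ expect xs f ℚ.* expect xs g
  -- One factor does not depend on the mark of x, so averaging over that mark only affects the other.
  expect-*-cons : ∀ x xs {S S′ f g} → DependsOn S f → DependsOn S′ g → Disjoint S S′ → x ∉ S →
    expect (x ∷ xs) (λ μ → f μ ℚ.* g μ) ≡ expect (x ∷ xs) f ℚ.* expect (x ∷ xs) g

  expect-* []       df dg disj = refl
  expect-* (x ∷ xs) {S} {f = f} {g} df dg disj with x ∈? S
  ... | no x∉S  = expect-*-cons x xs df dg disj x∉S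
  ... | yes x∈S = begin
    expect (x ∷ xs) (λ μ → f μ ℚ.* g μ)       ≡⟨ expect-cong (x ∷ xs) (λ μ → ℚ.*-comm (f μ) (g μ)) ⟩
    expect (x ∷ xs) (λ μ → g μ ℚ.* f μ)       ≡⟨ expect-*-cons x xs dg df (λ a∈S′ a∈S → disj a∈S a∈S′) (disj x∈S) ⟩
    expect (x ∷ xs) g ℚ.* expect (x ∷ xs) f      ≡⟨ ℚ.*-comm (expect (x ∷ xs) g) (expect (x ∷ xs) f) ⟩
    expect (x ∷ xs) f ℚ.* expect (x ∷ xs) g      ∎
    where open ≡-Reasoning

  expect-*-cons x xs {f = f} {g} df dg disj x∉S = begin
    expect (x ∷ xs) (λ μ → f μ ℚ.* g μ)
      ≡⟨ cong₂ (λ a b → p ℚ.* a ℚ.+ (1ℚ ℚ.- p) ℚ.* b) (part true) (part false) ⟩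
    p ℚ.* (expect xs f ℚ.* expect xs (λ μ → g (upd x true μ))) ℚ.+
      (1ℚ ℚ.- p) ℚ.* (expect xs f ℚ.* expect xs (λ μ → g (upd x false μ)))
      ≡⟨ average-*ˡ p (expect xs f) _ _ ⟩
    expect xs f ℚ.* expect (x ∷ xs) g
      ≡⟨ cong (ℚ._* expect (x ∷ xs) g) (expect-irrelevant xs x df x∉S) ⟨
    expect (x ∷ xs) f ℚ.* expect (x ∷ xs) g
      ∎
    where
    open ≡-Reasoning
    part : ∀ b → expect xs (λ μ → f (upd x b μ) ℚ.* g (upd x b μ)) ≡ expect xs f ℚ.* expect xs (λ μ → g (upd x b μ))
    part b = trans
      (expect-cong xs λ μ → cong (ℚ._* g (upd x b μ)) (upd-irrelevant x b df x∉S μ))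
      (expect-* xs df (upd-depends x b dg) disj)

  indicator : A → Marks → ℚ
  indicator a μ = if μ a then 1ℚ else 0ℚ

  indicator-depends : ∀ a → DependsOn (a ∷ []) (indicator a)
  indicator-depends a μ ν eq = cong (if_then 1ℚ else 0ℚ) (eq (here refl))

  0≤indicator : ∀ a μ → 0ℚ ℚ.≤ indicator a μ
  0≤indicator a μ with μ a
  ... | true  = 0≤1
  ... | false = ℚ.≤-refl

  average-01 : ∀ p → p ℚ.* 1ℚ ℚ.+ (1ℚ ℚ.- p) ℚ.* 0ℚ ≡ p
  average-01 = solve-∀ ℚ-ring

  expect-indicator-head : ∀ a xs → expect (a ∷ xs) (indicator a) ≡ p
  expect-indicator-head a xs = trans
    (cong₂ (λ a b → p ℚ.* a ℚ.+ (1ℚ ℚ.- p) ℚ.* b) (part true) (part false)) (average-01 p)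
    where
    part : ∀ b → expect xs (λ μ → indicator a (upd a b μ)) ≡ (if b then 1ℚ else 0ℚ)
    part b = trans (expect-cong xs λ μ → cong (if_then 1ℚ else 0ℚ) (upd-≡ a b μ)) (expect-const xs _)

  expect-indicator : ∀ {a xs} → a ∈ xs → expect xs (indicator a) ≡ p
  expect-indicator {a} {x ∷ xs} a∈ = split (a ≟ x) a∈
    where
    split : Dec (a ≡ x) → a ∈ x ∷ xs → expect (x ∷ xs) (indicator a) ≡ p
    split (yes refl) _            = expect-indicator-head a xs
    split (no a≢x)   (here a≡x)   = ⊥-elim (a≢x a≡x)
    split (no a≢x)   (there a∈xs) = trans
      (expect-irrelevant xs x (indicator-depends a) λ where (here refl) → a≢x refl)
      (expect-indicator a∈xs)

  -- Neighbours of a test need not belong to the list of random keys. Such a key is never marked, so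
  -- the upper bound survives although equality fails.
  expect-indicator-≤ : ∀ a xs → expect xs (indicator a) ℚ.≤ p
  expect-indicator-≤ a xs with a ∈? xs
  ... | yes a∈xs = ℚ.≤-reflexive (expect-indicator a∈xs)
  ... | no a∉xs  = ℚ.≤-trans (ℚ.≤-reflexive (zero-outside xs a∉xs)) 0≤p
    where
    zero-outside : ∀ xs → a ∉ xs → expect xs (indicator a) ≡ 0ℚ
    zero-outside []       _  = refl
    zero-outside (x ∷ xs) a∉ = trans
      (expect-irrelevant xs x (indicator-depends a) λ where (here refl) → a∉ (here refl))
      (zero-outside xs λ a∈xs → a∉ (there a∈xs))

  -- Tests and the probability that all of them fail

  record Test : Set where
    constructor test
    field
      centre     : A
      neighbours : List A
  open Test public

  keys : Test → List A
  keys t = centre t ∷ neighbours t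

  Passes : Marks → Test → Set
  Passes μ t = μ (centre t) ≡ true × All (λ a → μ a ≡ false) (neighbours t)

  marked : List A → Marks → ℚ
  marked []       μ = 0ℚ
  marked (a ∷ as) μ = indicator a μ ℚ.+ marked as μ

  -- A natural number that vanishes exactly when the test is passed.
  defect : Test → Marks → ℚ
  defect t μ = 1ℚ ℚ.- indicator (centre t) μ ℚ.+ indicator (centre t) μ ℚ.* marked (neighbours t) μ

  marked-depends : ∀ as → DependsOn as (marked as)
  marked-depends []       μ ν eq = refl
  marked-depends (a ∷ as) μ ν eq = cong₂ ℚ._+_
    (indicator-depends a μ ν λ where (here refl) → eq (here refl))
    (marked-depends as μ ν λ a∈ → eq (there a∈))

  defect-depends : ∀ t → DependsOn (keys t) (defect t)
  defect-depends t μ ν eq = cong₂ (λ x y → 1ℚ ℚ.- x ℚ.+ x ℚ.* y)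
    (indicator-depends _ μ ν λ where (here refl) → eq (here refl))
    (marked-depends _ μ ν λ a∈ → eq (there a∈))

  0≤marked : ∀ as μ → 0ℚ ℚ.≤ marked as μ
  0≤marked []       μ = ℚ.≤-refl
  0≤marked (a ∷ as) μ = 0≤-+ (0≤indicator a μ) (0≤marked as μ)

  expect-marked-≤ : ∀ xs as → expect xs (marked as) ℚ.≤ ι (+ length as) ℚ.* p
  expect-marked-≤ xs []       = ℚ.≤-reflexive (trans (expect-const xs 0ℚ) (sym (ℚ.*-zeroˡ p)))
  expect-marked-≤ xs (a ∷ as) = begin
    expect xs (λ μ → indicator a μ ℚ.+ marked as μ)    ≡⟨ expect-+ xs _ _ ⟩
    expect xs (indicator a) ℚ.+ expect xs (marked as)     ≤⟨ ℚ.+-mono-≤ (expect-indicator-≤ a xs) (expect-marked-≤ xs as) ⟩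
    p ℚ.+ ι (+ length as) ℚ.* p                     ≡⟨ cong (ℚ._+ ι (+ length as) ℚ.* p) (ℚ.*-identityˡ p) ⟨
    1ℚ ℚ.* p ℚ.+ ι (+ length as) ℚ.* p              ≡⟨ ℚ.*-distribʳ-+ p 1ℚ (ι (+ length as)) ⟨
    (1ℚ ℚ.+ ι (+ length as)) ℚ.* p                  ≡⟨ cong (ℚ._* p) (ι-+ (+ 1) (+ length as)) ⟨
    ι (+ suc (length as)) ℚ.* p                     ∎
    where open ℚ.≤-Reasoning

  expect-1-indicator : ∀ {a xs} → a ∈ xs → expect xs (λ μ → 1ℚ ℚ.- indicator a μ) ≡ 1ℚ ℚ.- p
  expect-1-indicator {a} {xs} a∈xs = move (begin
    expect xs (λ μ → 1ℚ ℚ.- indicator a μ) ℚ.+ p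
      ≡⟨ cong (expect xs (λ μ → 1ℚ ℚ.- indicator a μ) ℚ.+_) (expect-indicator a∈xs) ⟨
    expect xs (λ μ → 1ℚ ℚ.- indicator a μ) ℚ.+ expect xs (indicator a)
      ≡⟨ expect-+ xs _ _ ⟨
    expect xs (λ μ → 1ℚ ℚ.- indicator a μ ℚ.+ indicator a μ)
      ≡⟨ expect-cong xs (λ μ → cancel (indicator a μ)) ⟩
    expect xs (λ _ → 1ℚ)
      ≡⟨ expect-const xs 1ℚ ⟩
    1ℚ ∎)
    where
    open ≡-Reasoning
    cancel : ∀ x → 1ℚ ℚ.- x ℚ.+ x ≡ 1ℚ
    cancel = solve-∀ ℚ-ring
    add-sub : ∀ x y → x ≡ x ℚ.+ y ℚ.- y
    add-sub = solve-∀ ℚ-ring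
    move : ∀ {x} → x ℚ.+ p ≡ 1ℚ → x ≡ 1ℚ ℚ.- p
    move {x} eq = trans (add-sub x p) (cong (ℚ._- p) eq)

  -- A first-moment bound: the centre is independent of its neighbours, and the expected number of
  -- marked neighbours is at most their number times `p`. For at most 1 / (2 p) neighbours the right
  -- side is at most 1 - p / 2.
  expect-defect-≤ : ∀ xs t → centre t ∈ xs → centre t ∉ neighbours t →
    expect xs (defect t) ℚ.≤ 1ℚ ℚ.- p ℚ.+ p ℚ.* (ι (+ length (neighbours t)) ℚ.* p)
  expect-defect-≤ xs t c∈xs c∉ns = begin
    expect xs (defect t)
      ≡⟨ expect-+ xs _ _ ⟩
    expect xs (λ μ → 1ℚ ℚ.- indicator (centre t) μ) ℚ.+ expect xs (λ μ → indicator (centre t) μ ℚ.* marked (neighbours t) μ)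
      ≡⟨ cong₂ ℚ._+_ (expect-1-indicator c∈xs)
           (expect-* xs (indicator-depends (centre t)) (marked-depends (neighbours t)) λ where (here refl) → c∉ns) ⟩
    1ℚ ℚ.- p ℚ.+ expect xs (indicator (centre t)) ℚ.* expect xs (marked (neighbours t))
      ≡⟨ cong (λ e → 1ℚ ℚ.- p ℚ.+ e ℚ.* expect xs (marked (neighbours t))) (expect-indicator c∈xs) ⟩
    1ℚ ℚ.- p ℚ.+ p ℚ.* expect xs (marked (neighbours t))
      ≤⟨ ℚ.+-monoʳ-≤ (1ℚ ℚ.- p) (ℚ.*-monoˡ-≤-nonNeg p {{ℚ.nonNegative 0≤p}} (expect-marked-≤ xs (neighbours t))) ⟩
    1ℚ ℚ.- p ℚ.+ p ℚ.* (ι (+ length (neighbours t)) ℚ.* p)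
      ∎
    where open ℚ.≤-Reasoning

  indicator-≤1 : ∀ a μ → indicator a μ ℚ.≤ 1ℚ
  indicator-≤1 a μ with μ a
  ... | true  = ℚ.≤-refl
  ... | false = 0≤1

  0≤defect : ∀ t μ → 0ℚ ℚ.≤ defect t μ
  0≤defect t μ = 0≤-+ (0≤-diff (indicator-≤1 (centre t) μ))
    (0≤-* (0≤indicator (centre t) μ) (0≤marked (neighbours t) μ))

  marked<1 : ∀ as μ → marked as μ ℚ.< 1ℚ → All (λ a → μ a ≡ false) as
  marked<1 []       μ _  = []
  marked<1 (a ∷ as) μ lt with μ a in eq
  ... | true  = ⊥-elim (ℚ.<-irrefl refl (ℚ.≤-<-trans
    (subst (ℚ._≤ 1ℚ ℚ.+ marked as μ) (ℚ.+-identityʳ 1ℚ) (ℚ.+-monoʳ-≤ 1ℚ (0≤marked as μ))) lt))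
  ... | false = eq ∷ marked<1 as μ (subst (ℚ._< 1ℚ) (ℚ.+-identityˡ _) lt)

  1≤defect : ∀ t μ → ¬ Passes μ t → 1ℚ ℚ.≤ defect t μ
  1≤defect t μ fails with μ (centre t)
  ... | true  = subst (1ℚ ℚ.≤_) (sym (unit (marked (neighbours t) μ)))
                  (ℚ.≮⇒≥ λ lt → fails (refl , marked<1 (neighbours t) μ lt))
    where
    unit : ∀ x → 1ℚ ℚ.- 1ℚ ℚ.+ 1ℚ ℚ.* x ≡ x
    unit = solve-∀ ℚ-ring
  ... | false = ℚ.≤-reflexive (sym (unit (marked (neighbours t) μ)))
    where
    unit : ∀ x → 1ℚ ℚ.- 0ℚ ℚ.+ 0ℚ ℚ.* x ≡ 1ℚ
    unit = solve-∀ ℚ-ring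

  -- It dominates the indicator of the event that every test fails, and as a product it factors
  -- under `expect` when the tests have disjoint keys.
  ∏defect : List Test → Marks → ℚ
  ∏defect []       μ = 1ℚ
  ∏defect (t ∷ ts) μ = defect t μ ℚ.* ∏defect ts μ

  ∏defect-depends : ∀ ts → DependsOn (concatMap keys ts) (∏defect ts)
  ∏defect-depends []       μ ν eq = refl
  ∏defect-depends (t ∷ ts) μ ν eq = cong₂ ℚ._*_
    (defect-depends t μ ν λ a∈ → eq (∈-++⁺ˡ a∈))
    (∏defect-depends ts μ ν λ a∈ → eq (∈-++⁺ʳ (keys t) a∈))

  0≤∏defect : ∀ ts μ → 0ℚ ℚ.≤ ∏defect ts μ
  0≤∏defect []       μ = 0≤1
  0≤∏defect (t ∷ ts) μ = 0≤-* (0≤defect t μ) (0≤∏defect ts μ)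

  1≤∏defect : ∀ ts μ → All (λ t → ¬ Passes μ t) ts → 1ℚ ℚ.≤ ∏defect ts μ
  1≤∏defect []       μ []       = ℚ.≤-refl
  1≤∏defect (t ∷ ts) μ (f ∷ fs) = *-mono-≤′ 0≤1 (0≤∏defect ts μ) (1≤defect t μ f) (1≤∏defect ts μ fs)

  DisjointTests : List Test → Set
  DisjointTests = AllPairs (λ t t′ → Disjoint (keys t) (keys t′))

  disjoint-concat : ∀ {t} ts → All (λ t′ → Disjoint (keys t) (keys t′)) ts → Disjoint (keys t) (concatMap keys ts)
  disjoint-concat (t′ ∷ ts) (d ∷ ds) a∈ a∈′ with ∈-++⁻ (keys t′) a∈′
  ... | inj₁ i = d a∈ i
  ... | inj₂ j = disjoint-concat ts ds a∈ j

  expect-∏defect-≤ : ∀ xs β ts → 0ℚ ℚ.≤ β → DisjointTests ts → All (λ t → expect xs (defect t) ℚ.≤ β) ts →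
    expect xs (∏defect ts) ℚ.≤ β ^ℚ length ts
  expect-∏defect-≤ xs β []       0≤β []       []       = ℚ.≤-reflexive (expect-const xs 1ℚ)
  expect-∏defect-≤ xs β (t ∷ ts) 0≤β (d ∷ ds) (e ∷ es) = begin
    expect xs (λ μ → defect t μ ℚ.* ∏defect ts μ)
      ≡⟨ expect-* xs (defect-depends t) (∏defect-depends ts) (disjoint-concat ts d) ⟩
    expect xs (defect t) ℚ.* expect xs (∏defect ts)
      ≤⟨ *-mono-≤′ (subst (ℚ._≤ expect xs (defect t)) (expect-const xs 0ℚ) (expect-mono xs (0≤defect t)))
           (0≤^ (length ts) 0≤β) e (expect-∏defect-≤ xs β ts 0≤β ds es) ⟩
    β ℚ.* β ^ℚ length ts
      ∎
    where open ℚ.≤-Reasoning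

  ∑∏defect : List (List Test) → Marks → ℚ
  ∑∏defect []       μ = 0ℚ
  ∑∏defect (w ∷ ws) μ = ∏defect w μ ℚ.+ ∑∏defect ws μ

  expect-∑∏defect-≤ : ∀ xs γ ws → All (λ w → expect xs (∏defect w) ℚ.≤ γ) ws →
    expect xs (∑∏defect ws) ℚ.≤ ι (+ length ws) ℚ.* γ
  expect-∑∏defect-≤ xs γ []       []       = ℚ.≤-reflexive (trans (expect-const xs 0ℚ) (sym (ℚ.*-zeroˡ γ)))
  expect-∑∏defect-≤ xs γ (w ∷ ws) (e ∷ es) = begin
    expect xs (λ μ → ∏defect w μ ℚ.+ ∑∏defect ws μ)       ≡⟨ expect-+ xs _ _ ⟩
    expect xs (∏defect w) ℚ.+ expect xs (∑∏defect ws)        ≤⟨ ℚ.+-mono-≤ e (expect-∑∏defect-≤ xs γ ws es) ⟩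
    γ ℚ.+ ι (+ length ws) ℚ.* γ                       ≡⟨ cong (ℚ._+ ι (+ length ws) ℚ.* γ) (ℚ.*-identityˡ γ) ⟨
    1ℚ ℚ.* γ ℚ.+ ι (+ length ws) ℚ.* γ                ≡⟨ ℚ.*-distribʳ-+ γ 1ℚ (ι (+ length ws)) ⟨
    (1ℚ ℚ.+ ι (+ length ws)) ℚ.* γ                    ≡⟨ cong (ℚ._* γ) (ι-+ (+ 1) (+ length ws)) ⟨
    ι (+ suc (length ws)) ℚ.* γ                       ∎
    where open ℚ.≤-Reasoning

  ∏≤∑∏ : ∀ ws μ {w} → w ∈ ws → ∏defect w μ ℚ.≤ ∑∏defect ws μ
  0≤∑∏ : ∀ ws μ → 0ℚ ℚ.≤ ∑∏defect ws μ
  0≤∑∏ []       μ = ℚ.≤-refl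
  0≤∑∏ (w ∷ ws) μ = 0≤-+ (0≤∏defect w μ) (0≤∑∏ ws μ)
  ∏≤∑∏ (w ∷ ws) μ (here refl) = subst (ℚ._≤ ∏defect w μ ℚ.+ ∑∏defect ws μ) (ℚ.+-identityʳ (∏defect w μ)) (ℚ.+-monoʳ-≤ (∏defect w μ) (0≤∑∏ ws μ))
  ∏≤∑∏ (w ∷ ws) μ (there w∈)  = ℚ.≤-trans (∏≤∑∏ ws μ w∈)
    (subst (ℚ._≤ ∏defect w μ ℚ.+ ∑∏defect ws μ) (ℚ.+-identityˡ (∑∏defect ws μ)) (ℚ.+-monoˡ-≤ (∑∏defect ws μ) (0≤∏defect w μ)))

  -- The method of conditional expectations: at each key the mark with the smaller remaining
  -- expectation is kept, and that one is at most the weighted average.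
  expect-attained : ∀ xs f → ∃ λ μ → f μ ℚ.≤ expect xs f
  expect-attained []       f = (λ _ → false) , ℚ.≤-refl
  expect-attained (x ∷ xs) f with ℚ.≤-total (expect xs (λ μ → f (upd x true μ))) (expect xs (λ μ → f (upd x false μ)))
  ... | inj₁ t≤f = let (μ , le) = expect-attained xs (λ μ → f (upd x true μ)) in
    upd x true μ , ℚ.≤-trans le (subst (ℚ._≤ expect (x ∷ xs) f) (average-const p _)
      (ℚ.+-monoʳ-≤ (p ℚ.* expect xs (λ μ → f (upd x true μ)))
        (ℚ.*-monoˡ-≤-nonNeg (1ℚ ℚ.- p) {{ℚ.nonNegative 0≤1-p}} t≤f)))
  ... | inj₂ f≤t = let (μ , le) = expect-attained xs (λ μ → f (upd x false μ)) in
    upd x false μ , ℚ.≤-trans le (subst (ℚ._≤ expect (x ∷ xs) f) (average-const p _)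
      (ℚ.+-monoˡ-≤ ((1ℚ ℚ.- p) ℚ.* expect xs (λ μ → f (upd x false μ)))
        (ℚ.*-monoˡ-≤-nonNeg p {{ℚ.nonNegative 0≤p}} f≤t)))

  passes? : ∀ μ t → Dec (Passes μ t)
  passes? μ t = (μ (centre t) Bool.≟ true) ×-dec All.all? (λ a → μ a Bool.≟ false) (neighbours t)

  some-passes : ∀ ts μ → ∏defect ts μ ℚ.< 1ℚ → Any (Passes μ) ts
  some-passes ts μ lt with Any.any? (passes? μ) ts
  ... | yes passes = passes
  ... | no fails   = ⊥-elim (ℚ.<-irrefl refl (ℚ.≤-<-trans (1≤∏defect ts μ (All.¬Any⇒All¬ ts fails)) lt))

  Admissible : ℕ → Test → Set
  Admissible D t = centre t ∉ neighbours t × length (neighbours t) ≤ D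

  -- Some marking makes the sum of all products less than one. The products are nonnegative, so each
  -- of them is less than one, and then the tests of that word cannot all fail.
  marks-exist : ∀ D M ws (let β = 1ℚ ℚ.- p ℚ.+ p ℚ.* (ι (+ D) ℚ.* p)) →
    All (λ w → DisjointTests w × All (Admissible D) w × length w ≡ M) ws →
    ι (+ length ws) ℚ.* β ^ℚ M ℚ.< 1ℚ →
    ∃ λ μ → ∀ {w} → w ∈ ws → Any (Passes μ) w
  marks-exist D M ws good small =
    let (μ , le) = expect-attained xs (∑∏defect ws) in
    μ , λ {w} w∈ws → some-passes w μ (ℚ.≤-<-trans (∏≤∑∏ ws μ w∈ws) (ℚ.≤-<-trans le
      (ℚ.≤-<-trans (expect-∑∏defect-≤ xs (β ^ℚ M) ws (All.tabulate expect-word)) small)))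
    where
    β : ℚ
    β = 1ℚ ℚ.- p ℚ.+ p ℚ.* (ι (+ D) ℚ.* p)
    0≤ιD : 0ℚ ℚ.≤ ι (+ D)
    0≤ιD = ι-mono-≤ (ℤ.+≤+ ℕ.z≤n)
    0≤β : 0ℚ ℚ.≤ β
    0≤β = 0≤-+ 0≤1-p (0≤-* 0≤p (0≤-* 0≤ιD 0≤p))
    xs : List A
    -- Only centres receive random marks; a neighbour that is no centre stays unmarked, which can
    -- only help a test.
    xs = concatMap (map centre) ws
    expect-word : ∀ {w} → w ∈ ws → expect xs (∏defect w) ℚ.≤ β ^ℚ M
    expect-word {w} w∈ws with All.lookup good w∈ws
    ... | disj , adm , refl = expect-∏defect-≤ xs β w 0≤β disj (All.tabulate λ {t} t∈w →
      let (c∉ns , len≤D) = All.lookup adm t∈w in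
      ℚ.≤-trans (expect-defect-≤ xs t (∈-concatMap⁺ (map centre) (lose w∈ws (∈-map⁺ centre t∈w))) c∉ns)
        (ℚ.+-monoʳ-≤ (1ℚ ℚ.- p) (ℚ.*-monoˡ-≤-nonNeg p {{ℚ.nonNegative 0≤p}}
          (ℚ.*-monoʳ-≤-nonNeg p {{ℚ.nonNegative 0≤p}} (ι-mono-≤ (ℤ.+≤+ len≤D))))))

-- Short integer vectors and residues

-- A lower bound for (x ∸ 1)², by cost≤, whose unit steps allow counting by recursion on the budget.
cost : ℕ → ℕ
cost 0 = 0
cost 1 = 0
cost 2 = 1
cost (suc (suc (suc x))) = 4 + x

cost-sum : ∀ {n} → Vec ℤ n → ℕ
cost-sum []      = 0
cost-sum (z ∷ v) = cost ℤ.∣ z ∣ + cost-sum v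

±-cons : ∀ {n} → ℕ → List (Vec ℤ n) → List (Vec ℤ (suc n))
±-cons v xs = map (+ v ∷_) xs ++ map (ℤ.- + v ∷_) xs

module _ {n : ℕ} (F : ℕ → List (Vec ℤ n)) where

  -- The budget drops in unit steps as the absolute value of the head grows: `far` spends one for
  -- absolute value 2, `farther` two more, and `tails` one more for every further value, which adds
  -- up to 4 + x for the value 3 + x.
  tails : ℕ → ℕ → List (Vec ℤ (suc n))
  tails v zero    = []
  tails v (suc b) = ±-cons v (F b) ++ tails (suc v) b

  farther : ℕ → List (Vec ℤ (suc n))
  farther (suc (suc b)) = tails 3 b
  farther _             = []

  far : ℕ → List (Vec ℤ (suc n))
  far zero    = []
  far (suc b) = ±-cons 2 (F b) ++ farther b

  extend : ℕ → List (Vec ℤ (suc n))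
  extend b = (map (+ 0 ∷_) (F b) ++ ±-cons 1 (F b)) ++ far b

cheap : ∀ n → ℕ → List (Vec ℤ n)
cheap zero    b = [] ∷ []
cheap (suc n) b = extend (cheap n) b

∈-±-cons : ∀ {n} z {v : Vec ℤ n} {xs} → v ∈ xs → z ∷ v ∈ ±-cons ℤ.∣ z ∣ xs
∈-±-cons (+ x)     v∈ = ∈-++⁺ˡ (∈-map⁺ (+ x ∷_) v∈)
∈-±-cons (-[1+ x ]) {xs = xs} v∈ = ∈-++⁺ʳ (map (+ suc x ∷_) xs) (∈-map⁺ (-[1+ x ] ∷_) v∈)

module _ {n : ℕ} {F : ℕ → List (Vec ℤ n)} (v : Vec ℤ n) (complete : ∀ {b} → cost-sum v ≤ b → v ∈ F b) where

  ∈-tails : ∀ z w x b → ℤ.∣ z ∣ ≡ w + x → x + suc (cost-sum v) ≤ b → z ∷ v ∈ tails F w b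
  ∈-tails z w zero (suc b) eq (s≤s le) with trans eq (ℕ.+-identityʳ w)
  ... | refl = ∈-++⁺ˡ (∈-±-cons z (complete le))
  ∈-tails z w (suc x) (suc b) eq (s≤s le) =
    ∈-++⁺ʳ (±-cons w (F b)) (∈-tails z (suc w) x b (trans eq (ℕ.+-suc w x)) le)

  ∈-far : ∀ z x b → ℤ.∣ z ∣ ≡ suc (suc x) → cost (suc (suc x)) + cost-sum v ≤ b → z ∷ v ∈ far F b
  ∈-far z zero (suc b) eq (s≤s le) =
    ∈-++⁺ˡ (subst (λ w → z ∷ v ∈ ±-cons w (F b)) eq (∈-±-cons z (complete le)))
  ∈-far z (suc x) (suc (suc (suc b))) eq (s≤s (s≤s (s≤s le))) =
    ∈-++⁺ʳ (±-cons 2 (F (suc (suc b)))) (∈-tails z 3 x b eq (subst (_≤ b) (sym (ℕ.+-suc x _)) le))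

  ∈-extend : ∀ z b → cost ℤ.∣ z ∣ + cost-sum v ≤ b → z ∷ v ∈ extend F b
  ∈-extend z b le with ℤ.∣ z ∣ in eq
  ... | suc (suc x) = ∈-++⁺ʳ (map (+ 0 ∷_) (F b) ++ ±-cons 1 (F b)) (∈-far z x b eq le)
  ... | suc zero    = ∈-++⁺ˡ (∈-++⁺ʳ (map (+ 0 ∷_) (F b)) (subst (λ w → z ∷ v ∈ ±-cons w (F b)) eq (∈-±-cons z (complete le))))
  ... | zero with ℤ.∣i∣≡0⇒i≡0 {z} eq
  ...   | refl = ∈-++⁺ˡ (∈-++⁺ˡ (∈-map⁺ (+ 0 ∷_) (complete le)))

∈-cheap : ∀ {n} (v : Vec ℤ n) {b} → cost-sum v ≤ b → v ∈ cheap n b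
∈-cheap []      _  = here refl
∈-cheap (z ∷ v) {b} le = ∈-extend v (∈-cheap v) z b le

length-±-cons : ∀ {n} v (xs : List (Vec ℤ n)) → length (±-cons v xs) ≡ 2 * length xs
length-±-cons v xs = trans (length-++ (map (+ v ∷_) xs))
  (trans (cong₂ _+_ (length-map _ xs) (length-map _ xs)) (double (length xs)))
  where
  double : ∀ l → l + l ≡ 2 * l
  double = ℕ-Solver.solve-∀

module _ {n : ℕ} {F : ℕ → List (Vec ℤ n)} (q a : ℕ) (bound : ∀ b → length (F b) * q ≤ a * 2 ^ b) where

  open ℕ.≤-Reasoning

  -- A geometric series: the budgets b - 1, b - 2, ... contribute at most 2 (2^(b-1) + 2^(b-2) +
  -- ...) ≤ 2 · 2^b, in units of a / q. The ratio a / q is kept as two naturals to avoid fractions.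
  length-tails : ∀ v b → length (tails F v b) * q ≤ 2 * (a * 2 ^ b)
  length-tails v zero    = z≤n
  length-tails v (suc b) = begin
    length (±-cons v (F b) ++ tails F (suc v) b) * q
      ≡⟨ cong (_* q) (trans (length-++ (±-cons v (F b))) (cong (_+ length (tails F (suc v) b)) (length-±-cons v (F b)))) ⟩
    (2 * length (F b) + length (tails F (suc v) b)) * q
      ≡⟨ expand (length (F b)) (length (tails F (suc v) b)) q ⟩
    2 * (length (F b) * q) + length (tails F (suc v) b) * q
      ≤⟨ ℕ.+-mono-≤ (ℕ.*-monoʳ-≤ 2 (bound b)) (length-tails (suc v) b) ⟩
    2 * (a * 2 ^ b) + 2 * (a * 2 ^ b)
      ≡⟨ collect a (2 ^ b) ⟩
    2 * (a * 2 ^ suc b)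
      ∎
    where
    expand : ∀ l t q → (2 * l + t) * q ≡ 2 * (l * q) + t * q
    expand = ℕ-Solver.solve-∀
    collect : ∀ a x → 2 * (a * x) + 2 * (a * x) ≡ 2 * (a * (2 * x))
    collect = ℕ-Solver.solve-∀

  length-farther : ∀ b → 2 * (length (farther F b) * q) ≤ a * 2 ^ b
  length-farther zero          = z≤n
  length-farther (suc zero)    = z≤n
  length-farther (suc (suc b)) = begin
    2 * (length (tails F 3 b) * q)  ≤⟨ ℕ.*-monoʳ-≤ 2 (length-tails 3 b) ⟩
    2 * (2 * (a * 2 ^ b))           ≡⟨ collect a (2 ^ b) ⟩
    a * 2 ^ suc (suc b)             ∎
    where
    collect : ∀ a x → 2 * (2 * (a * x)) ≡ a * (2 * (2 * x))
    collect = ℕ-Solver.solve-∀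

  length-far : ∀ b → 4 * (length (far F b) * q) ≤ 5 * (a * 2 ^ b)
  length-far zero    = z≤n
  length-far (suc b) = begin
    4 * (length (±-cons 2 (F b) ++ farther F b) * q)
      ≡⟨ cong (λ l → 4 * (l * q)) (trans (length-++ (±-cons 2 (F b))) (cong (_+ length (farther F b)) (length-±-cons 2 (F b)))) ⟩
    4 * ((2 * length (F b) + length (farther F b)) * q)
      ≡⟨ expand (length (F b)) (length (farther F b)) q ⟩
    8 * (length (F b) * q) + 2 * (2 * (length (farther F b) * q))
      ≤⟨ ℕ.+-mono-≤ (ℕ.*-monoʳ-≤ 8 (bound b)) (ℕ.*-monoʳ-≤ 2 (length-farther b)) ⟩
    8 * (a * 2 ^ b) + 2 * (a * 2 ^ b)
      ≡⟨ collect a (2 ^ b) ⟩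
    5 * (a * 2 ^ suc b)
      ∎
    where
    expand : ∀ l t q → 4 * ((2 * l + t) * q) ≡ 8 * (l * q) + 2 * (2 * (t * q))
    expand = ℕ-Solver.solve-∀
    collect : ∀ a x → 8 * (a * x) + 2 * (a * x) ≡ 5 * (a * (2 * x))
    collect = ℕ-Solver.solve-∀

  -- One more coordinate multiplies the bound by the sum of 2^(- cost) over its values: 3 for 0 and
  -- ±1, 1 for ±2, and 2 (1/16 + 1/32 + ...) = 1/4 for the rest, in total 17/4.
  length-extend : ∀ b → length (extend F b) * (4 * q) ≤ (17 * a) * 2 ^ b
  length-extend b = begin
    length (extend F b) * (4 * q)
      ≡⟨ cong (_* (4 * q)) (trans (length-++ (map (+ 0 ∷_) (F b) ++ ±-cons 1 (F b))) (cong (_+ length (far F b))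
           (trans (length-++ (map (+ 0 ∷_) (F b))) (cong₂ _+_ (length-map _ (F b)) (length-±-cons 1 (F b)))))) ⟩
    (length (F b) + 2 * length (F b) + length (far F b)) * (4 * q)
      ≡⟨ expand (length (F b)) (length (far F b)) q ⟩
    12 * (length (F b) * q) + 4 * (length (far F b) * q)
      ≤⟨ ℕ.+-mono-≤ (ℕ.*-monoʳ-≤ 12 (bound b)) (length-far b) ⟩
    12 * (a * 2 ^ b) + 5 * (a * 2 ^ b)
      ≡⟨ collect a (2 ^ b) ⟩
    (17 * a) * 2 ^ b
      ∎
    where
    expand : ∀ l t q → (l + 2 * l + t) * (4 * q) ≡ 12 * (l * q) + 4 * (t * q)
    expand = ℕ-Solver.solve-∀
    collect : ∀ a x → 12 * (a * x) + 5 * (a * x) ≡ 17 * a * x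
    collect = ℕ-Solver.solve-∀

length-cheap : ∀ n b → length (cheap n b) * 4 ^ n ≤ 17 ^ n * 2 ^ b
length-cheap zero    b = ℕ.≤-trans (ℕ.m^n>0 2 b) (ℕ.≤-reflexive (sym (ℕ.*-identityˡ (2 ^ b))))
length-cheap (suc n) b = length-extend {F = cheap n} (4 ^ n) (17 ^ n) (length-cheap n) b

^-distribʳ-* : ∀ n a b → (a * b) ^ n ≡ a ^ n * b ^ n
^-distribʳ-* zero    a b = refl
^-distribʳ-* (suc n) a b = trans (cong (a * b *_) (^-distribʳ-* n a b)) (swap a b (a ^ n) (b ^ n))
  where
  swap : ∀ a b x y → a * b * (x * y) ≡ a * x * (b * y)
  swap = ℕ-Solver.solve-∀

-- The exponential-moment bound (17/4)ⁿ 2^b at the budget b = 3 n, where 17/4 · 8 = 34.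
length-cheap-3n : ∀ n → length (cheap n (3 * n)) ≤ 34 ^ n
length-cheap-3n n = ℕ.*-cancelʳ-≤ _ _ (4 ^ n) {{ℕ.m^n≢0 4 n}} (begin
  length (cheap n (3 * n)) * 4 ^ n   ≤⟨ length-cheap n (3 * n) ⟩
  17 ^ n * 2 ^ (3 * n)               ≡⟨ cong (17 ^ n *_) (ℕ.^-*-assoc 2 3 n) ⟨
  17 ^ n * 8 ^ n                     ≡⟨ ^-distribʳ-* n 17 8 ⟨
  136 ^ n                            ≡⟨ ^-distribʳ-* n 34 4 ⟩
  34 ^ n * 4 ^ n                     ∎)
  where open ℕ.≤-Reasoning

-- Cubes whose indices differ by z in a coordinate hold points that, up to rounding, are at least 14
-- times this number apart in that coordinate (`Near⇒excess`). Equal and adjacent indices give no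
-- lower bound.
excess : ℤ → ℕ
excess z = ℤ.∣ z ∣ ∸ 1

excess² : ∀ {n} → Vec ℤ n → ℕ
excess² []      = 0
excess² (z ∷ v) = excess z * excess z + excess² v

cost≤ : ∀ x → cost x ≤ (x ∸ 1) * (x ∸ 1)
cost≤ 0 = z≤n
cost≤ 1 = z≤n
cost≤ 2 = s≤s z≤n
cost≤ (suc (suc (suc x))) = begin
  4 + x                            ≤⟨ ℕ.m≤m+n (4 + x) (x * x + 3 * x) ⟩
  4 + x + (x * x + 3 * x)          ≡⟨ square x ⟩
  suc (suc x) * suc (suc x)        ∎
  where
  open ℕ.≤-Reasoning
  square : ∀ x → 4 + x + (x * x + 3 * x) ≡ (2 + x) * (2 + x)
  square = ℕ-Solver.solve-∀

cost-sum≤ : ∀ {n} (v : Vec ℤ n) → cost-sum v ≤ excess² v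
cost-sum≤ []      = z≤n
cost-sum≤ (z ∷ v) = ℕ.+-mono-≤ (cost≤ ℤ.∣ z ∣) (cost-sum≤ v)

module Residue (T : ℕ) {{_ : ℕ.NonZero T}} where

  remainder-unique : ∀ {a b} r → a < T → b < T → + a ≡ + b ℤ.+ + T ℤ.* r → a ≡ b
  remainder-unique {a} {b} (+ zero) a<T b<T eq = ℤ.+-injective (trans eq (trans (cong (λ t → + b ℤ.+ t) (ℤ.*-zeroʳ (+ T))) (ℤ.+-identityʳ (+ b))))
  remainder-unique {a} {b} (+ suc r) a<T b<T eq = ⊥-elim (ℕ.<-irrefl refl (ℕ.<-≤-trans a<T (begin
    T                ≤⟨ ℕ.m≤m*n T (suc r) ⟩
    T * suc r        ≤⟨ ℕ.m≤n+m _ b ⟩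
    b + T * suc r    ≡⟨ ℤ.+-injective (trans eq (cong (λ t → + b ℤ.+ t) (sym (ℤ.pos-* T (suc r))))) ⟨
    a                ∎)))
    where open ℕ.≤-Reasoning
  remainder-unique {a} {b} -[1+ r ] a<T b<T eq = ⊥-elim (ℕ.<-irrefl refl (ℕ.<-≤-trans b<T (begin
    T                ≤⟨ ℕ.m≤m*n T (suc r) ⟩
    T * suc r        ≤⟨ ℕ.m≤n+m _ a ⟩
    a + T * suc r    ≡⟨ ℤ.+-injective (trans (cong (λ t → + a ℤ.+ t) (ℤ.pos-* T (suc r))) (trans (cong (ℤ._+ + T ℤ.* + suc r) eq) (cancel (+ b) (+ T) (+ suc r)))) ⟩
    b                ∎)))
    where
    open ℕ.≤-Reasoning
    cancel : ∀ b t r → b ℤ.+ t ℤ.* (ℤ.- r) ℤ.+ t ℤ.* r ≡ b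
    cancel = ℤ-Solver.solve-∀

  rem : ℤ → ℕ
  rem z = z ℤ.%ℕ T

  rem-≡ : ∀ z → z ≡ + rem z ℤ.+ + T ℤ.* (z ℤ./ℕ T)
  rem-≡ z = trans (ℤ.a≡a%ℕn+[a/ℕn]*n z T) (cong (λ t → + rem z ℤ.+ t) (ℤ.*-comm (z ℤ./ℕ T) (+ T)))

  rem-shift : ∀ z r → rem (z ℤ.+ + T ℤ.* r) ≡ rem z
  rem-shift z r = remainder-unique (z ℤ./ℕ T ℤ.+ r ℤ.- y ℤ./ℕ T) (ℤ.n%ℕd<d y T) (ℤ.n%ℕd<d z T)
    (trans (solve-for (+ rem y) (+ T) (y ℤ./ℕ T) y (rem-≡ y)) (trans (cong (λ z → z ℤ.+ + T ℤ.* r ℤ.- + T ℤ.* (y ℤ./ℕ T)) (rem-≡ z))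
      (regroup (+ rem z) (+ T) (z ℤ./ℕ T) r (y ℤ./ℕ T))))
    where
    y : ℤ
    y = z ℤ.+ + T ℤ.* r
    add-sub : ∀ a t q → a ≡ a ℤ.+ t ℤ.* q ℤ.- t ℤ.* q
    add-sub = ℤ-Solver.solve-∀
    solve-for : ∀ a t q y → y ≡ a ℤ.+ t ℤ.* q → a ≡ y ℤ.- t ℤ.* q
    solve-for a t q y refl = add-sub a t q
    regroup : ∀ a t q r s → a ℤ.+ t ℤ.* q ℤ.+ t ℤ.* r ℤ.- t ℤ.* s ≡ a ℤ.+ t ℤ.* (q ℤ.+ r ℤ.- s)
    regroup = ℤ-Solver.solve-∀

  rem-≡⇒shift : ∀ {x y} → rem x ≡ rem y → ∃ λ r → x ≡ y ℤ.+ + T ℤ.* r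
  rem-≡⇒shift {x} {y} eq = x ℤ./ℕ T ℤ.- y ℤ./ℕ T , trans (rem-≡ x)
    (trans (cong (λ a → + a ℤ.+ + T ℤ.* (x ℤ./ℕ T)) eq)
      (trans (regroup (+ rem y) (+ T) (x ℤ./ℕ T) (y ℤ./ℕ T)) (cong (ℤ._+ + T ℤ.* (x ℤ./ℕ T ℤ.- y ℤ./ℕ T)) (sym (rem-≡ y)))))
    where
    regroup : ∀ a t q s → a ℤ.+ t ℤ.* q ≡ a ℤ.+ t ℤ.* s ℤ.+ t ℤ.* (q ℤ.- s)
    regroup = ℤ-Solver.solve-∀

-- Numerical estimates

^ℚ-+ : ∀ q a b → q ^ℚ (a + b) ≡ q ^ℚ a ℚ.* q ^ℚ b
^ℚ-+ q zero    b = sym (ℚ.*-identityˡ _)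
^ℚ-+ q (suc a) b = trans (cong (q ℚ.*_) (^ℚ-+ q a b)) (sym (ℚ.*-assoc q (q ^ℚ a) (q ^ℚ b)))

^ℚ-* : ∀ q a b → q ^ℚ (b * a) ≡ (q ^ℚ a) ^ℚ b
^ℚ-* q a zero    = refl
^ℚ-* q a (suc b) = trans (^ℚ-+ q a (b * a)) (cong (q ^ℚ a ℚ.*_) (^ℚ-* q a b))

^ℚ-≤1 : ∀ {q} n → 0ℚ ℚ.≤ q → q ℚ.≤ 1ℚ → q ^ℚ n ℚ.≤ 1ℚ
^ℚ-≤1 zero    0≤q q≤1 = ℚ.≤-refl
^ℚ-≤1 {q} (suc n) 0≤q q≤1 = *-mono-≤′ 0≤q 0≤1 q≤1 (^ℚ-≤1 n 0≤q q≤1)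

^ℚ-antimono : ∀ {q a b} → 0ℚ ℚ.≤ q → q ℚ.≤ 1ℚ → a ≤ b → q ^ℚ b ℚ.≤ q ^ℚ a
^ℚ-antimono {q} {a} {b} 0≤q q≤1 a≤b = begin
  q ^ℚ b                      ≡⟨ cong (q ^ℚ_) (ℕ.m+[n∸m]≡n a≤b) ⟨
  q ^ℚ (a + (b ∸ a))          ≡⟨ ^ℚ-+ q a (b ∸ a) ⟩
  q ^ℚ a ℚ.* q ^ℚ (b ∸ a)     ≤⟨ ℚ.*-monoˡ-≤-nonNeg (q ^ℚ a) {{ℚ.nonNegative (0≤^ a 0≤q)}} (^ℚ-≤1 (b ∸ a) 0≤q q≤1) ⟩
  q ^ℚ a ℚ.* 1ℚ               ≡⟨ ℚ.*-identityʳ (q ^ℚ a) ⟩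
  q ^ℚ a                      ∎
  where open ℚ.≤-Reasoning

ι-suc : ∀ N → ι (+ suc N) ≡ 1ℚ ℚ.+ ι (+ N)
ι-suc N = ι-+ (+ 1) (+ N)

0≤ι : ∀ N → 0ℚ ℚ.≤ ι (+ N)
0≤ι N = ι-mono-≤ (ℤ.+≤+ z≤n)

-- Multiply Bernoulli's inequality 1 + N x ≤ (1 + x) ^ N by (1 - x) ^ N.
bernoulli : ∀ {x} N → 0ℚ ℚ.≤ x → x ℚ.≤ 1ℚ → (1ℚ ℚ.- x) ^ℚ N ℚ.* (1ℚ ℚ.+ ι (+ N) ℚ.* x) ℚ.≤ 1ℚ
bernoulli {x} zero    0≤x x≤1 = ℚ.≤-reflexive (unit x)
  where
  unit : ∀ x → 1ℚ ℚ.* (1ℚ ℚ.+ 0ℚ ℚ.* x) ≡ 1ℚ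
  unit = solve-∀ ℚ-ring
bernoulli {x} (suc N) 0≤x x≤1 = begin
  (1ℚ ℚ.- x) ℚ.* y ℚ.* (1ℚ ℚ.+ ι (+ suc N) ℚ.* x)
    ≡⟨ cong (λ c → (1ℚ ℚ.- x) ℚ.* y ℚ.* (1ℚ ℚ.+ c ℚ.* x)) (ι-suc N) ⟩
  (1ℚ ℚ.- x) ℚ.* y ℚ.* (1ℚ ℚ.+ (1ℚ ℚ.+ ι (+ N)) ℚ.* x)
    ≤⟨ ≤-cert (y ℚ.* ((1ℚ ℚ.+ ι (+ N)) ℚ.* (x ℚ.* x))) (expand x y (ι (+ N)))
         (0≤-* (0≤^ N (0≤-diff x≤1)) (0≤-* (0≤-+ 0≤1 (0≤ι N)) (0≤-* 0≤x 0≤x))) ⟩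
  y ℚ.* (1ℚ ℚ.+ ι (+ N) ℚ.* x)
    ≤⟨ bernoulli N 0≤x x≤1 ⟩
  1ℚ ∎
  where
  open ℚ.≤-Reasoning
  y : ℚ
  y = (1ℚ ℚ.- x) ^ℚ N
  expand : ∀ x y c → y ℚ.* (1ℚ ℚ.+ c ℚ.* x) ℚ.- (1ℚ ℚ.- x) ℚ.* y ℚ.* (1ℚ ℚ.+ (1ℚ ℚ.+ c) ℚ.* x) ≡
    y ℚ.* ((1ℚ ℚ.+ c) ℚ.* (x ℚ.* x))
  expand = solve-∀ ℚ-ring

2^*≤1 : ∀ {q} L → 0ℚ ℚ.≤ q → q ℚ.* ι (+ 2) ℚ.≤ 1ℚ → ι (+ (2 ^ L)) ℚ.* q ^ℚ L ℚ.≤ 1ℚ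
2^*≤1     zero    0≤q q≤½ = ℚ.≤-refl
2^*≤1 {q} (suc L) 0≤q q≤½ = begin
  ι (+ (2 * 2 ^ L)) ℚ.* (q ℚ.* q ^ℚ L)
    ≡⟨ cong (λ c → c ℚ.* (q ℚ.* q ^ℚ L)) (trans (cong ι (ℤ.pos-* 2 (2 ^ L))) (ι-* (+ 2) (+ (2 ^ L)))) ⟩
  (ι (+ 2) ℚ.* ι (+ (2 ^ L))) ℚ.* (q ℚ.* q ^ℚ L)
    ≡⟨ swap (ι (+ 2)) (ι (+ (2 ^ L))) q (q ^ℚ L) ⟩
  (q ℚ.* ι (+ 2)) ℚ.* (ι (+ (2 ^ L)) ℚ.* q ^ℚ L)
    ≤⟨ *-mono-≤′ (0≤-* 0≤q (0≤ι 2)) 0≤1 q≤½ (2^*≤1 L 0≤q q≤½) ⟩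
  1ℚ ∎
  where
  open ℚ.≤-Reasoning
  swap : ∀ a b c d → (a ℚ.* b) ℚ.* (c ℚ.* d) ≡ (c ℚ.* a) ℚ.* (b ℚ.* d)
  swap = solve-∀ ℚ-ring

-- Here β = 1 - p / 2 and 4 D · p / 2 = 1, so Bernoulli gives β^(4D) ≤ 1/2. Therefore β^M ≤ 2^(-L),
-- and W such terms sum to at most 1/2.
union-bound : ∀ {p} D M L W (let β = 1ℚ ℚ.- p ℚ.+ p ℚ.* (ι (+ D) ℚ.* p)) →
  0ℚ ℚ.≤ p → p ℚ.≤ 1ℚ → ι (+ D) ℚ.* p ≡ ½ → 4 * D * L ≤ M → 2 * W ≤ 2 ^ L →
  ι (+ W) ℚ.* β ^ℚ M ℚ.< 1ℚ
union-bound {p} D M L W 0≤p p≤1 Dp≡½ NL≤M 2W≤2^L =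
  ℚ.*-cancelˡ-<-nonNeg (ι (+ 2)) (ℚ.≤-<-trans (begin
    ι (+ 2) ℚ.* (ι (+ W) ℚ.* β ^ℚ M)       ≡⟨ ℚ.*-assoc (ι (+ 2)) (ι (+ W)) (β ^ℚ M) ⟨
    (ι (+ 2) ℚ.* ι (+ W)) ℚ.* β ^ℚ M       ≡⟨ cong (ℚ._* β ^ℚ M) (trans (cong ι (ℤ.pos-* 2 W)) (ι-* (+ 2) (+ W))) ⟨
    ι (+ (2 * W)) ℚ.* β ^ℚ M               ≤⟨ *-mono-≤′ (0≤ι (2 * W)) (0≤^ L (0≤^ N 0≤β)) (ι-mono-≤ (ℤ.+≤+ 2W≤2^L)) β^M≤ ⟩
    ι (+ (2 ^ L)) ℚ.* (β ^ℚ N) ^ℚ L        ≤⟨ 2^*≤1 L (0≤^ N 0≤β) β^N≤½ ⟩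
    1ℚ                                     ∎) 1<2)
  where
  open ℚ.≤-Reasoning
  N : ℕ
  N = 4 * D
  β x : ℚ
  β = 1ℚ ℚ.- p ℚ.+ p ℚ.* (ι (+ D) ℚ.* p)
  x = ½ ℚ.* p
  1<2 : 1ℚ ℚ.< ι (+ 2) ℚ.* 1ℚ
  1<2 = ι-mono-< {+ 1} {+ 2} (ℤ.+<+ (s≤s (s≤s z≤n)))
  0≤½ : 0ℚ ℚ.≤ ½
  0≤½ = ℚ.nonNegative⁻¹ ½
  0≤x : 0ℚ ℚ.≤ x
  0≤x = 0≤-* 0≤½ 0≤p
  x≤1 : x ℚ.≤ 1ℚ
  x≤1 = ℚ.≤-trans (≤-cert x (halve p) 0≤x) p≤1
    where
    halve : ∀ p → p ℚ.- ½ ℚ.* p ≡ ½ ℚ.* p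
    halve = solve-∀ ℚ-ring
  β≡1-x : β ≡ 1ℚ ℚ.- x
  β≡1-x = trans (cong (λ y → 1ℚ ℚ.- p ℚ.+ p ℚ.* y) Dp≡½) (halve p)
    where
    halve : ∀ p → 1ℚ ℚ.- p ℚ.+ p ℚ.* ½ ≡ 1ℚ ℚ.- ½ ℚ.* p
    halve = solve-∀ ℚ-ring
  0≤β : 0ℚ ℚ.≤ β
  0≤β = subst (0ℚ ℚ.≤_) (sym β≡1-x) (0≤-diff x≤1)
  β≤1 : β ℚ.≤ 1ℚ
  β≤1 = subst (ℚ._≤ 1ℚ) (sym β≡1-x) (≤-cert x (cancel x) 0≤x)
    where
    cancel : ∀ x → 1ℚ ℚ.- (1ℚ ℚ.- x) ≡ x
    cancel = solve-∀ ℚ-ring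
  β^M≤ : β ^ℚ M ℚ.≤ (β ^ℚ N) ^ℚ L
  β^M≤ = subst (β ^ℚ M ℚ.≤_) (trans (cong (β ^ℚ_) (ℕ.*-comm N L)) (^ℚ-* β N L)) (^ℚ-antimono 0≤β β≤1 NL≤M)
  Nx≡1 : ι (+ N) ℚ.* x ≡ 1ℚ
  Nx≡1 = trans (cong (ℚ._* x) (trans (cong ι (ℤ.pos-* 4 D)) (ι-* (+ 4) (+ D))))
    (trans (regroup (ι (+ D)) p) (cong (ι (+ 2) ℚ.*_) Dp≡½))
    where
    regroup : ∀ d p → ι (+ 4) ℚ.* d ℚ.* (½ ℚ.* p) ≡ ι (+ 2) ℚ.* (d ℚ.* p)
    regroup = solve-∀ ℚ-ring
  β^N≤½ : β ^ℚ N ℚ.* ι (+ 2) ℚ.≤ 1ℚ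
  β^N≤½ = subst (ℚ._≤ 1ℚ) (cong₂ (λ b c → b ^ℚ N ℚ.* (1ℚ ℚ.+ c)) (sym β≡1-x) Nx≡1) (bernoulli N 0≤x x≤1)

suc≤2^ : ∀ r → suc r ≤ 2 ^ r
suc≤2^ zero    = s≤s z≤n
suc≤2^ (suc r) = begin
  suc (suc r)      ≤⟨ ℕ.m≤m+n (suc (suc r)) r ⟩
  suc (suc r) + r  ≡⟨ double r ⟩
  2 * suc r        ≤⟨ ℕ.*-monoʳ-≤ 2 (suc≤2^ r) ⟩
  2 ^ suc r        ∎
  where
  open ℕ.≤-Reasoning
  double : ∀ r → suc (suc r) + r ≡ 2 * suc r
  double = ℕ-Solver.solve-∀

-- The powers of ten are kept behind equations, since Agda would unfold them into iterated sums.
module Numbers (r m Q T : ℕ)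
  (m≡ : m ≡ 10 ^ (5 * suc r)) (Q≡ : Q ≡ 32 * m) (T≡ : T ≡ 4 * suc r * m) where

  open ℕ.≤-Reasoning

  -- `M` is m / 8, one test for every eighth point. `L` must exceed the O(n²) bits of a code and
  -- still satisfy 4 · 34ⁿ · L ≤ M; the factors 4 · 34 · 90 = 12240 ≤ 12500 and 34 · 100 ≤ 100000
  -- arrange this.
  n M L : ℕ
  n = suc r
  M = 12500 * 10 ^ (5 * r)
  L = 90 * 100 ^ r

  m≡10^5*  : m ≡ 100000 * 10 ^ (5 * r)
  m≡10^5* = trans m≡ (trans (cong (10 ^_) (ℕ.*-suc 5 r)) (ℕ.^-distribˡ-+-* 10 5 (5 * r)))

  m≡8M : m ≡ 8 * M
  m≡8M = trans m≡10^5* (ℕ.*-assoc 8 12500 (10 ^ (5 * r)))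

  1000≤m : 1000 ≤ m
  1000≤m = begin
    1000                    ≤⟨ ℕ.≤ᵇ⇒≤ 1000 100000 _ ⟩
    100000                  ≤⟨ ℕ.m≤m*n 100000 (10 ^ (5 * r)) {{ℕ.m^n≢0 10 (5 * r)}} ⟩
    100000 * 10 ^ (5 * r)   ≡⟨ m≡10^5* ⟨
    m                       ∎

  10^5r : 10 ^ (5 * r) ≡ 100000 ^ r
  10^5r = sym (ℕ.^-*-assoc 10 5 r)

  4DL≤M : 4 * 34 ^ suc r * L ≤ M
  4DL≤M = begin
    4 * (34 * 34 ^ r) * (90 * 100 ^ r)  ≡⟨ regroup (34 ^ r) (100 ^ r) ⟩
    12240 * (34 ^ r * 100 ^ r)          ≡⟨ cong (12240 *_) (^-distribʳ-* r 34 100) ⟨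
    12240 * 3400 ^ r                    ≤⟨ ℕ.*-mono-≤ (ℕ.≤ᵇ⇒≤ 12240 12500 _) (ℕ.^-monoˡ-≤ r (ℕ.≤ᵇ⇒≤ 3400 100000 _)) ⟩
    12500 * 100000 ^ r                  ≡⟨ cong (12500 *_) 10^5r ⟨
    M                                   ∎
    where
    regroup : ∀ a b → 4 * (34 * a) * (90 * b) ≡ 12240 * (a * b)
    regroup = ℕ-Solver.solve-∀

  m≤2^ : m ≤ 2 ^ (17 * n)
  m≤2^ = begin
    m                ≡⟨ m≡ ⟩
    10 ^ (5 * n)     ≡⟨ ℕ.^-*-assoc 10 5 n ⟨
    100000 ^ n       ≤⟨ ℕ.^-monoˡ-≤ n (ℕ.≤ᵇ⇒≤ 100000 131072 _) ⟩
    (2 ^ 17) ^ n     ≡⟨ ℕ.^-*-assoc 2 17 n ⟩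
    2 ^ (17 * n)     ∎

  -- The exponent collects 7 from 128, r = n - 1 from the factor n, and 34 n from m².
  QT≤2^ : Q * T ≤ 2 ^ (35 * n + 6)
  QT≤2^ = begin
    Q * T
      ≡⟨ cong₂ _*_ Q≡ T≡ ⟩
    32 * m * (4 * n * m)
      ≡⟨ regroup m n ⟩
    128 * n * (m * m)
      ≤⟨ ℕ.*-mono-≤ (ℕ.*-monoʳ-≤ 128 (suc≤2^ r)) (ℕ.*-mono-≤ m≤2^ m≤2^) ⟩
    128 * 2 ^ r * (2 ^ (17 * n) * 2 ^ (17 * n))
      ≡⟨ cong₂ _*_ (ℕ.^-distribˡ-+-* 2 7 r) (ℕ.^-distribˡ-+-* 2 (17 * n) (17 * n)) ⟨
    2 ^ (7 + r) * 2 ^ (17 * n + 17 * n)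
      ≡⟨ ℕ.^-distribˡ-+-* 2 (7 + r) (17 * n + 17 * n) ⟨
    2 ^ (7 + r + (17 * n + 17 * n))
      ≡⟨ cong (2 ^_) (exponent r) ⟩
    2 ^ (35 * n + 6)
      ∎
    where
    regroup : ∀ m n → 32 * m * (4 * n * m) ≡ 128 * n * (m * m)
    regroup = ℕ-Solver.solve-∀
    exponent : ∀ r → 7 + r + (17 * suc r + 17 * suc r) ≡ 35 * suc r + 6
    exponent = ℕ-Solver.solve-∀

  exponent≤L : suc ((35 * n + 6 + (35 * n + 6)) * n) ≤ L
  exponent≤L = begin
    suc ((35 * n + 6 + (35 * n + 6)) * n)
      ≡⟨ square n ⟩
    70 * (n * n) + 12 * n + 1
      -- This is 19 n² - 12 n expanded at n = r + 1, which makes all coefficients nonnegative.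
      ≤⟨ ℕ.m≤m+n _ (19 * (r * r) + 26 * r + 7) ⟩
    70 * (n * n) + 12 * n + 1 + (19 * (r * r) + 26 * r + 7)
      ≤⟨ ℕ.≤-reflexive (complete r) ⟩
    89 * (n * n) + 1
      ≤⟨ ℕ.+-monoʳ-≤ (89 * (n * n)) (s≤s z≤n) ⟩
    89 * (n * n) + n * n
      ≡⟨ ninety (n * n) ⟩
    90 * (n * n)
      ≤⟨ ℕ.*-monoʳ-≤ 90 (ℕ.*-mono-≤ (suc≤2^ r) (suc≤2^ r)) ⟩
    90 * (2 ^ r * 2 ^ r)
      ≡⟨ cong (90 *_) (^-distribʳ-* r 2 2) ⟨
    90 * 4 ^ r
      ≤⟨ ℕ.*-monoʳ-≤ 90 (ℕ.^-monoˡ-≤ r (ℕ.≤ᵇ⇒≤ 4 100 _)) ⟩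
    90 * 100 ^ r
      ∎
    where
    square : ∀ n → suc ((35 * n + 6 + (35 * n + 6)) * n) ≡ 70 * (n * n) + 12 * n + 1
    square = ℕ-Solver.solve-∀
    ninety : ∀ x → 89 * x + x ≡ 90 * x
    ninety = ℕ-Solver.solve-∀
    complete : ∀ r → 70 * (suc r * suc r) + 12 * suc r + 1 + (19 * (r * r) + 26 * r + 7) ≡ 89 * (suc r * suc r) + 1
    complete = ℕ-Solver.solve-∀

  2[QT]^≤2^L : 2 * ((Q * T) * (Q * T)) ^ n ≤ 2 ^ L
  2[QT]^≤2^L = begin
    2 * ((Q * T) * (Q * T)) ^ n
      ≤⟨ ℕ.*-monoʳ-≤ 2 (ℕ.^-monoˡ-≤ n (ℕ.*-mono-≤ QT≤2^ QT≤2^)) ⟩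
    2 * (2 ^ (35 * n + 6) * 2 ^ (35 * n + 6)) ^ n
      ≡⟨ cong (λ x → 2 * x ^ n) (ℕ.^-distribˡ-+-* 2 (35 * n + 6) (35 * n + 6)) ⟨
    2 * (2 ^ (35 * n + 6 + (35 * n + 6))) ^ n
      ≡⟨ cong (2 *_) (ℕ.^-*-assoc 2 (35 * n + 6 + (35 * n + 6)) n) ⟩
    2 ^ suc ((35 * n + 6 + (35 * n + 6)) * n)
      ≤⟨ ℕ.^-monoʳ-≤ 2 exponent≤L ⟩
    2 ^ L
      ∎

integer-sqrt : ∀ a → ∃ λ j → j * j ≤ a × a < suc j * suc j
integer-sqrt zero    = 0 , z≤n , s≤s z≤n
integer-sqrt (suc a) with integer-sqrt a
... | j , lo , hi with suc a ℕ.<? suc j * suc j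
...   | yes hi′ = j , ℕ.m≤n⇒m≤1+n lo , hi′
...   | no ¬hi′ = suc j , ℕ.≮⇒≥ ¬hi′ , ℕ.≤-<-trans hi (ℕ.*-mono-< {suc j} {suc (suc j)} ℕ.≤-refl ℕ.≤-refl)

-- The interval from 19 √n to 20 √n has length √n ≥ 1 and so contains an integer; the first one
-- above the integer square root of 361 n serves.
scale : ∀ r → ∃ λ k → 361 * suc r ≤ k * k × k * k ≤ 400 * suc r
scale r with integer-sqrt (361 * suc r)
... | j , lo , hi = suc j , ℕ.<⇒≤ hi , (begin
  suc j * suc j                  ≡⟨ expand j ⟩
  j * j + (2 * j + 1)            ≤⟨ ℕ.+-mono-≤ lo (ℕ.+-mono-≤ (ℕ.*-monoʳ-≤ 2 j≤19n) (s≤s z≤n)) ⟩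
  361 * n + (2 * (19 * n) + n)   ≡⟨ collect n ⟩
  400 * n                        ∎)
  where
  open ℕ.≤-Reasoning
  n : ℕ
  n = suc r
  expand : ∀ k → suc k * suc k ≡ k * k + (2 * k + 1)
  expand = ℕ-Solver.solve-∀
  collect : ∀ n → 361 * n + (2 * (19 * n) + n) ≡ 400 * n
  collect = ℕ-Solver.solve-∀
  square : ∀ n → 361 * (n * n) ≡ (19 * n) * (19 * n)
  square = ℕ-Solver.solve-∀
  j≤19n : j ≤ 19 * n
  j≤19n = ℕ.≮⇒≥ λ 19n<j → ℕ.<-irrefl refl (begin-strict
    j * j                  ≤⟨ lo ⟩
    361 * n                ≤⟨ ℕ.*-monoʳ-≤ 361 (ℕ.m≤m*n n n) ⟩
    361 * (n * n)          ≡⟨ square n ⟩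
    (19 * n) * (19 * n)    <⟨ ℕ.*-mono-< 19n<j 19n<j ⟩
    j * j                  ∎)

-- Tests attached to cells of the torus

∣z∣≤1+excess² : ∀ {n} (v : Vec ℤ n) j → ℤ.∣ lookup v j ∣ ≤ suc (excess² v)
∣z∣≤1+excess² (z ∷ v) zero = ℕ.≤-trans (le ℤ.∣ z ∣) (s≤s (ℕ.m≤m+n _ _))
  where
  le : ∀ x → x ≤ suc ((x ∸ 1) * (x ∸ 1))
  le zero          = z≤n
  le (suc zero)    = s≤s z≤n
  le (suc (suc x)) = s≤s (ℕ.m≤m*n (suc x) (suc x))
∣z∣≤1+excess² (z ∷ v) (suc j) = ℕ.≤-trans (∣z∣≤1+excess² v j) (s≤s (ℕ.m≤n+m (excess² v) (excess z * excess z)))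

excess²-0 : ∀ n → excess² (replicate n (+ 0)) ≡ 0
excess²-0 zero    = refl
excess²-0 (suc n) = excess²-0 n

Cell : ℕ → Set
Cell n = Fin n → ℤ

_⊕_ : ∀ {n} → Cell n → Vec ℤ n → Cell n
(c ⊕ z) j = c j ℤ.+ lookup z j

difference : ∀ {n} → Cell n → Cell n → Vec ℤ n
difference c′ c = tabulate λ j → c′ j ℤ.- c j

⊕-difference : ∀ {n} (c c′ : Cell n) j → (c ⊕ difference c′ c) j ≡ c′ j
⊕-difference c c′ j = trans (cong (λ d → c j ℤ.+ d) (lookup∘tabulate (λ j → c′ j ℤ.- c j) j)) (cancel (c j) (c′ j))
  where
  cancel : ∀ a b → a ℤ.+ (b ℤ.- a) ≡ b
  cancel = ℤ-Solver.solve-∀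

module Torus (n T : ℕ) {{T≢0 : ℕ.NonZero T}} (p : ℚ) (0≤p : 0ℚ ℚ.≤ p) (p≤1 : p ℚ.≤ 1ℚ) where

  open Residue T
  open Marking (≡-dec {n = n} ℕ._≟_) p 0≤p p≤1 public

  residue : Cell n → Vec ℕ n
  residue c = tabulate λ j → rem (c j)

  residue-cong : ∀ {c c′} → (∀ j → c j ≡ c′ j) → residue c ≡ residue c′
  residue-cong eq = tabulate-cong λ j → cong rem (eq j)

  residue-shift : ∀ c {r : Cell n} → residue (λ j → c j ℤ.+ + T ℤ.* r j) ≡ residue c
  residue-shift c {r} = tabulate-cong λ j → rem-shift (c j) (r j)

  residue-≡⇒shift : ∀ {c c′} → residue c ≡ residue c′ → ∀ j → ∃ λ r → c j ≡ c′ j ℤ.+ + T ℤ.* r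
  residue-≡⇒shift {c} {c′} eq j = rem-≡⇒shift {c j} {c′ j} (begin
    rem (c j)              ≡⟨ lookup∘tabulate (λ j → rem (c j)) j ⟨
    lookup (residue c) j   ≡⟨ cong (λ v → lookup v j) eq ⟩
    lookup (residue c′) j  ≡⟨ lookup∘tabulate (λ j → rem (c′ j)) j ⟩
    rem (c′ j)             ∎)
    where open ≡-Reasoning

  Short : Vec ℤ n → Set
  Short z = excess² z ≤ 3 * n

  short? : ∀ z → Dec (Short z)
  short? z = excess² z ℕ.≤? 3 * n

  -- `cheap` contains every short vector but possibly others, since `cost` only bounds the squares
  -- from below. Filtering makes every key of a test come from a short vector, as the separation of
  -- tests requires.
  shorts : List (Vec ℤ n)
  shorts = filter short? (cheap n (3 * n))

  ∈-shorts : ∀ {z} → Short z → z ∈ shorts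
  ∈-shorts {z} short = ∈-filter⁺ short? (∈-cheap z (ℕ.≤-trans (cost-sum≤ z) short)) short

  other? : ∀ c a → Dec (a ≢ residue c)
  other? c a = ¬? (≡-dec ℕ._≟_ a (residue c))

  -- The zero vector is short, so the residue of `c` itself has to be removed from the neighbours;
  -- otherwise no test could pass.
  testAt : Cell n → Test
  testAt c = test (residue c) (filter (other? c) (map (λ z → residue (c ⊕ z)) shorts))

  testAt-shift : ∀ c {r : Cell n} → testAt (λ j → c j ℤ.+ + T ℤ.* r j) ≡ testAt c
  testAt-shift c {r} = cong₂ (λ a as → test a (filter (λ b → ¬? (≡-dec ℕ._≟_ b a)) as))
    (residue-shift c) (map-cong (λ z → trans
      (residue-cong λ j → swap (c j) (+ T ℤ.* r j) (lookup z j)) (residue-shift (c ⊕ z))) shorts)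
    where
    swap : ∀ a b d → a ℤ.+ b ℤ.+ d ≡ a ℤ.+ d ℤ.+ b
    swap = ℤ-Solver.solve-∀

  testAt-cong : ∀ {c c′} → (∀ j → c j ≡ c′ j) → testAt c ≡ testAt c′
  testAt-cong {c} {c′} eq = cong₂ (λ a as → test a (filter (λ b → ¬? (≡-dec ℕ._≟_ b a)) as))
    (residue-cong eq) (map-cong (λ z → residue-cong λ j → cong (ℤ._+ lookup z j) (eq j)) shorts)

  testAt-admissible : ∀ c → Admissible (34 ^ n) (testAt c)
  testAt-admissible c = (λ c∈ → proj₂ (∈-filter⁻ (other? c) {xs = map (λ z → residue (c ⊕ z)) shorts} c∈) refl) , (begin
    length (filter (other? c) (map (λ z → residue (c ⊕ z)) shorts))  ≤⟨ length-filter (other? c) (map (λ z → residue (c ⊕ z)) shorts) ⟩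
    length (map (λ z → residue (c ⊕ z)) shorts)                      ≡⟨ length-map (λ z → residue (c ⊕ z)) shorts ⟩
    length shorts                                                    ≤⟨ length-filter short? (cheap n (3 * n)) ⟩
    length (cheap n (3 * n))                                         ≤⟨ length-cheap-3n n ⟩
    34 ^ n                                                           ∎)
    where open ℕ.≤-Reasoning

  ∈-keys⁻ : ∀ c {a} → a ∈ keys (testAt c) → ∃ λ z → Short z × a ≡ residue (c ⊕ z)
  ∈-keys⁻ c (here refl) = replicate n (+ 0) , subst (_≤ 3 * n) (sym (excess²-0 n)) z≤n ,
    residue-cong λ j → sym (trans (cong (λ d → c j ℤ.+ d) (lookup-replicate j (+ 0))) (ℤ.+-identityʳ (c j)))
  ∈-keys⁻ c (there a∈)
    with ∈-map⁻ (λ z → residue (c ⊕ z)) (proj₁ (∈-filter⁻ (other? c) {xs = map (λ z → residue (c ⊕ z)) shorts} a∈))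
  ... | z , z∈ , eq = z , proj₂ (∈-filter⁻ short? {xs = cheap n (3 * n)} z∈) , eq

  ∣T*r∣<T⇒r≡0 : ∀ r → ℤ.∣ + T ℤ.* r ∣ < T → r ≡ + 0
  ∣T*r∣<T⇒r≡0 (+ zero)    lt = refl
  ∣T*r∣<T⇒r≡0 r@(+ suc _) lt = ⊥-elim (ℕ.<-irrefl refl (ℕ.≤-<-trans (ℕ.m≤m*n T ℤ.∣ r ∣) (subst (_< T) (ℤ.∣i*j∣≡∣i∣*∣j∣ (+ T) r) lt)))
  ∣T*r∣<T⇒r≡0 r@(-[1+ _ ]) lt = ⊥-elim (ℕ.<-irrefl refl (ℕ.≤-<-trans (ℕ.m≤m*n T ℤ.∣ r ∣) (subst (_< T) (ℤ.∣i*j∣≡∣i∣*∣j∣ (+ T) r) lt)))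

  -- If the residues differ, that of `c′` is a neighbour in the test at `c`, and it would be marked
  -- and unmarked at once. If they agree, the cells differ by a multiple of `T` that is too short to
  -- be nonzero.
  passing-near-equal : ∀ {μ} c c′ → suc (3 * n) < T → Passes μ (testAt c) → Passes μ (testAt c′) →
    Short (difference c′ c) → ∀ j → c′ j ≡ c j
  passing-near-equal {μ} c c′ small (_ , clear) (on′ , _) short j with ≡-dec ℕ._≟_ (residue c′) (residue c)
  ... | no c′≢c = ⊥-elim (true≢false (trans (sym on′) (All.lookup clear (∈-filter⁺ (other? c)
    (subst (_∈ map (λ z → residue (c ⊕ z)) shorts) (residue-cong (⊕-difference c c′)) (∈-map⁺ (λ z → residue (c ⊕ z)) (∈-shorts {difference c′ c} short))) c′≢c))))
    where
    true≢false : true ≢ false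
    true≢false ()
  ... | yes c′≡c with residue-≡⇒shift {c′} {c} c′≡c j
  ...   | r , eq = trans eq (trans (cong (λ r → c j ℤ.+ + T ℤ.* r) (∣T*r∣<T⇒r≡0 r (begin-strict
    ℤ.∣ + T ℤ.* r ∣                     ≡⟨ cong ℤ.∣_∣ (cancel (c j) (+ T ℤ.* r)) ⟨
    ℤ.∣ c j ℤ.+ + T ℤ.* r ℤ.- c j ∣     ≡⟨ cong (λ x → ℤ.∣ x ℤ.- c j ∣) eq ⟨
    ℤ.∣ c′ j ℤ.- c j ∣                  ≡⟨ cong ℤ.∣_∣ (lookup∘tabulate (λ j → c′ j ℤ.- c j) j) ⟨
    ℤ.∣ lookup (difference c′ c) j ∣    ≤⟨ ∣z∣≤1+excess² (difference c′ c) j ⟩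
    suc (excess² (difference c′ c))     ≤⟨ s≤s short ⟩
    suc (3 * n)                         <⟨ small ⟩
    T                                   ∎)))
    (trans (cong (λ x → c j ℤ.+ x) (ℤ.*-zeroʳ (+ T))) (ℤ.+-identityʳ (c j))))
    where
    open ℕ.≤-Reasoning
    cancel : ∀ a t → a ℤ.+ t ℤ.- a ≡ t
    cancel = ℤ-Solver.solve-∀

-- Rational approximations of real points

-- Statements about reals are used through the rational terms: finitely many eventual estimates are
-- intersected and then evaluated at one common index.
Ev : (ℕ → Set) → Set
Ev P = ∃ λ N → ∀ K → N ≤ K → P K

Ev-map : ∀ {P Q : ℕ → Set} → (∀ {K} → P K → Q K) → Ev P → Ev Q
Ev-map f (N , p) = N , λ K le → f (p K le)

infixr 3 _∩_
_∩_ : ∀ {P Q : ℕ → Set} → Ev P → Ev Q → Ev (λ K → P K × Q K)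
(M , p) ∩ (N , q) = M ℕ.⊔ N , λ K le →
  p K (ℕ.m⊔n≤o⇒m≤o M N le) , q K (ℕ.m⊔n≤o⇒n≤o M N le)

Ev-∀ : ∀ {n} {P : Fin n → ℕ → Set} → (∀ j → Ev (P j)) → Ev (λ K → ∀ j → P j K)
Ev-∀ {zero}  ev = 0 , λ _ _ ()
Ev-∀ {suc n} ev with ev zero ∩ Ev-∀ (λ j → ev (suc j))
... | N , p = N , λ K le → λ where
  zero    → proj₁ (p K le)
  (suc j) → proj₂ (p K le) j

Ev-instance : ∀ {P : ℕ → Set} → Ev P → ∃ P
Ev-instance (N , p) = N , p N ℕ.≤-refl

-- Finite sums and squared distances of rational approximations

∑ℚ : ∀ {n} → Vector ℚ n → ℚ
∑ℚ = foldr ℚ._+_ 0ℚ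

seq-∑ : ∀ {n} (v : Vector ℝ n) K → seq (∑ v) K ≡ ∑ℚ (λ j → seq (v j) K)
seq-∑ {zero}  v K = refl
seq-∑ {suc n} v K = cong (seq (v zero) K ℚ.+_) (seq-∑ (λ j → v (suc j)) K)

∑-mono : ∀ {n} {u v : Vector ℚ n} → (∀ j → u j ℚ.≤ v j) → ∑ℚ u ℚ.≤ ∑ℚ v
∑-mono {zero}  le = ℚ.≤-refl
∑-mono {suc n} le = ℚ.+-mono-≤ (le zero) (∑-mono (λ j → le (suc j)))

∑-cong : ∀ {n} {u v : Vector ℚ n} → (∀ j → u j ≡ v j) → ∑ℚ u ≡ ∑ℚ v
∑-cong {zero}  eq = refl
∑-cong {suc n} eq = cong₂ ℚ._+_ (eq zero) (∑-cong (λ j → eq (suc j)))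

∑-+ : ∀ {n} (u v : Vector ℚ n) → ∑ℚ (λ j → u j ℚ.+ v j) ≡ ∑ℚ u ℚ.+ ∑ℚ v
∑-+ {zero}  u v = refl
∑-+ {suc n} u v = trans (cong (u zero ℚ.+ v zero ℚ.+_) (∑-+ (λ j → u (suc j)) (λ j → v (suc j))))
  (swap (u zero) (v zero) _ _)
  where
  swap : ∀ a b c d → a ℚ.+ b ℚ.+ (c ℚ.+ d) ≡ a ℚ.+ c ℚ.+ (b ℚ.+ d)
  swap = solve-∀ ℚ-ring

∑-* : ∀ {n} c (u : Vector ℚ n) → ∑ℚ (λ j → c ℚ.* u j) ≡ c ℚ.* ∑ℚ u
∑-* {zero}  c u = sym (ℚ.*-zeroʳ c)
∑-* {suc n} c u = trans (cong (c ℚ.* u zero ℚ.+_) (∑-* c (λ j → u (suc j)))) (sym (ℚ.*-distribˡ-+ c (u zero) _))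

∑-const : ∀ n c → ∑ℚ {n} (λ _ → c) ≡ ι (+ n) ℚ.* c
∑-const zero    c = sym (ℚ.*-zeroˡ c)
∑-const (suc n) c = trans (cong₂ ℚ._+_ (sym (ℚ.*-identityˡ c)) (∑-const n c))
  (trans (sym (ℚ.*-distribʳ-+ c 1ℚ (ι (+ n)))) (cong (ℚ._* c) (sym (ι-+ (+ 1) (+ n)))))

∑-nonNeg : ∀ {n} {u : Vector ℚ n} → (∀ j → 0ℚ ℚ.≤ u j) → 0ℚ ℚ.≤ ∑ℚ u
∑-nonNeg {zero}  0≤u = ℚ.≤-refl
∑-nonNeg {suc n} 0≤u = 0≤-+ (0≤u zero) (∑-nonNeg (λ j → 0≤u (suc j)))

term≤∑ : ∀ {n} {u : Vector ℚ n} → (∀ j → 0ℚ ℚ.≤ u j) → ∀ j → u j ℚ.≤ ∑ℚ u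
term≤∑ {suc n} {u} 0≤u zero    = subst (ℚ._≤ ∑ℚ u) (ℚ.+-identityʳ (u zero))
  (ℚ.+-monoʳ-≤ (u zero) (∑-nonNeg (λ j → 0≤u (suc j))))
term≤∑ {suc n} {u} 0≤u (suc j) = ℚ.≤-trans (term≤∑ (λ j → 0≤u (suc j)) j)
  (subst (ℚ._≤ ∑ℚ u) (ℚ.+-identityˡ (∑ℚ λ j → u (suc j))) (ℚ.+-monoˡ-≤ (∑ℚ λ j → u (suc j)) (0≤u zero)))

neg-involutive : ∀ p → ℚ.- (ℚ.- p) ≡ p
neg-involutive = solve-∀ ℚ-ring

-- The bounds -s ≤ e ≤ s, which combine linearly, instead of ∣ e ∣ ≤ s.
Within : ℚ → ℚ → Set
Within s e = ℚ.- s ℚ.≤ e × e ℚ.≤ s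

∣∣<⇒Within : ∀ {s} e → ∣ e ∣ ℚ.< s → Within s e
∣∣<⇒Within {s} e lt = subst (ℚ.- s ℚ.≤_) (neg-involutive e) (ℚ.neg-antimono-≤ (ℚ.≤-trans -e≤ (ℚ.<⇒≤ lt))) ,
  ℚ.≤-trans e≤ (ℚ.<⇒≤ lt)
  where
  p≤∣p∣ : ∀ p → p ℚ.≤ ∣ p ∣
  p≤∣p∣ p with ℚ.≤-total 0ℚ p
  ... | inj₁ 0≤p = ℚ.≤-reflexive (sym (ℚ.0≤p⇒∣p∣≡p 0≤p))
  ... | inj₂ p≤0 = ℚ.≤-trans p≤0 (ℚ.0≤∣p∣ p)
  e≤ : e ℚ.≤ ∣ e ∣
  e≤ = p≤∣p∣ e
  -e≤ : ℚ.- e ℚ.≤ ∣ e ∣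
  -e≤ = subst (ℚ.- e ℚ.≤_) (ℚ.∣-p∣≡∣p∣ e) (p≤∣p∣ (ℚ.- e))

Within⇒² : ∀ {s e} → Within s e → e ℚ.* e ℚ.≤ s ℚ.* s
Within⇒² {s} {e} (lo , hi) = ≤-cert _ (factor s e) (0≤-* (0≤-diff lo) (0≤-diff hi))
  where
  factor : ∀ s e → s ℚ.* s ℚ.- e ℚ.* e ≡ (e ℚ.- ℚ.- s) ℚ.* (s ℚ.- e)
  factor = solve-∀ ℚ-ring

²-mono-≤ : ∀ {s e} → 0ℚ ℚ.≤ s → s ℚ.≤ e → s ℚ.* s ℚ.≤ e ℚ.* e
²-mono-≤ {s} {e} 0≤s s≤e = *-mono-≤′ 0≤s (ℚ.≤-trans 0≤s s≤e) s≤e s≤e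

²-cancel-≤ : ∀ {s e} → 0ℚ ℚ.≤ s → e ℚ.* e ℚ.≤ s ℚ.* s → e ℚ.≤ s
²-cancel-≤ {s} {e} 0≤s e²≤s² = ℚ.≮⇒≥ λ s<e → ℚ.<-irrefl refl (ℚ.≤-<-trans e²≤s² (ℚ.≤-<-trans
  (ℚ.*-monoˡ-≤-nonNeg s {{ℚ.nonNegative 0≤s}} (ℚ.<⇒≤ s<e))
  (ℚ.*-monoˡ-<-pos e {{ℚ.positive (ℚ.≤-<-trans 0≤s s<e)}} s<e)))

²⇒Within : ∀ {s e} → 0ℚ ℚ.≤ s → e ℚ.* e ℚ.≤ s ℚ.* s → Within s e
²⇒Within {s} {e} 0≤s e²≤s² =
  subst (ℚ.- s ℚ.≤_) (neg-involutive e)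
    (ℚ.neg-antimono-≤ (²-cancel-≤ 0≤s (subst (ℚ._≤ s ℚ.* s) (neg² e) e²≤s²))) ,
  ²-cancel-≤ 0≤s e²≤s²
  where
  neg² : ∀ e → e ℚ.* e ≡ (ℚ.- e) ℚ.* (ℚ.- e)
  neg² = solve-∀ ℚ-ring

sqdist : ∀ {n} → Point n → Point n → ℕ → ℚ
sqdist x y K = ∑ℚ λ j → (seq (x j) K ℚ.- seq (y j) K) ℚ.* (seq (x j) K ℚ.- seq (y j) K)

Dist⇒sqdist : ∀ {n} {x y : Point n} {d} → Dist x y (fromℕ d) → ∀ {ε} → 0ℚ ℚ.< ε →
  Ev λ K → Within ε (ι (+ d) ℚ.* ι (+ d) ℚ.- sqdist x y K)
Dist⇒sqdist {x = x} {y} {d} (_ , d²≈) {ε} 0<ε = Ev-map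
  (λ {K} lt → ∣∣<⇒Within (ι (+ d) ℚ.* ι (+ d) ℚ.- sqdist x y K) (subst (λ e → ∣ e ∣ ℚ.< ε) (slice K) lt))
  (d²≈ ε 0<ε)
  where
  slice : ∀ K → seq (fromℕ d *ℝ fromℕ d) K ℚ.- seq (∑ λ j → (x j -ℝ y j) *ℝ (x j -ℝ y j)) K ≡
    ι (+ d) ℚ.* ι (+ d) ℚ.- sqdist x y K
  slice K = cong₂ ℚ._-_ (cong₂ ℚ._*_ (/1≡ι (+ d)) (/1≡ι (+ d))) (seq-∑ (λ j → (x j -ℝ y j) *ℝ (x j -ℝ y j)) K)

≡⇒≈ : ∀ {x y} → (∀ K → seq x K ≡ seq y K) → x ≈ y
≡⇒≈ {x} {y} eq ε 0<ε = 0 , λ K _ → subst (λ q → ∣ q ℚ.- seq y K ∣ ℚ.< ε) (sym (eq K))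
  (subst (ℚ._< ε) (sym (abs-self-diff (seq y K))) 0<ε)

ℓ-Dist : ∀ {m} (i j : Fin m) d → (ι (+ toℕ i) ℚ.- ι (+ toℕ j)) ℚ.* (ι (+ toℕ i) ℚ.- ι (+ toℕ j)) ≡ ι (+ d) ℚ.* ι (+ d) →
  Dist (ℓ m i) (ℓ m j) (fromℕ d)
ℓ-Dist {m} i j d eq =
  (λ ε 0<ε → 0 , λ K _ → subst (ℚ._≤ + d / 1 ℚ.+ ε) (ℚ.+-identityʳ 0ℚ)
    (ℚ.+-mono-≤ (subst (0ℚ ℚ.≤_) (sym (/1≡ι (+ d))) (0≤ι d)) (ℚ.<⇒≤ 0<ε))) ,
  ≡⇒≈ {fromℕ d *ℝ fromℕ d} {∑ (λ l → (ℓ m i l -ℝ ℓ m j l) *ℝ (ℓ m i l -ℝ ℓ m j l))} λ K → begin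
    (+ d / 1) ℚ.* (+ d / 1)
      ≡⟨ cong₂ ℚ._*_ (/1≡ι (+ d)) (/1≡ι (+ d)) ⟩
    ι (+ d) ℚ.* ι (+ d)
      ≡⟨ eq ⟨
    (ι (+ toℕ i) ℚ.- ι (+ toℕ j)) ℚ.* (ι (+ toℕ i) ℚ.- ι (+ toℕ j))
      ≡⟨ cong₂ (λ a b → (a ℚ.- b) ℚ.* (a ℚ.- b)) (/1≡ι (+ toℕ i)) (/1≡ι (+ toℕ j)) ⟨
    ((+ toℕ i / 1) ℚ.- (+ toℕ j / 1)) ℚ.* ((+ toℕ i / 1) ℚ.- (+ toℕ j / 1))
      ≡⟨ ℚ.+-identityʳ _ ⟨
    ((+ toℕ i / 1) ℚ.- (+ toℕ j / 1)) ℚ.* ((+ toℕ i / 1) ℚ.- (+ toℕ j / 1)) ℚ.+ 0ℚ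
      ∎
  where open ≡-Reasoning

-- `IsCopy` transfers `Dist` at a named distance, which must be nonnegative; this names |a - b| as a
-- natural number whichever index is larger.
gap : ∀ a b → ∃ λ d → (ι (+ a) ℚ.- ι (+ b)) ℚ.* (ι (+ a) ℚ.- ι (+ b)) ≡ ι (+ d) ℚ.* ι (+ d)
gap a b with ℕ.≤-total a b
... | inj₁ a≤b = b ∸ a , trans
  (cong (λ x → (ι (+ a) ℚ.- x) ℚ.* (ι (+ a) ℚ.- x)) (trans (cong (λ x → ι (+ x)) (sym (ℕ.m+[n∸m]≡n a≤b))) (ι-+ (+ a) (+ (b ∸ a)))))
  (cancel (ι (+ a)) (ι (+ (b ∸ a))))
  where
  cancel : ∀ x d → (x ℚ.- (x ℚ.+ d)) ℚ.* (x ℚ.- (x ℚ.+ d)) ≡ d ℚ.* d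
  cancel = solve-∀ ℚ-ring
... | inj₂ b≤a = a ∸ b , trans
  (cong (λ x → (x ℚ.- ι (+ b)) ℚ.* (x ℚ.- ι (+ b))) (trans (cong (λ x → ι (+ x)) (sym (ℕ.m+[n∸m]≡n b≤a))) (ι-+ (+ b) (+ (a ∸ b)))))
  (cancel (ι (+ b)) (ι (+ (a ∸ b))))
  where
  cancel : ∀ x d → (x ℚ.+ d ℚ.- x) ℚ.* (x ℚ.+ d ℚ.- x) ≡ d ℚ.* d
  cancel = solve-∀ ℚ-ring

copy-sqdist : ∀ {n m} {f : Configuration n m} → IsCopy (ℓ m) f → ∀ i j {ε} → 0ℚ ℚ.< ε →
  Ev λ K → Within ε ((ι (+ toℕ i) ℚ.- ι (+ toℕ j)) ℚ.* (ι (+ toℕ i) ℚ.- ι (+ toℕ j)) ℚ.- sqdist (f i) (f j) K)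
copy-sqdist {f = f} copy i j {ε} 0<ε =
  let (d , eq) = gap (toℕ i) (toℕ j) in
  Ev-map (λ {K} → subst (λ x → Within ε (x ℚ.- sqdist (f i) (f j) K)) (sym eq))
    (Dist⇒sqdist {x = f i} {f j} {d} (Equivalence.to (copy i j (fromℕ d)) (ℓ-Dist i j d eq)) 0<ε)

-- If x = y + t (w - y), the three squared distances are t², 1 and (t - 1)²; Stewart's identity
-- recovers x from them.
collinear : ∀ {n} (x y w : Vector ℚ n) t δ ε → 0ℚ ℚ.≤ t → 0ℚ ℚ.≤ ε →
  (1ℚ ℚ.+ ι (+ 3) ℚ.* t ℚ.+ t ℚ.* t) ℚ.* δ ≡ ε ℚ.* ε →
  Within δ (t ℚ.* t ℚ.- ∑ℚ (λ j → (x j ℚ.- y j) ℚ.* (x j ℚ.- y j))) →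
  Within δ (1ℚ ℚ.- ∑ℚ (λ j → (w j ℚ.- y j) ℚ.* (w j ℚ.- y j))) →
  Within δ ((t ℚ.- 1ℚ) ℚ.* (t ℚ.- 1ℚ) ℚ.- ∑ℚ (λ j → (x j ℚ.- w j) ℚ.* (x j ℚ.- w j))) →
  ∀ j → Within ε (x j ℚ.- (y j ℚ.+ t ℚ.* (w j ℚ.- y j)))
collinear x y w t δ ε 0≤t 0≤ε Cδ≡ε² (xy₁ , xy₂) (wy₁ , wy₂) (xw₁ , xw₂) j =
  ²⇒Within 0≤ε (begin
    e j ℚ.* e j
      ≤⟨ term≤∑ {u = λ j → e j ℚ.* e j} (λ j → 0≤-² (e j)) j ⟩
    ∑ℚ (λ j → e j ℚ.* e j)
      ≡⟨ ∑-cong (λ j → stewart (x j) (y j) (w j) t) ⟩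
    ∑ℚ (λ j → (1ℚ ℚ.- t) ℚ.* sq (x j) (y j) ℚ.+ (t ℚ.* t ℚ.- t) ℚ.* sq (w j) (y j) ℚ.+ t ℚ.* sq (x j) (w j))
      ≡⟨ ∑-+ (λ j → (1ℚ ℚ.- t) ℚ.* sq (x j) (y j) ℚ.+ (t ℚ.* t ℚ.- t) ℚ.* sq (w j) (y j)) (λ j → t ℚ.* sq (x j) (w j)) ⟩
    ∑ℚ (λ j → (1ℚ ℚ.- t) ℚ.* sq (x j) (y j) ℚ.+ (t ℚ.* t ℚ.- t) ℚ.* sq (w j) (y j)) ℚ.+ ∑ℚ (λ j → t ℚ.* sq (x j) (w j))
      ≡⟨ cong₂ ℚ._+_ (∑-+ (λ j → (1ℚ ℚ.- t) ℚ.* sq (x j) (y j)) (λ j → (t ℚ.* t ℚ.- t) ℚ.* sq (w j) (y j))) (∑-* t (λ j → sq (x j) (w j))) ⟩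
    ∑ℚ (λ j → (1ℚ ℚ.- t) ℚ.* sq (x j) (y j)) ℚ.+ ∑ℚ (λ j → (t ℚ.* t ℚ.- t) ℚ.* sq (w j) (y j)) ℚ.+ t ℚ.* C
      ≡⟨ cong₂ (λ a b → a ℚ.+ b ℚ.+ t ℚ.* C) (∑-* (1ℚ ℚ.- t) (λ j → sq (x j) (y j))) (∑-* (t ℚ.* t ℚ.- t) (λ j → sq (w j) (y j))) ⟩
    (1ℚ ℚ.- t) ℚ.* A ℚ.+ (t ℚ.* t ℚ.- t) ℚ.* B ℚ.+ t ℚ.* C
      -- For exact distances the three terms cancel. The errors in A, B and C enter with total
      -- weights 1 + t, t² + t and t, where 1 - t and t² - t are split because their signs depend on
      -- t; this yields the factor 1 + 3 t + t².
      ≤⟨ ≤-cert _ (certificate t δ A B C)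
           (0≤-+ (0≤-+ (0≤-+ (0≤-+ (0≤-diff xy₁) (0≤-* 0≤t (0≤-diff xy₂)))
             (0≤-* (0≤-* 0≤t 0≤t) (0≤-diff wy₁))) (0≤-* 0≤t (0≤-diff wy₂))) (0≤-* 0≤t (0≤-diff xw₁))) ⟩
    (1ℚ ℚ.+ ι (+ 3) ℚ.* t ℚ.+ t ℚ.* t) ℚ.* δ
      ≡⟨ Cδ≡ε² ⟩
    ε ℚ.* ε
      ∎)
  where
  open ℚ.≤-Reasoning
  sq : ℚ → ℚ → ℚ
  sq a b = (a ℚ.- b) ℚ.* (a ℚ.- b)
  e : Vector ℚ _
  e j = x j ℚ.- (y j ℚ.+ t ℚ.* (w j ℚ.- y j))
  A B C : ℚ
  A = ∑ℚ λ j → sq (x j) (y j)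
  B = ∑ℚ λ j → sq (w j) (y j)
  C = ∑ℚ λ j → sq (x j) (w j)
  stewart : ∀ x y w t →
    (x ℚ.- (y ℚ.+ t ℚ.* (w ℚ.- y))) ℚ.* (x ℚ.- (y ℚ.+ t ℚ.* (w ℚ.- y))) ≡
    (1ℚ ℚ.- t) ℚ.* ((x ℚ.- y) ℚ.* (x ℚ.- y)) ℚ.+ (t ℚ.* t ℚ.- t) ℚ.* ((w ℚ.- y) ℚ.* (w ℚ.- y)) ℚ.+ t ℚ.* ((x ℚ.- w) ℚ.* (x ℚ.- w))
  stewart = solve-∀ ℚ-ring
  certificate : ∀ t δ A B C →
    (1ℚ ℚ.+ ι (+ 3) ℚ.* t ℚ.+ t ℚ.* t) ℚ.* δ ℚ.- ((1ℚ ℚ.- t) ℚ.* A ℚ.+ (t ℚ.* t ℚ.- t) ℚ.* B ℚ.+ t ℚ.* C) ≡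
    (t ℚ.* t ℚ.- A ℚ.- ℚ.- δ) ℚ.+ t ℚ.* (δ ℚ.- (t ℚ.* t ℚ.- A)) ℚ.+ t ℚ.* t ℚ.* (1ℚ ℚ.- B ℚ.- ℚ.- δ) ℚ.+
    t ℚ.* (δ ℚ.- (1ℚ ℚ.- B)) ℚ.+ t ℚ.* ((t ℚ.- 1ℚ) ℚ.* (t ℚ.- 1ℚ) ℚ.- C ℚ.- ℚ.- δ)
  certificate = solve-∀ ℚ-ring

-- Rounding to integers and differences of cell indices

floorℚ : ∀ q → ∃ λ z → ι z ℚ.≤ q × q ℚ.≤ ι z ℚ.+ 1ℚ
floorℚ q@(ℚ.mkℚ num d-1 _) = z , lower , subst (q ℚ.≤_) (ι-+ z (+ 1)) upper
  where
  z : ℤ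
  z = num ℤ./ℕ suc d-1
  lower : ι z ℚ.≤ q
  lower = ℚ.*≤* (subst (z ℤ.* + suc d-1 ℤ.≤_) (sym (ℤ.*-identityʳ num)) (ℤ.[n/ℕd]*d≤n num (suc d-1)))
  upper : q ℚ.≤ ι (z ℤ.+ + 1)
  upper = ℚ.*≤* (subst₂ ℤ._≤_ (sym (ℤ.*-identityʳ num)) (cong (ℤ._* + suc d-1) (ℤ.+-comm (+ 1) z))
    (ℤ.<⇒≤ (ℤ.n<s[n/ℕd]*d num (suc d-1))))

-- The terms may cross an integer infinitely often, so a window of length one can fail forever.
-- Rounding down from half below a late term makes a window of length two permanent.
approximate : ∀ u → IsCauchy u → ∃ λ S → Ev λ K → ι S ℚ.≤ u K × u K ℚ.≤ ι S ℚ.+ ι (+ 2)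
approximate u cauchy with cauchy ½ (ℚ.positive⁻¹ ½)
... | N , p with floorℚ (u N ℚ.- ½)
...   | S , lo , hi = S , N , λ K le →
  let (lo′ , hi′) = ∣∣<⇒Within (u K ℚ.- u N) (p K N le ℕ.≤-refl) in
  ≤-cert _ (lower (u K) (u N) (ι S)) (0≤-+ (0≤-diff lo) (0≤-diff lo′)) ,
  ≤-cert _ (upper (u K) (u N) (ι S)) (0≤-+ (0≤-diff hi) (0≤-diff hi′))
  where
  lower : ∀ a b s → a ℚ.- s ≡ (b ℚ.- ½ ℚ.- s) ℚ.+ (a ℚ.- b ℚ.- ℚ.- ½)
  lower = solve-∀ ℚ-ring
  upper : ∀ a b s → s ℚ.+ ι (+ 2) ℚ.- a ≡ (s ℚ.+ 1ℚ ℚ.- (b ℚ.- ½)) ℚ.+ (½ ℚ.- (a ℚ.- b))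
  upper = solve-∀ ℚ-ring

-- The difference of two points in cubes of side 17 whose corners differ by 16 z; the bound 18 is 17
-- plus a slack of one half for each point.
Near : ℚ → ℤ → Set
Near e z = Within (ι (+ 18)) (e ℚ.- ι (+ 16) ℚ.* ι z)

Near-neg : ∀ {e z} → Near e z → Near (ℚ.- e) (ℤ.- z)
Near-neg {e} {z} (lo , hi) =
  ≤-cert _ (trans (cong (λ x → ℚ.- e ℚ.- ι (+ 16) ℚ.* x ℚ.- ℚ.- ι (+ 18)) (ι-neg z)) (flip₁ e (ι z))) (0≤-diff hi) ,
  ≤-cert _ (trans (cong (λ x → ι (+ 18) ℚ.- (ℚ.- e ℚ.- ι (+ 16) ℚ.* x)) (ι-neg z)) (flip₂ e (ι z))) (0≤-diff lo)
  where
  flip₁ : ∀ e x → ℚ.- e ℚ.- ι (+ 16) ℚ.* (ℚ.- x) ℚ.- ℚ.- ι (+ 18) ≡ ι (+ 18) ℚ.- (e ℚ.- ι (+ 16) ℚ.* x)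
  flip₁ = solve-∀ ℚ-ring
  flip₂ : ∀ e x → ι (+ 18) ℚ.- (ℚ.- e ℚ.- ι (+ 16) ℚ.* (ℚ.- x)) ≡ e ℚ.- ι (+ 16) ℚ.* x ℚ.- ℚ.- ι (+ 18)
  flip₂ = solve-∀ ℚ-ring

-- For x ≥ 2 one has 16 x - 18 ≥ 14 (x - 1), and 196 = 14².
Near⇒excess⁺ : ∀ {e} x → Near e (+ x) → ι (+ 196) ℚ.* ι (+ ((x ∸ 1) * (x ∸ 1))) ℚ.≤ e ℚ.* e
Near⇒excess⁺ {e} 0     _ = 0≤-² e
Near⇒excess⁺ {e} 1     _ = 0≤-² e
Near⇒excess⁺ {e} (suc (suc x)) (lo , _) = begin
  ι (+ 196) ℚ.* ι (+ (suc x * suc x))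
    ≡⟨ cong (ι (+ 196) ℚ.*_) (trans (cong ι (ℤ.pos-* (suc x) (suc x))) (ι-* (+ suc x) (+ suc x))) ⟩
  ι (+ 196) ℚ.* (ι (+ suc x) ℚ.* ι (+ suc x))
    ≡⟨ root (ι (+ suc x)) ⟩
  (ι (+ 14) ℚ.* ι (+ suc x)) ℚ.* (ι (+ 14) ℚ.* ι (+ suc x))
    ≤⟨ ²-mono-≤ (0≤-* (0≤ι 14) (0≤ι (suc x))) 14x≤e ⟩
  e ℚ.* e
    ∎
  where
  open ℚ.≤-Reasoning
  root : ∀ x → ι (+ 196) ℚ.* (x ℚ.* x) ≡ (ι (+ 14) ℚ.* x) ℚ.* (ι (+ 14) ℚ.* x)
  root = solve-∀ ℚ-ring
  split : ∀ e x → e ℚ.- ι (+ 14) ℚ.* (1ℚ ℚ.+ x) ≡ (e ℚ.- ι (+ 16) ℚ.* (ι (+ 2) ℚ.+ x) ℚ.- ℚ.- ι (+ 18)) ℚ.+ ι (+ 2) ℚ.* x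
  split = solve-∀ ℚ-ring
  14x≤e : ι (+ 14) ℚ.* ι (+ suc x) ℚ.≤ e
  14x≤e = ≤-cert _
    (trans (cong (λ y → e ℚ.- ι (+ 14) ℚ.* y) (ι-+ (+ 1) (+ x)))
      (trans (split e (ι (+ x))) (cong (λ y → (e ℚ.- ι (+ 16) ℚ.* y ℚ.- ℚ.- ι (+ 18)) ℚ.+ ι (+ 2) ℚ.* ι (+ x)) (sym (ι-+ (+ 2) (+ x))))))
    (0≤-+ (0≤-diff lo) (0≤-* (0≤ι 2) (0≤ι x)))

Near⇒excess : ∀ {e} z → Near e z → ι (+ 196) ℚ.* ι (+ (excess z * excess z)) ℚ.≤ e ℚ.* e
Near⇒excess {e} (+ x) near = Near⇒excess⁺ {e} x near
Near⇒excess {e} -[1+ x ] near = subst (ι (+ 196) ℚ.* ι (+ (x * x)) ℚ.≤_) (neg² e)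
  (Near⇒excess⁺ {ℚ.- e} (suc x) (Near-neg {e} { -[1+ x ]} near))
  where
  neg² : ∀ e → (ℚ.- e) ℚ.* (ℚ.- e) ≡ e ℚ.* e
  neg² = solve-∀ ℚ-ring

Within-∣∣ : ∀ {w} z → ℤ.∣ z ∣ ≤ w → Within (ι (+ w)) (ι z)
Within-∣∣ {w} z le =
  subst (ℚ._≤ ι z) (ι-neg (+ w)) (ι-mono-≤ (lower z le)) , ι-mono-≤ (upper z le)
  where
  upper : ∀ z → ℤ.∣ z ∣ ≤ w → z ℤ.≤ + w
  upper (+ x)     le = ℤ.+≤+ le
  upper -[1+ x ] le = ℤ.-≤+
  lower : ∀ z → ℤ.∣ z ∣ ≤ w → ℤ.- + w ℤ.≤ z
  lower z le = subst (ℤ.- + w ℤ.≤_) (ℤ.neg-involutive z) (ℤ.neg-mono-≤ (upper (ℤ.- z) (subst (_≤ w) (sym (ℤ.∣-i∣≡∣i∣ z)) le)))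

Near⇒Within : ∀ {e w} z → ℤ.∣ z ∣ ≤ w → Near e z → Within (ι (+ 18) ℚ.+ ι (+ 16) ℚ.* ι (+ w)) e
Near⇒Within {e} {w} z le (lo , hi) with Within-∣∣ z le
... | lo′ , hi′ =
  ≤-cert _ (low e (ι z) (ι (+ w))) (0≤-+ (0≤-diff lo) (0≤-* (0≤ι 16) (0≤-diff lo′))) ,
  ≤-cert _ (high e (ι z) (ι (+ w))) (0≤-+ (0≤-diff hi) (0≤-* (0≤ι 16) (0≤-diff hi′)))
  where
  low : ∀ e z w → e ℚ.- ℚ.- (ι (+ 18) ℚ.+ ι (+ 16) ℚ.* w) ≡ (e ℚ.- ι (+ 16) ℚ.* z ℚ.- ℚ.- ι (+ 18)) ℚ.+ ι (+ 16) ℚ.* (z ℚ.- ℚ.- w)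
  low = solve-∀ ℚ-ring
  high : ∀ e z w → ι (+ 18) ℚ.+ ι (+ 16) ℚ.* w ℚ.- e ≡ (ι (+ 18) ℚ.- (e ℚ.- ι (+ 16) ℚ.* z)) ℚ.+ ι (+ 16) ℚ.* (w ℚ.- z)
  high = solve-∀ ℚ-ring

∣∣≤ : ∀ {w} z → Within (ι (+ w)) (ι z) → ℤ.∣ z ∣ ≤ w
∣∣≤ (+ x)    (_ , hi) = ℤ.drop‿+≤+ (ι-cancel-≤ hi)
∣∣≤ {w} -[1+ x ] (lo , _) = ℤ.drop‿+≤+ (ι-cancel-≤ (begin
  ι (+ suc x)               ≡⟨ ι-neg -[1+ x ] ⟩
  ℚ.- ι -[1+ x ]            ≤⟨ ℚ.neg-antimono-≤ lo ⟩
  ℚ.- ℚ.- ι (+ w)           ≡⟨ neg-involutive (ι (+ w)) ⟩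
  ι (+ w)                   ∎))
  where open ℚ.≤-Reasoning

Near⇒∣∣ : ∀ {e s} z → Within (ι (+ s)) e → Near e z → 16 * ℤ.∣ z ∣ ≤ 18 + s
Near⇒∣∣ {e} {s} z (lo , hi) (lo′ , hi′) = subst (_≤ 18 + s) (ℤ.∣i*j∣≡∣i∣*∣j∣ (+ 16) z) (∣∣≤ (+ 16 ℤ.* z)
  (≤-cert _ (trans (cong₂ (λ x y → x ℚ.- ℚ.- y) (ι-* (+ 16) z) (ι-+ (+ 18) (+ s))) (low e (ι z) (ι (+ s)))) (0≤-+ (0≤-diff lo) (0≤-diff hi′)) ,
   ≤-cert _ (trans (cong₂ (λ x y → y ℚ.- x) (ι-* (+ 16) z) (ι-+ (+ 18) (+ s))) (high e (ι z) (ι (+ s)))) (0≤-+ (0≤-diff hi) (0≤-diff lo′))))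
  where
  low : ∀ e z s → ι (+ 16) ℚ.* z ℚ.- ℚ.- (ι (+ 18) ℚ.+ s) ≡ (e ℚ.- ℚ.- s) ℚ.+ (ι (+ 18) ℚ.- (e ℚ.- ι (+ 16) ℚ.* z))
  low = solve-∀ ℚ-ring
  high : ∀ e z s → ι (+ 18) ℚ.+ s ℚ.- ι (+ 16) ℚ.* z ≡ (s ℚ.- e) ℚ.+ (e ℚ.- ι (+ 16) ℚ.* z ℚ.- ℚ.- ι (+ 18))
  high = solve-∀ ℚ-ring

sum-of-three² : ∀ a b c → (a ℚ.+ b ℚ.+ c) ℚ.* (a ℚ.+ b ℚ.+ c) ℚ.≤ ι (+ 3) ℚ.* (a ℚ.* a ℚ.+ b ℚ.* b ℚ.+ c ℚ.* c)
sum-of-three² a b c = ≤-cert _ (cauchy-schwarz a b c) (0≤-+ (0≤-+ (0≤-² (a ℚ.- b)) (0≤-² (b ℚ.- c))) (0≤-² (a ℚ.- c)))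
  where
  cauchy-schwarz : ∀ a b c → ι (+ 3) ℚ.* (a ℚ.* a ℚ.+ b ℚ.* b ℚ.+ c ℚ.* c) ℚ.- (a ℚ.+ b ℚ.+ c) ℚ.* (a ℚ.+ b ℚ.+ c) ≡
    (a ℚ.- b) ℚ.* (a ℚ.- b) ℚ.+ (b ℚ.- c) ℚ.* (b ℚ.- c) ℚ.+ (a ℚ.- c) ℚ.* (a ℚ.- c)
  cauchy-schwarz = solve-∀ ℚ-ring

-- Cells in Euclidean space

∑-ι : ∀ {n} (v : Vec ℤ n) → ∑ℚ (λ j → ι (+ (excess (lookup v j) * excess (lookup v j)))) ≡ ι (+ excess² v)
∑-ι []      = refl
∑-ι (z ∷ v) = trans (cong (ι (+ (excess z * excess z)) ℚ.+_) (∑-ι v)) (sym (ι-+ (+ (excess z * excess z)) (+ excess² v)))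

ι-ℕ* : ∀ a b → ι (+ (a * b)) ≡ ι (+ a) ℚ.* ι (+ b)
ι-ℕ* a b = trans (cong ι (ℤ.pos-* a b)) (ι-* (+ a) (+ b))

ι-ℕ-≤ : ∀ {a b} → a ≤ b → ι (+ a) ℚ.≤ ι (+ b)
ι-ℕ-≤ a≤b = ι-mono-≤ (ℤ.+≤+ a≤b)

-- `InCell` in one coordinate at the tolerance ε = 1 / (2 k), read in scaled coordinates.
HalfNear : ℚ → ℤ → Set
HalfNear a c = ι (+ 16) ℚ.* ι c ℚ.≤ a ℚ.+ ½ × a ℚ.- ½ ℚ.≤ ι (+ 16) ℚ.* ι c ℚ.+ ι (+ 17)

HalfNear⇒Near : ∀ a b c c′ → HalfNear a c → HalfNear b c′ → Near (a ℚ.- b) (c ℤ.- c′)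
HalfNear⇒Near a b c c′ (a₁ , a₂) (b₁ , b₂) =
  ≤-cert _ (trans (cong (λ x → a ℚ.- b ℚ.- ι (+ 16) ℚ.* x ℚ.- ℚ.- ι (+ 18)) ι-diff) (low a b (ι c) (ι c′))) (0≤-+ (0≤-diff a₁) (0≤-diff b₂)) ,
  ≤-cert _ (trans (cong (λ x → ι (+ 18) ℚ.- (a ℚ.- b ℚ.- ι (+ 16) ℚ.* x)) ι-diff) (high a b (ι c) (ι c′))) (0≤-+ (0≤-diff a₂) (0≤-diff b₁))
  where
  ι-diff : ι (c ℤ.- c′) ≡ ι c ℚ.- ι c′
  ι-diff = trans (ι-+ c (ℤ.- c′)) (cong (ι c ℚ.+_) (ι-neg c′))
  low : ∀ a b c d → a ℚ.- b ℚ.- ι (+ 16) ℚ.* (c ℚ.- d) ℚ.- ℚ.- ι (+ 18) ≡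
    (a ℚ.+ ½ ℚ.- ι (+ 16) ℚ.* c) ℚ.+ (ι (+ 16) ℚ.* d ℚ.+ ι (+ 17) ℚ.- (b ℚ.- ½))
  low = solve-∀ ℚ-ring
  high : ∀ a b c d → ι (+ 18) ℚ.- (a ℚ.- b ℚ.- ι (+ 16) ℚ.* (c ℚ.- d)) ≡
    (ι (+ 16) ℚ.* c ℚ.+ ι (+ 17) ℚ.- (a ℚ.- ½)) ℚ.+ (b ℚ.+ ½ ℚ.- ι (+ 16) ℚ.* d)
  high = solve-∀ ℚ-ring

module Geometry (n k : ℕ) {{n≢0 : ℕ.NonZero n}} (lo : 361 * n ≤ k * k) (hi : k * k ≤ 400 * n) where

  κ : ℚ
  κ = ι (+ k)

  0≤κ : 0ℚ ℚ.≤ κ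
  0≤κ = 0≤ι k

  0<κ : 0ℚ ℚ.< κ
  0<κ = ι-mono-< (ℤ.+<+ (0<k k (ℕ.≤-trans (ℕ.≤-trans (ℕ.>-nonZero⁻¹ n) (ℕ.m≤n*m n 361)) lo)))
    where
    0<k : ∀ k → 0 < k * k → 0 < k
    0<k (suc k) _ = s≤s z≤n

  instance
    ιn-pos : ℚ.Positive (ι (+ n))
    ιn-pos = ℚ.positive (ι-mono-< (ℤ.+<+ (ℕ.>-nonZero⁻¹ n)))

  κ-lo : ι (+ 361) ℚ.* ι (+ n) ℚ.≤ κ ℚ.* κ
  κ-lo = subst₂ ℚ._≤_ (ι-ℕ* 361 n) (ι-ℕ* k k) (ι-ℕ-≤ lo)

  κ-hi : κ ℚ.* κ ℚ.≤ ι (+ 400) ℚ.* ι (+ n)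
  κ-hi = subst₂ ℚ._≤_ (ι-ℕ* k k) (ι-ℕ* 400 n) (ι-ℕ-≤ hi)

  -- k x lies in the cube 16 c + [0, 17]ⁿ, expressed through the rational approximations of x.
  InCell : Point n → Cell n → Set
  InCell x c = ∀ j ε → 0ℚ ℚ.< ε → Ev λ K →
    ι (+ 16) ℚ.* ι (c j) ℚ.≤ κ ℚ.* (seq (x j) K ℚ.+ ε) ×
    κ ℚ.* (seq (x j) K ℚ.- ε) ℚ.≤ ι (+ 16) ℚ.* ι (c j) ℚ.+ ι (+ 17)

  InCell-resp : ∀ {x y} c → (∀ j → x j ≈ y j) → InCell x c → InCell y c
  InCell-resp {x} {y} c x≈y x∈c j ε 0<ε = Ev-map
    (λ {K} → λ ((l , h) , near) → move (seq (x j) K) (seq (y j) K) l h (∣∣<⇒Within (seq (x j) K ℚ.- seq (y j) K) near))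
    (x∈c j (½ ℚ.* ε) (half-pos 0<ε) ∩ x≈y j (½ ℚ.* ε) (half-pos 0<ε))
    where
    up : ∀ k a b e → k ℚ.* (b ℚ.+ e) ℚ.- k ℚ.* (a ℚ.+ ½ ℚ.* e) ≡ k ℚ.* (½ ℚ.* e ℚ.- (a ℚ.- b))
    up = solve-∀ ℚ-ring
    down : ∀ k a b e → k ℚ.* (a ℚ.- ½ ℚ.* e) ℚ.- k ℚ.* (b ℚ.- e) ≡ k ℚ.* (a ℚ.- b ℚ.- ℚ.- (½ ℚ.* e))
    down = solve-∀ ℚ-ring
    move : ∀ a b → ι (+ 16) ℚ.* ι (c j) ℚ.≤ κ ℚ.* (a ℚ.+ ½ ℚ.* ε) → κ ℚ.* (a ℚ.- ½ ℚ.* ε) ℚ.≤ ι (+ 16) ℚ.* ι (c j) ℚ.+ ι (+ 17) →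
      Within (½ ℚ.* ε) (a ℚ.- b) →
      ι (+ 16) ℚ.* ι (c j) ℚ.≤ κ ℚ.* (b ℚ.+ ε) × κ ℚ.* (b ℚ.- ε) ℚ.≤ ι (+ 16) ℚ.* ι (c j) ℚ.+ ι (+ 17)
    move a b l h (w₁ , w₂) =
      ℚ.≤-trans l (≤-cert _ (up κ a b ε) (0≤-* 0≤κ (0≤-diff w₂))) ,
      ℚ.≤-trans (≤-cert _ (down κ a b ε) (0≤-* 0≤κ (0≤-diff w₁))) h

  InCell⇒HalfNear : ∀ {x} c → InCell x c → Ev λ K → ∀ j → HalfNear (κ ℚ.* seq (x j) K) (c j)
  InCell⇒HalfNear {x} c x∈c = Ev-∀ {P = λ j K → HalfNear (κ ℚ.* seq (x j) K) (c j)} λ j →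
    Ev-map (λ {K} → λ (l , h) →
        subst (ι (+ 16) ℚ.* ι (c j) ℚ.≤_) (trans (ℚ.*-distribˡ-+ κ (seq (x j) K) ε) (cong (λ t → κ ℚ.* seq (x j) K ℚ.+ t) κε≡½)) l ,
        subst (ℚ._≤ ι (+ 16) ℚ.* ι (c j) ℚ.+ ι (+ 17)) (trans (distrib-minus κ (seq (x j) K) ε) (cong (λ t → κ ℚ.* seq (x j) K ℚ.- t) κε≡½)) h)
      (x∈c j ε 0<ε)
    where
    inverse : ∃ λ ε → 0ℚ ℚ.< ε × κ ℚ.* ε ≡ ½
    inverse = scaled κ ½ 0<κ (ℚ.positive⁻¹ ½)
    ε : ℚ
    ε = proj₁ inverse
    0<ε : 0ℚ ℚ.< ε
    0<ε = proj₁ (proj₂ inverse)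
    κε≡½ : κ ℚ.* ε ≡ ½
    κε≡½ = proj₂ (proj₂ inverse)
    distrib-minus : ∀ k a e → k ℚ.* (a ℚ.- e) ≡ k ℚ.* a ℚ.- k ℚ.* e
    distrib-minus = solve-∀ ℚ-ring

  scaled-diff : Point n → Point n → ℕ → Vector ℚ n
  scaled-diff x y K j = κ ℚ.* seq (x j) K ℚ.- κ ℚ.* seq (y j) K

  ∑-scaled-diff² : ∀ x y K → ∑ℚ (λ j → scaled-diff x y K j ℚ.* scaled-diff x y K j) ≡ κ ℚ.* κ ℚ.* sqdist x y K
  ∑-scaled-diff² x y K = trans (∑-cong (λ j → factor κ (seq (x j) K) (seq (y j) K)))
    (∑-* (κ ℚ.* κ) (λ j → (seq (x j) K ℚ.- seq (y j) K) ℚ.* (seq (x j) K ℚ.- seq (y j) K)))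
    where
    factor : ∀ k a b → (k ℚ.* a ℚ.- k ℚ.* b) ℚ.* (k ℚ.* a ℚ.- k ℚ.* b) ≡ k ℚ.* k ℚ.* ((a ℚ.- b) ℚ.* (a ℚ.- b))
    factor = solve-∀ ℚ-ring

  InCell⇒Near : ∀ {x y} c c′ → InCell x c → InCell y c′ →
    Ev λ K → ∀ j → Near (scaled-diff x y K j) (c j ℤ.- c′ j)
  InCell⇒Near {x} {y} c c′ x∈c y∈c′ = Ev-map
    (λ {K} → λ (hx , hy) j → HalfNear⇒Near (κ ℚ.* seq (x j) K) (κ ℚ.* seq (y j) K) (c j) (c′ j) (hx j) (hy j))
    (InCell⇒HalfNear {x} c x∈c ∩ InCell⇒HalfNear {y} c′ y∈c′)

  -- The error allowed in a squared distance of one. It must leave 400 (1 + ρ) ≤ 3 · 196 for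
  -- `unit⇒short` and 361 (1 - ρ) > 324 for `unit⇒different`.
  ρ : ℚ
  ρ = + 1 / 20

  module _ (e : Vector ℚ n) (c c′ : Cell n) (near : ∀ j → Near (e j) (c j ℤ.- c′ j)) (s : ℚ)
    (∑e² : ∑ℚ (λ j → e j ℚ.* e j) ≡ κ ℚ.* κ ℚ.* s) where

    open ℚ.≤-Reasoning

    -- The sum of the squares of `e` is at least 196 times the excess and at most 400 n · 21/20 =
    -- 420 n.
    unit⇒short : s ℚ.≤ 1ℚ ℚ.+ ρ → excess² (difference c c′) ≤ 3 * n
    unit⇒short s≤ = ℕ.*-cancelˡ-≤ 196 (ℕ.≤-trans (ℤ.drop‿+≤+ (ι-cancel-≤ (begin
      ι (+ (196 * excess² v))
        ≡⟨ ι-ℕ* 196 (excess² v) ⟩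
      ι (+ 196) ℚ.* ι (+ excess² v)
        ≡⟨ cong (ι (+ 196) ℚ.*_) (∑-ι v) ⟨
      ι (+ 196) ℚ.* ∑ℚ (λ j → ι (+ (excess (lookup v j) * excess (lookup v j))))
        ≡⟨ ∑-* (ι (+ 196)) (λ j → ι (+ (excess (lookup v j) * excess (lookup v j)))) ⟨
      ∑ℚ (λ j → ι (+ 196) ℚ.* ι (+ (excess (lookup v j) * excess (lookup v j))))
        ≤⟨ ∑-mono (λ j → Near⇒excess {e j} (lookup v j) (subst (Near (e j)) (sym (lookup∘tabulate (λ j → c j ℤ.- c′ j) j)) (near j))) ⟩
      ∑ℚ (λ j → e j ℚ.* e j)
        ≡⟨ ∑e² ⟩
      κ ℚ.* κ ℚ.* s
        ≤⟨ ℚ.*-monoˡ-≤-nonNeg (κ ℚ.* κ) {{ℚ.nonNegative (0≤-* 0≤κ 0≤κ)}} s≤ ⟩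
      κ ℚ.* κ ℚ.* (1ℚ ℚ.+ ρ)
        ≤⟨ ℚ.*-monoʳ-≤-nonNeg (1ℚ ℚ.+ ρ) κ-hi ⟩
      ι (+ 400) ℚ.* ι (+ n) ℚ.* (1ℚ ℚ.+ ρ)
        ≡⟨ value (ι (+ n)) ⟩
      ι (+ 420) ℚ.* ι (+ n)
        ≡⟨ ι-ℕ* 420 n ⟨
      ι (+ (420 * n))
        ∎))) (ℕ.≤-trans (ℕ.*-monoˡ-≤ n (ℕ.≤ᵇ⇒≤ 420 588 _)) (ℕ.≤-reflexive (ℕ.*-assoc 196 3 n))))
      where
      v : Vec ℤ n
      v = difference c c′
      value : ∀ x → ι (+ 400) ℚ.* x ℚ.* (1ℚ ℚ.+ + 1 / 20) ≡ ι (+ 420) ℚ.* x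
      value = solve-∀ ℚ-ring

    -- Within one cube every coordinate of `e` is at most 18 in absolute value, so the sum of
    -- squares is at most 324 n, less than 361 n · 19/20.
    unit⇒different : 1ℚ ℚ.- ρ ℚ.≤ s → ¬ (∀ j → c j ≡ c′ j)
    unit⇒different ≤s same = ℚ.<-irrefl refl (begin-strict
      ∑ℚ (λ j → e j ℚ.* e j)
        ≤⟨ ∑-mono (λ j → Within⇒² {ι (+ 18)} {e j} (subst (Within (ι (+ 18))) (at-zero (e j))
             (subst (Near (e j)) (trans (cong (ℤ._- c′ j) (same j)) (ℤ.+-inverseʳ (c′ j))) (near j)))) ⟩
      ∑ℚ {n} (λ _ → ι (+ 324))
        ≡⟨ ∑-const n (ι (+ 324)) ⟩
      ι (+ n) ℚ.* ι (+ 324)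
        <⟨ ℚ.*-monoʳ-<-pos (ι (+ n)) (ℚ.<-trans (ι-mono-< {+ 324} {+ 325} (ℤ.+<+ (ℕ.≤ᵇ⇒≤ 325 325 _))) 325<) ⟩
      ι (+ n) ℚ.* (ι (+ 361) ℚ.* (1ℚ ℚ.- ρ))
        ≡⟨ value (ι (+ n)) (ι (+ 361)) (1ℚ ℚ.- ρ) ⟩
      ι (+ 361) ℚ.* ι (+ n) ℚ.* (1ℚ ℚ.- ρ)
        ≤⟨ ℚ.*-monoʳ-≤-nonNeg (1ℚ ℚ.- ρ) κ-lo ⟩
      κ ℚ.* κ ℚ.* (1ℚ ℚ.- ρ)
        ≤⟨ ℚ.*-monoˡ-≤-nonNeg (κ ℚ.* κ) {{ℚ.nonNegative (0≤-* 0≤κ 0≤κ)}} ≤s ⟩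
      κ ℚ.* κ ℚ.* s
        ≡⟨ ∑e² ⟨
      ∑ℚ (λ j → e j ℚ.* e j)
        ∎)
      where
      325< : ι (+ 325) ℚ.< ι (+ 361) ℚ.* (1ℚ ℚ.- ρ)
      325< = ℚ.*<* (ℤ.+<+ (ℕ.<ᵇ⇒< 6500 6859 _))
      at-zero : ∀ e → e ℚ.- ι (+ 16) ℚ.* ι (+ 0) ≡ e
      at-zero = solve-∀ ℚ-ring
      value : ∀ x y z → x ℚ.* (y ℚ.* z) ≡ y ℚ.* x ℚ.* z
      value = solve-∀ ℚ-ring

    module _ (z z′ : Vec ℤ n) (z-short : excess² z ≤ 3 * n) (z′-short : excess² z′ ≤ 3 * n) where

      -- A common neighbour would give |e_j| ≤ 50 + 16 a + 16 a′ with the excesses a and a′ of z_j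
      -- and z′_j. Squaring and summing bounds the total by 3 (2500 + 6 · 256) n = 12108 n, below
      -- 361 · 63 n = 22743 n. The number 63 is 8² less an approximation error of one.
      far⇒unaligned : ι (+ 63) ℚ.≤ s → ¬ (∀ j → (c ⊕ z) j ≡ (c′ ⊕ z′) j)
      far⇒unaligned 63≤s aligned = ℚ.<-irrefl refl (begin-strict
        ∑ℚ (λ j → e j ℚ.* e j)
          ≤⟨ ∑-mono bound ⟩
        ∑ℚ (λ j → ι (+ 3) ℚ.* (ι (+ 2500) ℚ.+ (ι (+ 256) ℚ.* x j ℚ.+ ι (+ 256) ℚ.* x′ j)))
          ≡⟨ ∑-* (ι (+ 3)) (λ j → ι (+ 2500) ℚ.+ (ι (+ 256) ℚ.* x j ℚ.+ ι (+ 256) ℚ.* x′ j)) ⟩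
        ι (+ 3) ℚ.* ∑ℚ (λ j → ι (+ 2500) ℚ.+ (ι (+ 256) ℚ.* x j ℚ.+ ι (+ 256) ℚ.* x′ j))
          ≡⟨ cong (ι (+ 3) ℚ.*_) (trans (∑-+ (λ _ → ι (+ 2500)) (λ j → ι (+ 256) ℚ.* x j ℚ.+ ι (+ 256) ℚ.* x′ j))
               (cong₂ ℚ._+_ (∑-const n (ι (+ 2500))) (trans (∑-+ (λ j → ι (+ 256) ℚ.* x j) (λ j → ι (+ 256) ℚ.* x′ j))
                 (cong₂ ℚ._+_ (∑-256 z) (∑-256 z′))))) ⟩
        ι (+ 3) ℚ.* (ι (+ n) ℚ.* ι (+ 2500) ℚ.+ (ι (+ 256) ℚ.* ι (+ excess² z) ℚ.+ ι (+ 256) ℚ.* ι (+ excess² z′)))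
          ≤⟨ ℚ.*-monoˡ-≤-nonNeg (ι (+ 3)) (ℚ.+-monoʳ-≤ (ι (+ n) ℚ.* ι (+ 2500)) (ℚ.+-mono-≤ (≤-256 z-short) (≤-256 z′-short))) ⟩
        ι (+ 3) ℚ.* (ι (+ n) ℚ.* ι (+ 2500) ℚ.+ (ι (+ 256) ℚ.* (ι (+ 3) ℚ.* ι (+ n)) ℚ.+ ι (+ 256) ℚ.* (ι (+ 3) ℚ.* ι (+ n))))
          ≡⟨ value (ι (+ n)) ⟩
        ι (+ n) ℚ.* ι (+ 12108)
          <⟨ ℚ.*-monoʳ-<-pos (ι (+ n)) (ι-mono-< {+ 12108} {+ 22743} (ℤ.+<+ (ℕ.<ᵇ⇒< 12108 22743 _))) ⟩
        ι (+ n) ℚ.* ι (+ 22743)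
          ≡⟨ value′ (ι (+ n)) ⟩
        ι (+ 361) ℚ.* ι (+ n) ℚ.* ι (+ 63)
          ≤⟨ *-mono-≤′ (0≤-* (0≤ι 361) (0≤ι n)) (ℚ.≤-trans (0≤ι 63) 63≤s) κ-lo 63≤s ⟩
        κ ℚ.* κ ℚ.* s
          ≡⟨ ∑e² ⟨
        ∑ℚ (λ j → e j ℚ.* e j)
          ∎)
        where
        a a′ : Fin n → ℕ
        a j = excess (lookup z j)
        a′ j = excess (lookup z′ j)
        x x′ : Vector ℚ n
        x j = ι (+ (a j * a j))
        x′ j = ι (+ (a′ j * a′ j))
        ∑-256 : ∀ (z : Vec ℤ n) → ∑ℚ (λ j → ι (+ 256) ℚ.* ι (+ (excess (lookup z j) * excess (lookup z j)))) ≡ ι (+ 256) ℚ.* ι (+ excess² z)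
        ∑-256 z = trans (∑-* (ι (+ 256)) (λ j → ι (+ (excess (lookup z j) * excess (lookup z j))))) (cong (ι (+ 256) ℚ.*_) (∑-ι z))
        ≤-256 : ∀ {b} → b ≤ 3 * n → ι (+ 256) ℚ.* ι (+ b) ℚ.≤ ι (+ 256) ℚ.* (ι (+ 3) ℚ.* ι (+ n))
        ≤-256 {b} b≤ = ℚ.*-monoˡ-≤-nonNeg (ι (+ 256)) (subst (ι (+ b) ℚ.≤_) (ι-ℕ* 3 n) (ι-ℕ-≤ b≤))
        value : ∀ x → ι (+ 3) ℚ.* (x ℚ.* ι (+ 2500) ℚ.+ (ι (+ 256) ℚ.* (ι (+ 3) ℚ.* x) ℚ.+ ι (+ 256) ℚ.* (ι (+ 3) ℚ.* x))) ≡ x ℚ.* ι (+ 12108)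
        value = solve-∀ ℚ-ring
        value′ : ∀ x → x ℚ.* ι (+ 22743) ≡ ι (+ 361) ℚ.* x ℚ.* ι (+ 63)
        value′ = solve-∀ ℚ-ring
        ∣∣≤1+excess : ∀ z → ℤ.∣ z ∣ ≤ suc (excess z)
        ∣∣≤1+excess z = ℕ.m≤n+m∸n ℤ.∣ z ∣ 1
        close : ∀ j → ℤ.∣ c j ℤ.- c′ j ∣ ≤ suc (a′ j) + suc (a j)
        close j = subst (λ t → ℤ.∣ t ∣ ≤ suc (a′ j) + suc (a j))
          (sym (exchange (c j) (c′ j) (lookup z j) (lookup z′ j) (aligned j)))
          (ℕ.≤-trans (ℤ.∣i-j∣≤∣i∣+∣j∣ (lookup z′ j) (lookup z j)) (ℕ.+-mono-≤ (∣∣≤1+excess (lookup z′ j)) (∣∣≤1+excess (lookup z j))))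
          where
          exchange : ∀ c c′ z z′ → c ℤ.+ z ≡ c′ ℤ.+ z′ → c ℤ.- c′ ≡ z′ ℤ.- z
          exchange c c′ z z′ eq = trans (split c c′ z) (trans (cong (λ t → t ℤ.- c′ ℤ.- z) eq) (join c′ z z′))
            where
            split : ∀ c c′ z → c ℤ.- c′ ≡ c ℤ.+ z ℤ.- c′ ℤ.- z
            split = ℤ-Solver.solve-∀
            join : ∀ c′ z z′ → c′ ℤ.+ z′ ℤ.- c′ ℤ.- z ≡ z′ ℤ.- z
            join = ℤ-Solver.solve-∀
        bound : ∀ j → e j ℚ.* e j ℚ.≤ ι (+ 3) ℚ.* (ι (+ 2500) ℚ.+ (ι (+ 256) ℚ.* x j ℚ.+ ι (+ 256) ℚ.* x′ j))
        bound j = begin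
          e j ℚ.* e j
            ≤⟨ Within⇒² {w} {e j} (Near⇒Within {e j} (c j ℤ.- c′ j) (close j) (near j)) ⟩
          w ℚ.* w
            ≡⟨ cong (λ t → t ℚ.* t) w≡ ⟩
          (ι (+ 50) ℚ.+ ι (+ 16) ℚ.* ι (+ a j) ℚ.+ ι (+ 16) ℚ.* ι (+ a′ j)) ℚ.* (ι (+ 50) ℚ.+ ι (+ 16) ℚ.* ι (+ a j) ℚ.+ ι (+ 16) ℚ.* ι (+ a′ j))
            ≤⟨ sum-of-three² (ι (+ 50)) (ι (+ 16) ℚ.* ι (+ a j)) (ι (+ 16) ℚ.* ι (+ a′ j)) ⟩
          ι (+ 3) ℚ.* (ι (+ 50) ℚ.* ι (+ 50) ℚ.+ (ι (+ 16) ℚ.* ι (+ a j)) ℚ.* (ι (+ 16) ℚ.* ι (+ a j)) ℚ.+ (ι (+ 16) ℚ.* ι (+ a′ j)) ℚ.* (ι (+ 16) ℚ.* ι (+ a′ j)))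
            ≡⟨ squares (ι (+ a j)) (ι (+ a′ j)) ⟩
          ι (+ 3) ℚ.* (ι (+ 2500) ℚ.+ (ι (+ 256) ℚ.* (ι (+ a j) ℚ.* ι (+ a j)) ℚ.+ ι (+ 256) ℚ.* (ι (+ a′ j) ℚ.* ι (+ a′ j))))
            ≡⟨ cong₂ (λ s t → ι (+ 3) ℚ.* (ι (+ 2500) ℚ.+ (ι (+ 256) ℚ.* s ℚ.+ ι (+ 256) ℚ.* t))) (ι-ℕ* (a j) (a j)) (ι-ℕ* (a′ j) (a′ j)) ⟨
          ι (+ 3) ℚ.* (ι (+ 2500) ℚ.+ (ι (+ 256) ℚ.* x j ℚ.+ ι (+ 256) ℚ.* x′ j))
            ∎
          where
          w : ℚ
          w = ι (+ 18) ℚ.+ ι (+ 16) ℚ.* ι (+ (suc (a′ j) + suc (a j)))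
          w≡ : w ≡ ι (+ 50) ℚ.+ ι (+ 16) ℚ.* ι (+ a j) ℚ.+ ι (+ 16) ℚ.* ι (+ a′ j)
          w≡ = trans (cong (λ t → ι (+ 18) ℚ.+ ι (+ 16) ℚ.* t)
            (trans (ι-+ (+ suc (a′ j)) (+ suc (a j))) (cong₂ ℚ._+_ (ι-+ (+ 1) (+ a′ j)) (ι-+ (+ 1) (+ a j)))))
            (collect (ι (+ a j)) (ι (+ a′ j)))
            where
            collect : ∀ a b → ι (+ 18) ℚ.+ ι (+ 16) ℚ.* ((1ℚ ℚ.+ b) ℚ.+ (1ℚ ℚ.+ a)) ≡ ι (+ 50) ℚ.+ ι (+ 16) ℚ.* a ℚ.+ ι (+ 16) ℚ.* b
            collect = solve-∀ ℚ-ring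
          squares : ∀ a b → ι (+ 3) ℚ.* (ι (+ 50) ℚ.* ι (+ 50) ℚ.+ (ι (+ 16) ℚ.* a) ℚ.* (ι (+ 16) ℚ.* a) ℚ.+ (ι (+ 16) ℚ.* b) ℚ.* (ι (+ 16) ℚ.* b)) ≡
            ι (+ 3) ℚ.* (ι (+ 2500) ℚ.+ (ι (+ 256) ℚ.* (a ℚ.* a) ℚ.+ ι (+ 256) ℚ.* (b ℚ.* b)))
          squares = solve-∀ ℚ-ring

    -- This keeps the cells along a copy from wrapping around the torus. A coordinate of `e` is at
    -- most its norm, hence at most 20 √n √(m² + 1) ≤ 40 n m.
    bounded⇒∣c-c′∣ : ∀ m → 1 ≤ m → s ℚ.≤ ι (+ m) ℚ.* ι (+ m) ℚ.+ 1ℚ → ∀ j → 16 * ℤ.∣ c j ℤ.- c′ j ∣ ≤ 18 + 40 * n * m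
    bounded⇒∣c-c′∣ m 1≤m s≤ j = Near⇒∣∣ {e j} (c j ℤ.- c′ j) (²⇒Within {S} {e j} (0≤ι (40 * n * m)) (begin
      e j ℚ.* e j
        ≤⟨ term≤∑ {u = λ j → e j ℚ.* e j} (λ j → 0≤-² (e j)) j ⟩
      ∑ℚ (λ j → e j ℚ.* e j)
        ≡⟨ ∑e² ⟩
      κ ℚ.* κ ℚ.* s
        ≤⟨ *-mono-≤′ (0≤-* 0≤κ 0≤κ) (0≤-+ (0≤-* (0≤ι m) (0≤ι m)) 0≤1) κ-hi s≤ ⟩
      ι (+ 400) ℚ.* ι (+ n) ℚ.* (ι (+ m) ℚ.* ι (+ m) ℚ.+ 1ℚ)
        ≡⟨ trans (ι-ℕ* (400 * n) (m * m + 1)) (cong₂ ℚ._*_ (ι-ℕ* 400 n) (trans (ι-+ (+ (m * m)) (+ 1)) (cong (ℚ._+ 1ℚ) (ι-ℕ* m m)))) ⟨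
      ι (+ (400 * n * (m * m + 1)))
        ≤⟨ ι-ℕ-≤ natural ⟩
      ι (+ (40 * n * m * (40 * n * m)))
        ≡⟨ ι-ℕ* (40 * n * m) (40 * n * m) ⟩
      S ℚ.* S
        ∎)) (near j)
      where
      S : ℚ
      S = ι (+ (40 * n * m))
      natural : 400 * n * (m * m + 1) ≤ 40 * n * m * (40 * n * m)
      natural = ℕ.≤-trans (ℕ.*-mono-≤ (ℕ.≤-trans (ℕ.*-monoʳ-≤ 400 (ℕ.m≤m*n n n)) (ℕ.*-monoˡ-≤ (n * n) (ℕ.≤ᵇ⇒≤ 400 800 _)))
          (ℕ.+-monoʳ-≤ (m * m) (ℕ.*-mono-≤ 1≤m 1≤m)))
        (ℕ.≤-reflexive (regroup n m))
        where
        regroup : ∀ n m → 800 * (n * n) * (m * m + m * m) ≡ 40 * n * m * (40 * n * m)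
        regroup = ℕ-Solver.solve-∀

  -- One coordinate of a line q₀ + t (q₁ - q₀), with S and U its rounded data at scale η.
  line-in-cell : ∀ η t c S U q₀ q₁ q ε → 0ℚ ℚ.< η → 0ℚ ℚ.≤ t → ι (+ 2) ℚ.+ ι (+ 2) ℚ.* t ℚ.≤ η →
    S ℚ.≤ η ℚ.* κ ℚ.* q₀ × η ℚ.* κ ℚ.* q₀ ℚ.≤ S ℚ.+ ι (+ 2) →
    U ℚ.≤ η ℚ.* κ ℚ.* (q₁ ℚ.- q₀) × η ℚ.* κ ℚ.* (q₁ ℚ.- q₀) ℚ.≤ U ℚ.+ ι (+ 2) →
    ι (+ 16) ℚ.* η ℚ.* c ℚ.≤ S ℚ.+ t ℚ.* U → S ℚ.+ t ℚ.* U ℚ.≤ ι (+ 16) ℚ.* η ℚ.* c ℚ.+ ι (+ 16) ℚ.* η →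
    Within ε (q ℚ.- (q₀ ℚ.+ t ℚ.* (q₁ ℚ.- q₀))) →
    ι (+ 16) ℚ.* c ℚ.≤ κ ℚ.* (q ℚ.+ ε) × κ ℚ.* (q ℚ.- ε) ℚ.≤ ι (+ 16) ℚ.* c ℚ.+ ι (+ 17)
  line-in-cell η t c S U q₀ q₁ q ε 0<η 0≤t fine (S₁ , S₂) (U₁ , U₂) c₁ c₂ (w₁ , w₂) =
    ℚ.*-cancelˡ-≤-pos η {{ℚ.positive 0<η}} (≤-cert _ (lower η κ t c S U q₀ q₁ q ε)
      (0≤-+ (0≤-+ (0≤-+ (0≤-* 0≤ηκ (0≤-diff w₁)) (0≤-diff S₁)) (0≤-* 0≤t (0≤-diff U₁))) (0≤-diff c₁))) ,
    -- Rounding down costs nothing on the lower side. On the upper side the errors of S and t U add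
    -- up to 2 + 2 t ≤ η, which is one scaled unit: the overlap between side 17 and spacing 16.
    ℚ.*-cancelˡ-≤-pos η {{ℚ.positive 0<η}} (≤-cert _ (upper η κ t c S U q₀ q₁ q ε)
      (0≤-+ (0≤-+ (0≤-+ (0≤-+ (0≤-* 0≤ηκ (0≤-diff w₂)) (0≤-diff S₂)) (0≤-* 0≤t (0≤-diff U₂))) (0≤-diff c₂)) (0≤-diff fine)))
    where
    0≤ηκ : 0ℚ ℚ.≤ η ℚ.* κ
    0≤ηκ = 0≤-* (ℚ.<⇒≤ 0<η) 0≤κ
    lower : ∀ η κ t c S U q₀ q₁ q ε → η ℚ.* (κ ℚ.* (q ℚ.+ ε)) ℚ.- η ℚ.* (ι (+ 16) ℚ.* c) ≡
      η ℚ.* κ ℚ.* (q ℚ.- (q₀ ℚ.+ t ℚ.* (q₁ ℚ.- q₀)) ℚ.- ℚ.- ε) ℚ.+ (η ℚ.* κ ℚ.* q₀ ℚ.- S) ℚ.+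
      t ℚ.* (η ℚ.* κ ℚ.* (q₁ ℚ.- q₀) ℚ.- U) ℚ.+ (S ℚ.+ t ℚ.* U ℚ.- ι (+ 16) ℚ.* η ℚ.* c)
    lower = solve-∀ ℚ-ring
    upper : ∀ η κ t c S U q₀ q₁ q ε → η ℚ.* (ι (+ 16) ℚ.* c ℚ.+ ι (+ 17)) ℚ.- η ℚ.* (κ ℚ.* (q ℚ.- ε)) ≡
      η ℚ.* κ ℚ.* (ε ℚ.- (q ℚ.- (q₀ ℚ.+ t ℚ.* (q₁ ℚ.- q₀)))) ℚ.+ (S ℚ.+ ι (+ 2) ℚ.- η ℚ.* κ ℚ.* q₀) ℚ.+
      t ℚ.* (U ℚ.+ ι (+ 2) ℚ.- η ℚ.* κ ℚ.* (q₁ ℚ.- q₀)) ℚ.+ (ι (+ 16) ℚ.* η ℚ.* c ℚ.+ ι (+ 16) ℚ.* η ℚ.- (S ℚ.+ t ℚ.* U)) ℚ.+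
      (η ℚ.- (ι (+ 2) ℚ.+ ι (+ 2) ℚ.* t))
    upper = solve-∀ ℚ-ring

-- The coloring

length-cartesianProductWith : ∀ {A B C : Set} (f : A → B → C) xs ys → length (cartesianProductWith f xs ys) ≡ length xs * length ys
length-cartesianProductWith f []       ys = refl
length-cartesianProductWith f (x ∷ xs) ys = trans (length-++ (map (f x) ys))
  (cong₂ _+_ (length-map (f x) ys) (length-cartesianProductWith f xs ys))

vectors : ∀ {A : Set} → List A → ∀ n → List (Vec A n)
vectors xs zero    = [] ∷ []
vectors xs (suc n) = cartesianProductWith _∷_ xs (vectors xs n)

∈-vectors : ∀ {A : Set} {xs : List A} {n} (v : Vec A n) → (∀ j → lookup v j ∈ xs) → v ∈ vectors xs n
∈-vectors []      _ = here refl
∈-vectors (x ∷ v) ∈xs = ∈-cartesianProductWith⁺ _∷_ (∈xs zero) (∈-vectors v (λ j → ∈xs (suc j)))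

length-vectors : ∀ {A : Set} (xs : List A) n → length (vectors xs n) ≡ length xs ^ n
length-vectors xs zero    = refl
length-vectors xs (suc n) = trans (length-cartesianProductWith _∷_ xs (vectors xs n)) (cong (length xs *_) (length-vectors xs n))

-- Finite codes for rounded progressions

module Rounding (Q T : ℕ) {{Q≢0 : ℕ.NonZero Q}} {{P≢0 : ℕ.NonZero (Q * T)}} where

  P : ℕ
  P = Q * T

  cellCode : ℕ → ℕ → ℕ → ℤ
  cellCode s t i = + ((s + i * t) ℕ./ Q)

  shift : ℤ → ℤ → ℕ → ℤ
  shift S U i = S ℤ./ℕ P ℤ.+ + i ℤ.* (U ℤ./ℕ P)

  -- This is the floor of (S + i U) / Q. Since P = Q T, reducing S and U modulo P changes that floor
  -- by a multiple of T, so the definition separates a part known from the residues from a part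
  -- invisible on the torus.
  cell : ℤ → ℤ → ℕ → ℤ
  cell S U i = cellCode (S ℤ.%ℕ P) (U ℤ.%ℕ P) i ℤ.+ + T ℤ.* shift S U i

  private
    decompose : ∀ S U i → S ℤ.+ + i ℤ.* U ≡ + ((S ℤ.%ℕ P + i * (U ℤ.%ℕ P)) ℕ.% Q) ℤ.+ + Q ℤ.* cell S U i
    decompose S U i = begin
      S ℤ.+ + i ℤ.* U
        ≡⟨ cong₂ (λ x y → x ℤ.+ + i ℤ.* y) (ℤ.a≡a%ℕn+[a/ℕn]*n S P) (ℤ.a≡a%ℕn+[a/ℕn]*n U P) ⟩
      + s ℤ.+ A ℤ.* + P ℤ.+ + i ℤ.* (+ t ℤ.+ B ℤ.* + P)
        ≡⟨ cong (λ x → + s ℤ.+ A ℤ.* x ℤ.+ + i ℤ.* (+ t ℤ.+ B ℤ.* x)) (ℤ.pos-* Q T) ⟩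
      + s ℤ.+ A ℤ.* (+ Q ℤ.* + T) ℤ.+ + i ℤ.* (+ t ℤ.+ B ℤ.* (+ Q ℤ.* + T))
        ≡⟨ regroup (+ s) (+ t) (+ i) A B (+ Q) (+ T) ⟩
      (+ s ℤ.+ + i ℤ.* + t) ℤ.+ + Q ℤ.* (+ T ℤ.* (A ℤ.+ + i ℤ.* B))
        ≡⟨ cong (λ x → x ℤ.+ + Q ℤ.* (+ T ℤ.* (A ℤ.+ + i ℤ.* B))) natural ⟩
      (+ (g ℕ.% Q) ℤ.+ + (g ℕ./ Q) ℤ.* + Q) ℤ.+ + Q ℤ.* (+ T ℤ.* (A ℤ.+ + i ℤ.* B))
        ≡⟨ regroup′ (+ (g ℕ.% Q)) (+ (g ℕ./ Q)) (+ Q) (+ T ℤ.* (A ℤ.+ + i ℤ.* B)) ⟩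
      + (g ℕ.% Q) ℤ.+ + Q ℤ.* cell S U i
        ∎
      where
      open ≡-Reasoning
      s t g : ℕ
      s = S ℤ.%ℕ P
      t = U ℤ.%ℕ P
      g = s + i * t
      A B : ℤ
      A = S ℤ./ℕ P
      B = U ℤ./ℕ P
      natural : + s ℤ.+ + i ℤ.* + t ≡ + (g ℕ.% Q) ℤ.+ + (g ℕ./ Q) ℤ.* + Q
      natural = trans (cong (λ x → + s ℤ.+ x) (sym (ℤ.pos-* i t)))
        (trans (cong +_ (ℕ.m≡m%n+[m/n]*n g Q)) (cong (λ x → + (g ℕ.% Q) ℤ.+ x) (ℤ.pos-* (g ℕ./ Q) Q)))
      regroup : ∀ s t i A B Q T → s ℤ.+ A ℤ.* (Q ℤ.* T) ℤ.+ i ℤ.* (t ℤ.+ B ℤ.* (Q ℤ.* T)) ≡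
        (s ℤ.+ i ℤ.* t) ℤ.+ Q ℤ.* (T ℤ.* (A ℤ.+ i ℤ.* B))
      regroup = ℤ-Solver.solve-∀
      regroup′ : ∀ r d Q X → (r ℤ.+ d ℤ.* Q) ℤ.+ Q ℤ.* X ≡ r ℤ.+ Q ℤ.* (d ℤ.+ X)
      regroup′ = ℤ-Solver.solve-∀

  cell-lower : ∀ S U i → + Q ℤ.* cell S U i ℤ.≤ S ℤ.+ + i ℤ.* U
  cell-lower S U i = subst (+ Q ℤ.* cell S U i ℤ.≤_) (sym (decompose S U i)) (ℤ.i≤j+i _ (+ ((S ℤ.%ℕ P + i * (U ℤ.%ℕ P)) ℕ.% Q)))

  cell-upper : ∀ S U i → S ℤ.+ + i ℤ.* U ℤ.≤ + Q ℤ.* cell S U i ℤ.+ + Q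
  cell-upper S U i = subst (ℤ._≤ + Q ℤ.* cell S U i ℤ.+ + Q) (sym (decompose S U i))
    (subst (+ ((S ℤ.%ℕ P + i * (U ℤ.%ℕ P)) ℕ.% Q) ℤ.+ + Q ℤ.* cell S U i ℤ.≤_) (ℤ.+-comm (+ Q) (+ Q ℤ.* cell S U i))
      (ℤ.+-monoˡ-≤ (+ Q ℤ.* cell S U i) (ℤ.+≤+ (ℕ.<⇒≤ (ℕ.m%n<n (S ℤ.%ℕ P + i * (U ℤ.%ℕ P)) Q)))))

module Construction (em : ExcludedMiddle 0ℓ) (n m M L k D Q T : ℕ) {{n≢0 : ℕ.NonZero n}}
  (1000≤m : 1000 ≤ m) (m≡8M : m ≡ 8 * M)
  (361n≤k² : 361 * n ≤ k * k) (k²≤400n : k * k ≤ 400 * n)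
  (D≡ : D ≡ 34 ^ n) (Q≡ : Q ≡ 32 * m) (T≡ : T ≡ 4 * n * m)
  (enough-tests : 4 * D * L ≤ M)
  (few-codes : 2 * ((Q * T) * (Q * T)) ^ n ≤ 2 ^ L)
  where

  open Geometry n k 361n≤k² k²≤400n

  0<m : 0 < m
  0<m = ℕ.≤-trans (s≤s z≤n) 1000≤m

  1<m : 1 < m
  1<m = ℕ.≤-trans (s≤s (s≤s z≤n)) 1000≤m

  m≤T : m ≤ T
  m≤T = subst (m ≤_) (sym T≡) (ℕ.m≤n*m m (4 * n) {{ℕ.m*n≢0 4 n}})

  instance
    T≢0 : ℕ.NonZero T
    T≢0 = ℕ.>-nonZero (ℕ.<-≤-trans 0<m m≤T)
    m≢0 : ℕ.NonZero m
    m≢0 = ℕ.>-nonZero 0<m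
    Q≢0 : ℕ.NonZero Q
    Q≢0 = subst ℕ.NonZero (sym Q≡) (ℕ.m*n≢0 32 m)
    P≢0 : ℕ.NonZero (Q * T)
    P≢0 = ℕ.m*n≢0 Q T

  open Rounding Q T

  0<D : 0 < D
  0<D = subst (0 <_) (sym D≡) (ℕ.m^n>0 34 n)

  density : ∃ λ p → 0ℚ ℚ.< p × ι (+ D) ℚ.* p ≡ ½
  density = scaled (ι (+ D)) ½ (ι-mono-< (ℤ.+<+ 0<D)) (ℚ.positive⁻¹ ½)

  p : ℚ
  p = proj₁ density

  0≤p : 0ℚ ℚ.≤ p
  0≤p = ℚ.<⇒≤ (proj₁ (proj₂ density))

  Dp≡½ : ι (+ D) ℚ.* p ≡ ½
  Dp≡½ = proj₂ (proj₂ density)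

  p≤1 : p ℚ.≤ 1ℚ
  p≤1 = begin
    p                  ≡⟨ ℚ.*-identityˡ p ⟨
    1ℚ ℚ.* p           ≤⟨ ℚ.*-monoʳ-≤-nonNeg p {{ℚ.nonNegative 0≤p}} (ι-ℕ-≤ 0<D) ⟩
    ι (+ D) ℚ.* p      ≡⟨ Dp≡½ ⟩
    ½                  ≤⟨ ℚ.≤ᵇ⇒≤ _ ⟩
    1ℚ                 ∎
    where open ℚ.≤-Reasoning

  open Torus n T p 0≤p p≤1

  3n+1<T : suc (3 * n) < T
  3n+1<T = subst (suc (3 * n) <_) (sym T≡) (begin-strict
    suc (3 * n)              <⟨ ℕ.m<m+n (suc (3 * n)) (s≤s z≤n) ⟩
    suc (3 * n) + suc (5 * n) ≡⟨ sum n ⟩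
    2 + 8 * n              ≤⟨ ℕ.+-monoˡ-≤ (8 * n) (ℕ.m≤m*n 2 n) ⟩
    2 * n + 8 * n        ≡⟨ ten n ⟩
    n * 10                   ≤⟨ ℕ.*-mono-≤ (ℕ.m≤n*m n 4) (ℕ.≤-trans (ℕ.≤ᵇ⇒≤ 10 1000 _) 1000≤m) ⟩
    4 * n * m              ∎)
    where
    open ℕ.≤-Reasoning
    sum : ∀ n → suc (3 * n) + suc (5 * n) ≡ 2 + 8 * n
    sum = ℕ-Solver.solve-∀
    ten : ∀ n → 2 * n + 8 * n ≡ n * 10
    ten = ℕ-Solver.solve-∀

  Code : Set
  Code = Vec (ℕ × ℕ) n

  codes : List Code
  codes = vectors (cartesianProduct (upTo P) (upTo P)) n

  codeCell : Code → ℕ → Cell n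
  codeCell w i j = cellCode (proj₁ (lookup w j)) (proj₂ (lookup w j)) i

  tests : Code → List Test
  tests w = applyUpTo (λ l → testAt (codeCell w (8 * l))) M

  disjoint? : ∀ ts → Dec (DisjointTests ts)
  disjoint? ts = em

  words : List (List Test)
  words = filter disjoint? (map tests codes)

  testAt-admissible-D : ∀ c → Admissible D (testAt c)
  testAt-admissible-D c = subst (λ d → Admissible d (testAt c)) (sym D≡) (testAt-admissible c)

  tests-admissible : ∀ w → All (Admissible D) (tests w)
  tests-admissible w = All.applyUpTo⁺₂ (λ l → testAt (codeCell w (8 * l))) M (λ l → testAt-admissible-D (codeCell w (8 * l)))

  Good : List Test → Set
  Good ts = DisjointTests ts × All (Admissible D) ts × length ts ≡ M

  tests-good : ∀ w → DisjointTests (tests w) → Good (tests w)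
  tests-good w disjoint = disjoint , tests-admissible w , length-applyUpTo (λ l → testAt (codeCell w (8 * l))) M

  words-good : All Good words
  words-good = All.tabulate λ {ts} ts∈ →
    let (ts∈tests , disjoint) = ∈-filter⁻ disjoint? {v = ts} {xs = map tests codes} ts∈
        (w , _ , ts≡) = ∈-map⁻ tests {xs = codes} ts∈tests
    in subst Good (sym ts≡) (tests-good w (subst DisjointTests ts≡ disjoint))

  length-codes : length codes ≡ (P * P) ^ n
  length-codes = trans (length-vectors (cartesianProduct (upTo P) (upTo P)) n)
    (cong (_^ n) (trans (length-cartesianProductWith _,_ (upTo P) (upTo P)) (cong₂ _*_ (length-upTo P) (length-upTo P))))

  2words≤2^L : 2 * length words ≤ 2 ^ L
  2words≤2^L = begin
    2 * length words              ≤⟨ ℕ.*-monoʳ-≤ 2 (length-filter disjoint? (map tests codes)) ⟩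
    2 * length (map tests codes)  ≡⟨ cong (2 *_) (trans (length-map tests codes) length-codes) ⟩
    2 * (P * P) ^ n           ≤⟨ few-codes ⟩
    2 ^ L                         ∎
    where open ℕ.≤-Reasoning

  marking : ∃ λ μ → ∀ {ts} → ts ∈ words → Any (Passes μ) ts
  marking = marks-exist D M words words-good (union-bound D M L (length words) 0≤p p≤1 Dp≡½ enough-tests 2words≤2^L)

  μ : Marks
  μ = proj₁ marking

  -- Cubes overlap, so a point may lie in several cells; one passing cell suffices. The existential
  -- avoids choosing a cell and respects equality of points.
  Red : Point n → Set
  Red x = ∃ λ c → InCell x c × Passes μ (testAt c)

  color : ∀ {A : Set} → Dec A → Color
  color (yes _) = red
  color (no _)  = blue

  color-cong : ∀ {A B : Set} → (A → B) → (B → A) → (a? : Dec A) (b? : Dec B) → color a? ≡ color b?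
  color-cong f g (yes a) (yes b) = refl
  color-cong f g (yes a) (no ¬b) = ⊥-elim (¬b (f a))
  color-cong f g (no ¬a) (yes b) = ⊥-elim (¬a (g b))
  color-cong f g (no ¬a) (no ¬b) = refl

  red⇒ : ∀ {A : Set} (a? : Dec A) → color a? ≡ red → A
  red⇒ (yes a) _ = a

  blue⇒ : ∀ {A : Set} (a? : Dec A) → color a? ≡ blue → ¬ A
  blue⇒ (no ¬a) _ = ¬a

  Red-resp : ∀ {x y : Point n} → (∀ j → x j ≈ y j) → Red x → Red y
  Red-resp {x} {y} x≈y (c , x∈c , passes) = c , InCell-resp {x} {y} c x≈y x∈c , passes

  χ : Coloring n
  χ = record
    { to   = λ x → color (em {Red x})
    ; cong = λ {x} {y} x≈y → color-cong (Red-resp {x} {y} x≈y)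
        (Red-resp {y} {x} (λ j → ≈-sym {x j} {y j} (x≈y j))) (em {Red x}) (em {Red y})
    }

  0<ρ : 0ℚ ℚ.< ρ
  0<ρ = ℚ.positive⁻¹ ρ

  no-red-pair : ¬ HasCopy χ red (ℓ 2)
  no-red-pair (f , copy , all-red) =
    contradict (red⇒ (em {Red (f zero)}) (all-red zero)) (red⇒ (em {Red (f (suc zero))}) (all-red (suc zero)))
    where
    contradict : Red (f zero) → Red (f (suc zero)) → ⊥
    contradict (c , x∈c , passes) (c′ , y∈c′ , passes′) =
      let (K , (d₁ , d₂) , near) = Ev-instance (copy-sqdist {f = f} copy zero (suc zero) {ρ} 0<ρ ∩
            InCell⇒Near {f zero} {f (suc zero)} c c′ x∈c y∈c′)
          e = scaled-diff (f zero) (f (suc zero)) K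
          s = sqdist (f zero) (f (suc zero)) K
          ∑e² = ∑-scaled-diff² (f zero) (f (suc zero)) K
      -- The upper bound on the distance makes the difference of the cells short, so the two passing
      -- cells coincide; the lower bound forbids this.
      in unit⇒different e c c′ near s ∑e² (≤-cert _ (below s) (0≤-diff d₂))
           (passing-near-equal {μ} c′ c 3n+1<T passes′ passes
             (unit⇒short e c c′ near s ∑e² (≤-cert _ (above s) (0≤-diff d₁))))
      where
      below : ∀ s → s ℚ.- (1ℚ ℚ.- + 1 / 20) ≡ + 1 / 20 ℚ.- ((ι (+ 0) ℚ.- ι (+ 1)) ℚ.* (ι (+ 0) ℚ.- ι (+ 1)) ℚ.- s)
      below = solve-∀ ℚ-ring
      above : ∀ s → 1ℚ ℚ.+ + 1 / 20 ℚ.- s ≡ (ι (+ 0) ℚ.- ι (+ 1)) ℚ.* (ι (+ 0) ℚ.- ι (+ 1)) ℚ.- s ℚ.- ℚ.- (+ 1 / 20)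
      above = solve-∀ ℚ-ring

  -- The tests met by a copy of the long progression

  module Copy (f : Configuration n m) (copy : IsCopy (ℓ m) f) where

    -- A common key is a congruence c + z ≡ c′ + z′ modulo `T`. The bound d ≤ m keeps both sides
    -- within less than `T`, which turns it into an equality, and 8 ≤ d refutes that equality by
    -- `far⇒unaligned`.
    separated : ∀ (i i′ : Fin m) c c′ d → toℕ i′ ≡ toℕ i + d → 8 ≤ d → d ≤ m → InCell (f i) c → InCell (f i′) c′ →
      Disjoint (keys (testAt c)) (keys (testAt c′))
    separated i i′ c c′ d i′≡i+d 8≤d d≤m x∈c y∈c′ a∈ a∈′ =
      apart (∈-keys⁻ c a∈) (∈-keys⁻ c′ a∈′)
        (Ev-instance (copy-sqdist {f = f} copy i i′ {1ℚ} 0<1 ∩ InCell⇒Near {f i} {f i′} c c′ x∈c y∈c′))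
      where
      square : (ι (+ toℕ i) ℚ.- ι (+ toℕ i′)) ℚ.* (ι (+ toℕ i) ℚ.- ι (+ toℕ i′)) ≡ ι (+ (d * d))
      square = trans (cong (λ x → (ι (+ toℕ i) ℚ.- x) ℚ.* (ι (+ toℕ i) ℚ.- x)) (trans (cong (λ x → ι (+ x)) i′≡i+d) (ι-+ (+ toℕ i) (+ d))))
        (trans (cancel (ι (+ toℕ i)) (ι (+ d))) (sym (ι-ℕ* d d)))
        where
        cancel : ∀ x d → (x ℚ.- (x ℚ.+ d)) ℚ.* (x ℚ.- (x ℚ.+ d)) ≡ d ℚ.* d
        cancel = solve-∀ ℚ-ring
      apart : ∀ {a} → (∃ λ z → Short z × a ≡ residue (c ⊕ z)) → (∃ λ z → Short z × a ≡ residue (c′ ⊕ z)) →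
        (∃ λ K → Within 1ℚ ((ι (+ toℕ i) ℚ.- ι (+ toℕ i′)) ℚ.* (ι (+ toℕ i) ℚ.- ι (+ toℕ i′)) ℚ.- sqdist (f i) (f i′) K) ×
          (∀ j → Near (scaled-diff (f i) (f i′) K j) (c j ℤ.- c′ j))) → ⊥
      apart (z , z-short , a≡) (z′ , z′-short , a≡′) (K , (d₁ , d₂) , near) =
        far⇒unaligned e c c′ near s ∑e² z z′ z-short z′-short 63≤s aligned
        where
        e : Vector ℚ n
        e = scaled-diff (f i) (f i′) K
        s : ℚ
        s = sqdist (f i) (f i′) K
        ∑e² : ∑ℚ (λ j → e j ℚ.* e j) ≡ κ ℚ.* κ ℚ.* s
        ∑e² = ∑-scaled-diff² (f i) (f i′) K
        63≤s : ι (+ 63) ℚ.≤ s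
        63≤s = begin
          ι (+ 63)                        ≤⟨ ℚ.+-monoˡ-≤ (ℚ.- 1ℚ) (ι-ℕ-≤ (ℕ.*-mono-≤ 8≤d 8≤d)) ⟩
          ι (+ (d * d)) ℚ.- 1ℚ          ≡⟨ cong (ℚ._- 1ℚ) square ⟨
          (ι (+ toℕ i) ℚ.- ι (+ toℕ i′)) ℚ.* (ι (+ toℕ i) ℚ.- ι (+ toℕ i′)) ℚ.- 1ℚ
                                          ≤⟨ ≤-cert _ (rearrange ((ι (+ toℕ i) ℚ.- ι (+ toℕ i′)) ℚ.* (ι (+ toℕ i) ℚ.- ι (+ toℕ i′))) s) (0≤-diff d₂) ⟩
          s                               ∎
          where
          open ℚ.≤-Reasoning
          rearrange : ∀ x s → s ℚ.- (x ℚ.- 1ℚ) ≡ 1ℚ ℚ.- (x ℚ.- s)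
          rearrange = solve-∀ ℚ-ring
        s≤ : s ℚ.≤ ι (+ m) ℚ.* ι (+ m) ℚ.+ 1ℚ
        s≤ = begin
          s                               ≤⟨ ≤-cert _ (rearrange ((ι (+ toℕ i) ℚ.- ι (+ toℕ i′)) ℚ.* (ι (+ toℕ i) ℚ.- ι (+ toℕ i′))) s) (0≤-diff d₁) ⟩
          (ι (+ toℕ i) ℚ.- ι (+ toℕ i′)) ℚ.* (ι (+ toℕ i) ℚ.- ι (+ toℕ i′)) ℚ.+ 1ℚ
                                          ≡⟨ cong (ℚ._+ 1ℚ) square ⟩
          ι (+ (d * d)) ℚ.+ 1ℚ          ≤⟨ ℚ.+-monoˡ-≤ 1ℚ (ι-ℕ-≤ (ℕ.*-mono-≤ d≤m d≤m)) ⟩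
          ι (+ (m * m)) ℚ.+ 1ℚ          ≡⟨ cong (ℚ._+ 1ℚ) (ι-ℕ* m m) ⟩
          ι (+ m) ℚ.* ι (+ m) ℚ.+ 1ℚ      ∎
          where
          open ℚ.≤-Reasoning
          rearrange : ∀ x s → x ℚ.+ 1ℚ ℚ.- s ≡ x ℚ.- s ℚ.- ℚ.- 1ℚ
          rearrange = solve-∀ ℚ-ring
        aligned : ∀ j → (c ⊕ z) j ≡ (c′ ⊕ z′) j
        aligned j = trans eq (trans (cong (λ q → (c′ ⊕ z′) j ℤ.+ + T ℤ.* q) (∣T*r∣<T⇒r≡0 q small))
            (trans (cong (λ x → (c′ ⊕ z′) j ℤ.+ x) (ℤ.*-zeroʳ (+ T))) (ℤ.+-identityʳ ((c′ ⊕ z′) j))))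
          where
          q : ℤ
          q = proj₁ (residue-≡⇒shift {c ⊕ z} {c′ ⊕ z′} (trans (sym a≡) a≡′) j)
          eq : (c ⊕ z) j ≡ (c′ ⊕ z′) j ℤ.+ + T ℤ.* q
          eq = proj₂ (residue-≡⇒shift {c ⊕ z} {c′ ⊕ z′} (trans (sym a≡) a≡′) j)
          open ℕ.≤-Reasoning
          solve-for : ∀ c z c′ z′ t → c ℤ.+ z ≡ c′ ℤ.+ z′ ℤ.+ t → t ≡ (c ℤ.- c′) ℤ.+ z ℤ.- z′
          solve-for c z c′ z′ t eq = trans (split c′ z′ t) (trans (cong (λ x → x ℤ.- c′ ℤ.- z′) (sym eq)) (join c z c′ z′))
            where
            split : ∀ c′ z′ t → t ≡ c′ ℤ.+ z′ ℤ.+ t ℤ.- c′ ℤ.- z′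
            split = ℤ-Solver.solve-∀
            join : ∀ c z c′ z′ → c ℤ.+ z ℤ.- c′ ℤ.- z′ ≡ (c ℤ.- c′) ℤ.+ z ℤ.- z′
            join = ℤ-Solver.solve-∀
          -- Of 16 T = 64 n m, the extent of the copy uses 40 n m; the other 24 n m exceed the short
          -- vectors and the slack.
          numbers : 18 + 40 * n * m + 16 * (suc (3 * n)) + 16 * (suc (3 * n)) < 16 * T
          numbers = begin-strict
            18 + 40 * n * m + 16 * (suc (3 * n)) + 16 * (suc (3 * n))
              ≡⟨ collect n m ⟩
            50 + 96 * n + 40 * n * m
              <⟨ ℕ.+-monoˡ-< (40 * n * m) (begin-strict
                   50 + 96 * n           <⟨ ℕ.+-monoˡ-< (96 * n) (ℕ.<-≤-trans (ℕ.<ᵇ⇒< 50 51 _) (ℕ.m≤m*n 51 n)) ⟩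
                   51 * n + 96 * n     ≡⟨ ℕ.*-distribʳ-+ n 51 96 ⟨
                   147 * n                 ≤⟨ ℕ.*-monoˡ-≤ n (ℕ.≤-trans (ℕ.≤ᵇ⇒≤ 147 1000 _) 1000≤m) ⟩
                   m * n                   ≤⟨ ℕ.m≤n*m (m * n) 24 ⟩
                   24 * (m * n)          ∎) ⟩
            24 * (m * n) + 40 * n * m
              ≡⟨ total n m ⟩
            16 * (4 * n * m)
              ≡⟨ cong (16 *_) T≡ ⟨
            16 * T
              ∎
            where
            collect : ∀ n m → 18 + 40 * n * m + 16 * (suc (3 * n)) + 16 * (suc (3 * n)) ≡ 50 + 96 * n + 40 * n * m
            collect = ℕ-Solver.solve-∀
            total : ∀ n m → 24 * (m * n) + 40 * n * m ≡ 16 * (4 * n * m)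
            total = ℕ-Solver.solve-∀
          component : ∀ (z : Vec ℤ n) → Short z → ℤ.∣ lookup z j ∣ ≤ suc (3 * n)
          component z short = ℕ.≤-trans (∣z∣≤1+excess² z j) (s≤s short)
          small : ℤ.∣ + T ℤ.* q ∣ < T
          small = ℕ.*-cancelˡ-< 16 _ _ (begin-strict
            16 * ℤ.∣ + T ℤ.* q ∣
              ≡⟨ cong (λ x → 16 * ℤ.∣ x ∣) (solve-for (c j) (lookup z j) (c′ j) (lookup z′ j) (+ T ℤ.* q) eq) ⟩
            16 * ℤ.∣ (c j ℤ.- c′ j) ℤ.+ lookup z j ℤ.- lookup z′ j ∣
              ≤⟨ ℕ.*-monoʳ-≤ 16 (ℕ.≤-trans (ℤ.∣i-j∣≤∣i∣+∣j∣ ((c j ℤ.- c′ j) ℤ.+ lookup z j) (lookup z′ j))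
                   (ℕ.+-monoˡ-≤ ℤ.∣ lookup z′ j ∣ (ℤ.∣i+j∣≤∣i∣+∣j∣ (c j ℤ.- c′ j) (lookup z j)))) ⟩
            16 * (ℤ.∣ c j ℤ.- c′ j ∣ + ℤ.∣ lookup z j ∣ + ℤ.∣ lookup z′ j ∣)
              ≡⟨ distrib ℤ.∣ c j ℤ.- c′ j ∣ ℤ.∣ lookup z j ∣ ℤ.∣ lookup z′ j ∣ ⟩
            16 * ℤ.∣ c j ℤ.- c′ j ∣ + 16 * ℤ.∣ lookup z j ∣ + 16 * ℤ.∣ lookup z′ j ∣
              ≤⟨ ℕ.+-mono-≤ (ℕ.+-mono-≤ (bounded⇒∣c-c′∣ e c c′ near s ∑e² m 0<m s≤ j)
                   (ℕ.*-monoʳ-≤ 16 (component z z-short))) (ℕ.*-monoʳ-≤ 16 (component z′ z′-short)) ⟩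
            18 + 40 * n * m + 16 * (suc (3 * n)) + 16 * (suc (3 * n))
              <⟨ numbers ⟩
            16 * T
              ∎)
            where
            distrib : ∀ a b c → 16 * (a + b + c) ≡ 16 * a + 16 * b + 16 * c
            distrib = ℕ-Solver.solve-∀

    i₀ i₁ : Fin m
    i₀ = fromℕ< 0<m
    i₁ = fromℕ< 1<m

    -- Rounding at scale 1 / (2 m) gives an error of 2 + 2 t ≤ 2 m at every index t < m. The spacing
    -- 16 of the cubes becomes 16 η = 32 m, which is `Q`.
    η : ℚ
    η = ι (+ (2 * m))

    start : ∀ j → ∃ λ S → Ev λ K → ι S ℚ.≤ η ℚ.* κ ℚ.* seq (f i₀ j) K × η ℚ.* κ ℚ.* seq (f i₀ j) K ℚ.≤ ι S ℚ.+ ι (+ 2)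
    start j = approximate (seq x) (cauchy x)
      where
      x : ℝ
      x = fromℚ (η ℚ.* κ) *ℝ f i₀ j

    step : ∀ j → ∃ λ U → Ev λ K → ι U ℚ.≤ η ℚ.* κ ℚ.* (seq (f i₁ j) K ℚ.- seq (f i₀ j) K) ×
      η ℚ.* κ ℚ.* (seq (f i₁ j) K ℚ.- seq (f i₀ j) K) ℚ.≤ ι U ℚ.+ ι (+ 2)
    step j = approximate (seq x) (cauchy x)
      where
      x : ℝ
      x = fromℚ (η ℚ.* κ) *ℝ (f i₁ j -ℝ f i₀ j)

    S U : Cell n
    S j = proj₁ (start j)
    U j = proj₁ (step j)

    cellAt : ℕ → Cell n
    cellAt i j = cell (S j) (U j) i

    16η≡Q : ι (+ 16) ℚ.* η ≡ ι (+ Q)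
    16η≡Q = trans (sym (ι-ℕ* 16 (2 * m))) (cong (λ x → ι (+ x)) (trans (sym (ℕ.*-assoc 16 2 m)) (sym Q≡)))

    -- The distances from `f i` to the first two points force it onto their line at parameter i, so
    -- the rounded start and step predict a cube containing it for every index at once.
    InCell-cellAt : ∀ i → InCell (f i) (cellAt (toℕ i))
    InCell-cellAt i j ε 0<ε = Ev-map
      (λ {K} → λ (xy , wy , xw , SK , UK) → line-in-cell η t (ι c) (ι (S j)) (ι (U j))
        (seq (f i₀ j) K) (seq (f i₁ j) K) (seq (f i j) K) ε 0<η (0≤ι (toℕ i)) fine SK UK c₁ c₂
        (collinear (λ j → seq (f i j) K) (λ j → seq (f i₀ j) K) (λ j → seq (f i₁ j) K) t δ ε (0≤ι (toℕ i)) (ℚ.<⇒≤ 0<ε) Cδ≡ε²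
          (subst (λ x → Within δ (x ℚ.- sqdist (f i) (f i₀) K)) t-0 xy)
          (subst (λ x → Within δ (x ℚ.- sqdist (f i₁) (f i₀) K)) 1-0 wy)
          (subst (λ x → Within δ (x ℚ.- sqdist (f i) (f i₁) K)) t-1 xw)
          j))
      (copy-sqdist {f = f} copy i i₀ {δ} 0<δ ∩ copy-sqdist {f = f} copy i₁ i₀ {δ} 0<δ ∩ copy-sqdist {f = f} copy i i₁ {δ} 0<δ ∩
        proj₂ (start j) ∩ proj₂ (step j))
      where
      t : ℚ
      t = ι (+ toℕ i)
      c : ℤ
      c = cellAt (toℕ i) j
      0<C : 0ℚ ℚ.< 1ℚ ℚ.+ ι (+ 3) ℚ.* t ℚ.+ t ℚ.* t
      0<C = ℚ.+-mono-<-≤ (ℚ.+-mono-<-≤ 0<1 (0≤-* (0≤ι 3) (0≤ι (toℕ i)))) (0≤-² t)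
      0<ε² : 0ℚ ℚ.< ε ℚ.* ε
      0<ε² = subst (ℚ._< ε ℚ.* ε) (ℚ.*-zeroʳ ε) (ℚ.*-monoʳ-<-pos ε {{ℚ.positive 0<ε}} 0<ε)
      tolerance : ∃ λ δ → 0ℚ ℚ.< δ × (1ℚ ℚ.+ ι (+ 3) ℚ.* t ℚ.+ t ℚ.* t) ℚ.* δ ≡ ε ℚ.* ε
      -- The tolerance for squared distances is the δ for which `collinear` returns exactly the
      -- error ε in each coordinate.
      tolerance = scaled _ _ 0<C 0<ε²
      δ : ℚ
      δ = proj₁ tolerance
      0<δ : 0ℚ ℚ.< δ
      0<δ = proj₁ (proj₂ tolerance)
      Cδ≡ε² : (1ℚ ℚ.+ ι (+ 3) ℚ.* t ℚ.+ t ℚ.* t) ℚ.* δ ≡ ε ℚ.* ε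
      Cδ≡ε² = proj₂ (proj₂ tolerance)
      ιi₀ : ι (+ toℕ i₀) ≡ 0ℚ
      ιi₀ = cong (λ x → ι (+ x)) (toℕ-fromℕ< 0<m)
      ιi₁ : ι (+ toℕ i₁) ≡ 1ℚ
      ιi₁ = cong (λ x → ι (+ x)) (toℕ-fromℕ< 1<m)
      t-0 : (t ℚ.- ι (+ toℕ i₀)) ℚ.* (t ℚ.- ι (+ toℕ i₀)) ≡ t ℚ.* t
      t-0 = trans (cong (λ x → (t ℚ.- x) ℚ.* (t ℚ.- x)) ιi₀) (minus-0 t)
        where
        minus-0 : ∀ t → (t ℚ.- 0ℚ) ℚ.* (t ℚ.- 0ℚ) ≡ t ℚ.* t
        minus-0 = solve-∀ ℚ-ring
      1-0 : (ι (+ toℕ i₁) ℚ.- ι (+ toℕ i₀)) ℚ.* (ι (+ toℕ i₁) ℚ.- ι (+ toℕ i₀)) ≡ 1ℚ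
      1-0 = cong₂ (λ x y → (x ℚ.- y) ℚ.* (x ℚ.- y)) ιi₁ ιi₀
      t-1 : (t ℚ.- ι (+ toℕ i₁)) ℚ.* (t ℚ.- ι (+ toℕ i₁)) ≡ (t ℚ.- 1ℚ) ℚ.* (t ℚ.- 1ℚ)
      t-1 = cong (λ x → (t ℚ.- x) ℚ.* (t ℚ.- x)) ιi₁
      0<η : 0ℚ ℚ.< η
      0<η = ι-mono-< (ℤ.+<+ (ℕ.<-≤-trans 0<m (ℕ.m≤n*m m 2)))
      fine : ι (+ 2) ℚ.+ ι (+ 2) ℚ.* t ℚ.≤ η
      fine = subst (ℚ._≤ η) (trans (ι-+ (+ 2) (+ (2 * toℕ i))) (cong (ι (+ 2) ℚ.+_) (ι-ℕ* 2 (toℕ i))))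
        (ι-ℕ-≤ (subst (_≤ 2 * m) (ℕ.*-suc 2 (toℕ i)) (ℕ.*-monoʳ-≤ 2 (toℕ<n i))))
      ι-line : ι (S j ℤ.+ + toℕ i ℤ.* U j) ≡ ι (S j) ℚ.+ t ℚ.* ι (U j)
      ι-line = trans (ι-+ (S j) (+ toℕ i ℤ.* U j)) (cong (ι (S j) ℚ.+_) (ι-* (+ toℕ i) (U j)))
      ι-Qc : ι (+ Q ℤ.* c) ≡ ι (+ 16) ℚ.* η ℚ.* ι c
      ι-Qc = trans (ι-* (+ Q) c) (cong (ℚ._* ι c) (sym 16η≡Q))
      c₁ : ι (+ 16) ℚ.* η ℚ.* ι c ℚ.≤ ι (S j) ℚ.+ t ℚ.* ι (U j)
      c₁ = subst₂ ℚ._≤_ ι-Qc ι-line (ι-mono-≤ (cell-lower (S j) (U j) (toℕ i)))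
      c₂ : ι (S j) ℚ.+ t ℚ.* ι (U j) ℚ.≤ ι (+ 16) ℚ.* η ℚ.* ι c ℚ.+ ι (+ 16) ℚ.* η
      c₂ = subst₂ ℚ._≤_ ι-line (trans (ι-+ (+ Q ℤ.* c) (+ Q)) (cong₂ ℚ._+_ ι-Qc (sym 16η≡Q)))
        (ι-mono-≤ (cell-upper (S j) (U j) (toℕ i)))

    code : Code
    code = tabulate λ j → S j ℤ.%ℕ P , U j ℤ.%ℕ P

    code∈codes : code ∈ codes
    code∈codes = ∈-vectors code λ j → subst (_∈ cartesianProduct (upTo P) (upTo P))
      (sym (lookup∘tabulate (λ j → S j ℤ.%ℕ P , U j ℤ.%ℕ P) j))
      (∈-cartesianProduct⁺ (∈-upTo⁺ (ℤ.n%ℕd<d (S j) P)) (∈-upTo⁺ (ℤ.n%ℕd<d (U j) P)))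

    -- The passage from the continuum to the finite list: the true cells and those of the code
    -- differ by multiples of `T`, which tests do not see.
    testAt-code : ∀ i → testAt (cellAt i) ≡ testAt (codeCell code i)
    testAt-code i = trans (testAt-shift (λ j → cellCode (S j ℤ.%ℕ P) (U j ℤ.%ℕ P) i) {λ j → shift (S j) (U j) i})
      (testAt-cong λ j → cong (λ (s , t) → cellCode s t i) (sym (lookup∘tabulate (λ j → S j ℤ.%ℕ P , U j ℤ.%ℕ P) j)))

    8l<m : ∀ {l} → l < M → 8 * l < m
    8l<m l<M = subst (_ <_) (sym m≡8M) (ℕ.*-monoʳ-< 8 l<M)

    InCell-8l : ∀ l (l<M : l < M) → InCell (f (fromℕ< (8l<m l<M))) (cellAt (8 * l))
    InCell-8l l l<M = subst (λ i → InCell (f (fromℕ< (8l<m l<M))) (cellAt i)) (toℕ-fromℕ< (8l<m l<M)) (InCell-cellAt (fromℕ< (8l<m l<M)))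

    disjoint : DisjointTests (tests code)
    disjoint = AllPairs.applyUpTo⁺₁ (λ l → testAt (codeCell code (8 * l))) M λ {l} {l′} l<l′ l′<M →
      subst₂ (λ t t′ → Disjoint (keys t) (keys t′)) (testAt-code (8 * l)) (testAt-code (8 * l′)) (pair l l′ l<l′ l′<M)
      where
      pair : ∀ l l′ → l < l′ → l′ < M → Disjoint (keys (testAt (cellAt (8 * l)))) (keys (testAt (cellAt (8 * l′))))
      pair l l′ l<l′ l′<M = separated (fromℕ< (8l<m l<M)) (fromℕ< (8l<m l′<M)) (cellAt (8 * l)) (cellAt (8 * l′)) (8 * (l′ ∸ l))
        (trans (toℕ-fromℕ< (8l<m l′<M)) (trans (cong (8 *_) (sym (ℕ.m+[n∸m]≡n (ℕ.<⇒≤ l<l′))))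
          (trans (ℕ.*-distribˡ-+ 8 l (l′ ∸ l)) (cong (_+ 8 * (l′ ∸ l)) (sym (toℕ-fromℕ< (8l<m l<M)))))))
        (ℕ.*-monoʳ-≤ 8 (ℕ.m<n⇒0<n∸m l<l′))
        (ℕ.≤-trans (ℕ.*-monoʳ-≤ 8 (ℕ.m∸n≤m l′ l)) (ℕ.<⇒≤ (8l<m l′<M)))
        (InCell-8l l l<M) (InCell-8l l′ l′<M)
        where
        l<M : l < M
        l<M = ℕ.<-trans l<l′ l′<M

    some-red : ∃ λ i → Red (f i)
    some-red =
      let (l , l<M , passes) = Any.applyUpTo⁻ (λ l → testAt (codeCell code (8 * l)))
            (proj₂ marking (∈-filter⁺ disjoint? (∈-map⁺ tests code∈codes) disjoint))
      in fromℕ< (8l<m l<M) , cellAt (8 * l) , InCell-8l l l<M , subst (Passes μ) (sym (testAt-code (8 * l))) passes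

  no-blue-copy : ¬ HasCopy χ blue (ℓ m)
  no-blue-copy (f , copy , all-blue) = let (i , red-i) = Copy.some-red f copy in
    blue⇒ (em {Red (f i)}) (all-blue i) red-i

  avoids : n ↛⟨ ℓ 2 , ℓ m ⟩
  avoids = χ , no-red-pair , no-blue-copy

avoiding-coloring : ExcludedMiddle 0ℓ → ∀ r m Q T → m ≡ 10 ^ (5 * suc r) → Q ≡ 32 * m → T ≡ 4 * suc r * m →
  suc r ↛⟨ ℓ 2 , ℓ m ⟩
avoiding-coloring em r m Q T m≡ Q≡ T≡ =
  let (k , lo , hi) = scale r in
  Construction.avoids em (suc r) m M L k (34 ^ suc r) Q T 1000≤m m≡8M lo hi refl Q≡ T≡ 4DL≤M 2[QT]^≤2^L
  where open Numbers r m Q T m≡ Q≡ T≡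

mainTheorem2 : ExcludedMiddle 0ℓ → (n : ℕ) → 1 ≤ n → n ↛⟨ ℓ 2 , ℓ (10 ^ (5 * n)) ⟩
mainTheorem2 em (suc r) _ = avoiding-coloring em r (10 ^ (5 * suc r)) _ _ refl refl refl
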